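{- Let $m,n,k$ be non-negative integers with $1\le k\le n$, let $q$ be an integer with $0\le q\le n-k+1$, and suppose $k\ne1$ or $m+q\ne1$. Then the sum over all $(m,n,k)$-Magog trapezoids with exactly $q$ minima of $P^{\#\text{maxima}}$ equals the constant term in $x_1,\dots,x_{m+n-1}$ of $$P^{[m=0]}\prod_{i=1}^{m+n-1}(1+x_i)^nx_i^{ -i-k+2}(1-x_i)^{ -1}\prod_{i=\max(m,1)}^{m+n-1}(1+x_i)^{m-i-1}(Px_i+1)\prod_{1\le i<j\le m+n-1}\frac{x_j-x_i}{1-x_ix_j}\times R,$$ where $$R=\sum_{i=1}^{k+m+q-2}(1+x_i)^{k+q-n-1}(1-x_i)\prod_{1\le j\le m+n-1,\ j\ne i}\frac{1-x_ix_j}{x_j-x_i}\quad\text{if }q\le n-k,\qquad R=1\quad\text{if }q=n-k+1.$$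
   Context: For non-negative integers $m,n,k$ with $k\le n$, an $(m,n,k)$-Magog trapezoid is an array $(m_{i,j})$ of positive integers indexed by $1\le j\le i\le n$ with $i-j\le k-1$ (the $k$ rightmost SE-diagonals of a triangular array with $n$ rows), such that $m_{i+1,j}\le m_{i,j}\le m_{i+1,j+1}$ whenever these entries exist and $m_{i,j}\le m+j$. A minimum is an entry equal to $1$ in the leftmost SE-diagonal $\{m_{i,j}:i-j=k-1\}$; a maximum is an entry $m_{j,j}$ with $m_{j,j}=m+j$. $P$ is an indeterminate; $[m=0]$ is $1$ if $m=0$ and $0$ otherwise. Negative powers of $(1+x_i)$, $(1-x_i)^{ -1}$ and $\frac{1}{1-x_ix_j}$ are expanded as power series in the variables with non-negative exponents. -}

module Defs where

open import Data.Bool using (Bool; true; false; if_then_else_)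
open import Data.Nat as ℕ using (ℕ; zero; suc; _∸_; _≤_; _<_; _⊔_; _≤?_; _<?_)
open import Data.Nat.Combinatorics using (_C_)
open import Data.Integer as ℤ using (ℤ; +_; -[1+_]; 0ℤ; 1ℤ; -1ℤ)
open import Data.Fin using (Fin; toℕ) renaming (zero to fz; suc to fs)
open import Data.Fin.Properties using (all?) renaming (_≟_ to _≟ᶠ_)
open import Data.Vec.Functional using (_∷_; head; tail)
open import Data.List using (List; []; [_]; map; concatMap; foldr; upTo; allFin; filter; cartesianProduct; length)
open import Data.Product using (_×_; _,_; proj₁; proj₂)
open import Relation.Nullary using (Dec; does; ¬_; ¬?)
open import Relation.Nullary.Decidable using (_×-dec_; _→-dec_)
open import Relation.Binary.PropositionalEquality using (_≡_)

-- Multivariate formal power series over ℤ in V variables: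
-- a coefficient for every exponent vector.

Series : ℕ → Set
Series V = (Fin V → ℕ) → ℤ

sumℤ : List ℤ → ℤ
sumℤ = foldr ℤ._+_ 0ℤ

below : ∀ V → (Fin V → ℕ) → List (Fin V → ℕ)
below zero    e = [ e ]
below (suc V) e = concatMap (λ c → map (c ∷_) (below V (tail e))) (upTo (suc (head e)))

vecEq? : ∀ {V} (e f : Fin V → ℕ) → Dec (∀ i → e i ≡ f i)
vecEq? e f = all? (λ i → e i ℕ.≟ f i)

total : ∀ {V} → (Fin V → ℕ) → ℕ
total {V} e = foldr ℕ._+_ 0 (map e (allFin V))

module _ {V : ℕ} where

  const : ℤ → Series V
  const c e = if does (vecEq? e (λ _ → 0)) then c else 0ℤ

  one : Series V
  one = const 1ℤ

  _+ₛ_ : Series V → Series V → Series V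
  (f +ₛ g) e = f e ℤ.+ g e

  _-ₛ_ : Series V → Series V → Series V
  (f -ₛ g) e = f e ℤ.- g e

  _*ₛ_ : Series V → Series V → Series V
  (f *ₛ g) e = sumℤ (map (λ a → f a ℤ.* g (λ i → e i ∸ a i)) (below V e))

  infixl 6 _+ₛ_ _-ₛ_
  infixl 7 _*ₛ_

  _^ₛ_ : Series V → ℕ → Series V
  f ^ₛ zero  = one
  f ^ₛ suc n = f *ₛ (f ^ₛ n)

  prodL : ∀ {A : Set} → List A → (A → Series V) → Series V
  prodL xs f = foldr (λ a acc → f a *ₛ acc) one xs

  sumL : ∀ {A : Set} → List A → (A → Series V) → Series V
  sumL xs f = foldr (λ a acc → f a +ₛ acc) (const 0ℤ) xs

  unit : Fin V → (Fin V → ℕ)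
  unit t s = if does (s ≟ᶠ t) then 1 else 0

  var : Fin V → Series V
  var t e = if does (vecEq? e (unit t)) then 1ℤ else 0ℤ

  -- Σ_d c(d) μ^d for a (nonzero) monomial μ: substitution of the monomial
  -- x^μ into the univariate power series Σ_d c(d) y^d.
  subst : (ℕ → ℤ) → (Fin V → ℕ) → Series V
  subst c μ e = sumℤ (map (λ d → if does (vecEq? e (λ i → d ℕ.* μ i)) then c d else 0ℤ)
                          (upTo (suc (total e))))

-- coefficients of (1+y)^z for z ∈ ℤ, expanded as a power series in y
genBinom : ℤ → ℕ → ℤ
genBinom (+ n)      d = + (n C d)
genBinom -[1+ r ]   d = (-1ℤ ℤ.^ d) ℤ.* + ((r ℕ.+ d) C d)

module _ {V : ℕ} where
  onePlusPow : Fin V → ℤ → Series V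
  onePlusPow t z = subst (genBinom z) (unit t)

  geom : Fin V → Series V
  geom t = subst (λ _ → 1ℤ) (unit t)

  geomPair : Fin V → Fin V → Series V
  geomPair s t = subst (λ _ → 1ℤ) (λ i → unit s i ℕ.+ unit t i)

-- Magog trapezoids.  An (m,n,k)-Magog trapezoid is encoded as an array
-- A : Fin n → Fin n → ℕ, where A i j (0-based i,j) is m_{i+1,j+1};
-- cells outside the trapezoid are required to be 0 (so the encoding is
-- a bijection).

-- (i,j) (0-based) lies in the k rightmost SE-diagonals: j ≤ i and i - j ≤ k-1
InT : (n k : ℕ) → Fin n → Fin n → Set
InT n k i j = (toℕ j ≤ toℕ i) × (toℕ i < toℕ j ℕ.+ k)

inT? : (n k : ℕ) → (i j : Fin n) → Dec (InT n k i j)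
inT? n k i j = (toℕ j ≤? toℕ i) ×-dec (toℕ i <? toℕ j ℕ.+ k)

Array : ℕ → Set
Array n = Fin n → Fin n → ℕ

IsMagog : (m n k : ℕ) → Array n → Set
IsMagog m n k A =
  (∀ i j → ¬ InT n k i j → A i j ≡ 0) ×
  (∀ i j → InT n k i j → (1 ≤ A i j) × (A i j ≤ m ℕ.+ suc (toℕ j))) ×
  (∀ i i' j → toℕ i' ≡ suc (toℕ i) → InT n k i j → InT n k i' j → A i' j ≤ A i j) ×
  (∀ i i' j j' → toℕ i' ≡ suc (toℕ i) → toℕ j' ≡ suc (toℕ j) →
     InT n k i j → InT n k i' j' → A i j ≤ A i' j')

isMagog? : (m n k : ℕ) → (A : Array n) → Dec (IsMagog m n k A)
isMagog? m n k A =
  all? (λ i → all? (λ j → ¬? (inT? n k i j) →-dec (A i j ℕ.≟ 0))) ×-dec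
  all? (λ i → all? (λ j → inT? n k i j →-dec ((1 ≤? A i j) ×-dec (A i j ≤? m ℕ.+ suc (toℕ j))))) ×-dec
  all? (λ i → all? (λ i' → all? (λ j →
     (toℕ i' ℕ.≟ suc (toℕ i)) →-dec (inT? n k i j →-dec (inT? n k i' j →-dec (A i' j ≤? A i j)))))) ×-dec
  all? (λ i → all? (λ i' → all? (λ j → all? (λ j' →
     (toℕ i' ℕ.≟ suc (toℕ i)) →-dec ((toℕ j' ℕ.≟ suc (toℕ j)) →-dec
       (inT? n k i j →-dec (inT? n k i' j' →-dec (A i j ≤? A i' j'))))))))

-- number of minima: entries equal to 1 on the leftmost SE-diagonal i - j = k - 1
minima : (n k : ℕ) → Array n → ℕ
minima n k A = length (filter (λ p → inT? n k (proj₁ p) (proj₂ p) ×-dec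
                                  ((toℕ (proj₁ p) ℕ.≟ toℕ (proj₂ p) ℕ.+ (k ∸ 1)) ×-dec
                                   (A (proj₁ p) (proj₂ p) ℕ.≟ 1)))
                              (cartesianProduct (allFin n) (allFin n)))

maxima : (m n : ℕ) → Array n → ℕ
maxima m n A = length (filter (λ j → A j j ℕ.≟ m ℕ.+ suc (toℕ j)) (allFin n))

allFuns : ∀ {A : Set} (d : ℕ) → List A → List (Fin d → A)
allFuns zero    xs = [ (λ ()) ]
allFuns (suc d) xs = concatMap (λ a → map (a ∷_) (allFuns d xs)) xs

allArrays : (m n : ℕ) → List (Array n)
allArrays m n = allFuns n (allFuns n (upTo (suc (m ℕ.+ n))))

magogGF : (m n k q : ℕ) → Series 1
magogGF m n k q =
  sumL (filter (λ A → isMagog? m n k A ×-dec (minima n k A ℕ.≟ q)) (allArrays m n))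
       (λ A → var fz ^ₛ maxima m n A)

-- Right-hand side.  Variables: index fz is P, index fs t is x_{t+1},
-- t : Fin (m+n-1).

module RHS (m n k q : ℕ) where
  N : ℕ
  N = m ℕ.+ n ∸ 1

  S : Set
  S = Series (suc N)

  P : S
  P = var fz

  x : Fin N → S
  x t = var (fs t)

  ι : Fin N → ℕ
  ι t = suc (toℕ t)

  xs : List (Fin N)
  xs = allFin N

  pairs : List (Fin N × Fin N)
  pairs = filter (λ p → toℕ (proj₁ p) <? toℕ (proj₂ p)) (cartesianProduct xs xs)

  Pm0 : S
  Pm0 = if does (m ℕ.≟ 0) then P else one

  -- ∏_i (1+x_i)^n (1-x_i)^{-1} · ∏_{i ≥ max(m,1)} (1+x_i)^{m-i-1} (P x_i + 1)
  -- (the monomials x_i^{-i-k+2} are handled in `constTerm` below)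
  common : S
  common = Pm0
        *ₛ prodL xs (λ t → onePlusPow (fs t) (+ n) *ₛ geom (fs t))
        *ₛ prodL (filter (λ t → (m ⊔ 1) ≤? ι t) xs)
                 (λ t → onePlusPow (fs t) (+ m ℤ.- + ι t ℤ.- 1ℤ) *ₛ (P *ₛ x t +ₛ one))

  cauchy : S
  cauchy = prodL pairs (λ p → geomPair (fs (proj₁ p)) (fs (proj₂ p)))

  vand : S
  vand = prodL pairs (λ p → x (proj₂ p) -ₛ x (proj₁ p))

  vandWithout : Fin N → S
  vandWithout r = prodL (filter (λ p → ¬? (proj₁ p ≟ᶠ r) ×-dec ¬? (proj₂ p ≟ᶠ r)) pairs)
                        (λ p → x (proj₂ p) -ₛ x (proj₁ p))

  -- (∏_{i<j} (x_j - x_i)) · R, with the exact division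
  -- ∏_{i<j}(x_j-x_i) / ∏_{j≠r}(x_j - x_r) = (-1)^{r-1} ∏_{i<j; i,j≠r}(x_j-x_i)
  -- carried out.
  vandR : S
  vandR = if does (q ℕ.≟ n ∸ k ℕ.+ 1) then vand else
    sumL (filter (λ t → ι t ℕ.+ 2 ≤? k ℕ.+ m ℕ.+ q) xs) (λ r →
         const (-1ℤ ℤ.^ toℕ r)
      *ₛ onePlusPow (fs r) (+ k ℤ.+ + q ℤ.- + n ℤ.- 1ℤ)
      *ₛ (one -ₛ x r)
      *ₛ prodL (filter (λ t → ¬? (t ≟ᶠ r)) xs) (λ t → one -ₛ x r *ₛ x t)
      *ₛ vandWithout r)

  F : S
  F = common *ₛ cauchy *ₛ vandR

  -- constant term in x_1,…,x_{m+n-1} of ∏_i x_i^{-(i+k-2)} · F,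
  -- i.e. the coefficient of ∏_i x_i^{i+k-2} in F, as a series in P.
  constTerm : Series 1
  constTerm e = F (e fz ∷ (λ t → toℕ t ℕ.+ (k ∸ 1)))

{-# OPTIONS --safe #-}
module Submission where

-- Let ℓ(i,c) be the number of entries of row i of a trapezoid that exceed c.
-- The inequalities of the trapezoid say that ℓ(i,c) weakly decreases in c and
-- grows by 0 or 1 from one row to the next, where column c may grow in row i
-- only if c ≤ m+i-1.  The entry m_{i,i} is a maximum iff the newest column
-- c = m+i-1 grows in row i (or m = 0 and i = 1), and there are exactly q minima
-- iff column 1 reaches length k in row k+q, or never does and q = n-k+1.
--
-- Take c+k-2-ℓ(i,c) as the exponent of x_c.  Then one row amounts to
-- multiplication by the product of the 1+x_c over the active columns c, with
-- 1+P x_c for the newest one.  The series involved are antisymmetric in the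
-- active variables, so their coefficients vanish where two exponents agree, and
-- only the strictly increasing exponents, that is, the trapezoids, contribute.
--
-- The series L(x) = ∏ 1/(1-x_i) ∏_{i<j} (x_j-x_i)/(1-x_i x_j) has coefficient 1
-- at all strictly increasing exponents.  This follows by induction from
-- (1 - ∏ x_j) L(x) = Σ_i (-1)^{i-1} (∏_{j≠i} x_j) L(x without x_i), which is
-- Lagrange interpolation of y ↦ ∏ (1-y x_j) at the x_i, evaluated at 0 and -1.
-- If q ≤ n-k, column 1 leaves the system in row k+q, and R expands the remaining
-- series along the column that leaves.

-- A row is symmetric only in the columns older than its newest one, which carries P. This does no
-- harm: the series that a row multiplies is made of later rows, where every column active now is
-- already older, so that series is antisymmetric in all columns active now. One row lowers an
-- exponent by at most 1, so neighbours that were strictly increasing can become equal but never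
-- cross.
--
-- The exit of column 1 would destroy antisymmetry if only that column were singled out. It is
-- therefore replaced by an alternating sum over all columns that are active before the exit row.
-- The summand for i does not involve x_i, so at strictly increasing exponents only the first column
-- survives, and only with exponent 0, that is, with length k-1. This is the origin of R and of its
-- range; the power of 1+x_i in R cancels the rows in which the leaving column no longer takes part.
--
-- For k = 1 and m+q = 1 column 1 would be the newest one when it leaves, with weight P, whereas R
-- would be an empty sum; this explains the excluded case.

-- Ring identities with integer coefficients.

module RingSolving where

  open import Algebra.Bundles using (CommutativeRing)
  import Algebra.Solver.Ring as RS
  import Algebra.Solver.Ring.AlmostCommutativeRing as ACR
  open import Data.Integer as ℤ using (ℤ; +_; -[1+_]; _⊖_)
  import Data.Integer.Properties as ℤₚ
  open import Data.Maybe using (Maybe; just; nothing)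
  open import Data.Nat as ℕ using (ℕ; zero; suc)
  import Data.Nat.Properties as ℕₚ
  open import Level using (0ℓ)
  open import Relation.Nullary using (yes; no)
  import Relation.Binary.PropositionalEquality as ≡

  CRing : Set₁
  CRing = CommutativeRing 0ℓ 0ℓ

  -- Integer coefficients let the solver see cancellations, which it cannot do
  -- with coefficients in a ring without decidable equality.
  module IntegerSolver (R : CRing) where
    open CommutativeRing R
    open import Algebra.Properties.Ring ring
    open import Algebra.Properties.Semiring.Mult.TCOptimised semiring
      using (1+×; ×-homo-+; ×1-homo-*) renaming (_×_ to _·_)
    open import Relation.Binary.Reasoning.Setoid setoid

    private
      embed : ℤ → Carrier
      embed (+ n)    = n · 1#
      embed -[1+ n ] = - (suc n · 1#)

      cancel-+ : ∀ a b c → (c + a) - (c + b) ≈ a - b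
      cancel-+ a b c = begin
        (c + a) + - (c + b)     ≈⟨ +-cong (+-comm c a) (trans (-‿cong (+-comm c b)) (sym (-‿+-comm b c))) ⟩
        (a + c) + (- b + - c)   ≈⟨ +-assoc a c _ ⟩
        a + (c + (- b + - c))   ≈⟨ +-congˡ (+-congˡ (+-comm (- b) (- c))) ⟩
        a + (c + (- c + - b))   ≈⟨ +-congˡ (+-assoc c (- c) (- b)) ⟨
        a + ((c - c) + - b)     ≈⟨ +-congˡ (+-congʳ (-‿inverseʳ c)) ⟩
        a + (0# + - b)          ≈⟨ +-congˡ (+-identityˡ (- b)) ⟩
        a - b ∎

      embed-⊖ : ∀ m n → embed (m ⊖ n) ≈ m · 1# - n · 1#
      embed-⊖ m zero = begin
        embed (m ⊖ 0)     ≡⟨ ≡.cong embed (ℤₚ.⊖-≥ {m} ℕ.z≤n) ⟩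
        m · 1#            ≈⟨ +-identityʳ _ ⟨
        m · 1# + 0#       ≈⟨ +-congˡ (-0#≈0#) ⟨
        m · 1# - 0# ∎
      embed-⊖ zero (suc n) = sym (+-identityˡ _)
      embed-⊖ (suc m) (suc n) = begin
        embed (suc m ⊖ suc n)  ≡⟨ ≡.cong embed (ℤₚ.[1+m]⊖[1+n]≡m⊖n m n) ⟩
        embed (m ⊖ n)          ≈⟨ embed-⊖ m n ⟩
        m · 1# - n · 1#        ≈⟨ cancel-+ _ _ 1# ⟨
        (1# + m · 1#) - (1# + n · 1#)  ≈⟨ +-cong (1+× m 1#) (-‿cong (1+× n 1#)) ⟨
        suc m · 1# - suc n · 1# ∎

      embed-neg : ∀ i → embed (ℤ.- i) ≈ - embed i
      embed-neg (+ zero)   = sym -0#≈0#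
      embed-neg (+ suc n)  = refl
      embed-neg -[1+ n ]   = sym (-‿involutive _)

      embed-+ : ∀ i j → embed (i ℤ.+ j) ≈ embed i + embed j
      embed-+ (+ m)    (+ n)    = ×-homo-+ 1# m n
      embed-+ (+ m)    -[1+ n ] = embed-⊖ m (suc n)
      embed-+ -[1+ m ] (+ n)    = trans (embed-⊖ n (suc m)) (+-comm _ _)
      embed-+ -[1+ m ] -[1+ n ] = begin
        - (suc (suc (m ℕ.+ n)) · 1#)       ≡⟨ ≡.cong (λ t → - (t · 1#)) (≡.cong suc (≡.sym (ℕₚ.+-suc m n))) ⟩
        - ((suc m ℕ.+ suc n) · 1#)         ≈⟨ -‿cong (×-homo-+ 1# (suc m) (suc n)) ⟩
        - (suc m · 1# + suc n · 1#)        ≈⟨ -‿+-comm _ _ ⟨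
        - (suc m · 1#) + - (suc n · 1#) ∎

      embed-pos* : ∀ m j → embed (+ m ℤ.* j) ≈ m · 1# * embed j
      embed-pos* m (+ n) = begin
        embed (+ m ℤ.* + n)  ≡⟨ ≡.cong embed (ℤₚ.pos-* m n) ⟨
        (m ℕ.* n) · 1#       ≈⟨ ×1-homo-* m n ⟩
        m · 1# * n · 1# ∎
      embed-pos* m -[1+ n ] = begin
        embed (+ m ℤ.* (ℤ.- (+ suc n)))   ≡⟨ ≡.cong embed (ℤₚ.neg-distribʳ-* (+ m) (+ suc n)) ⟨
        embed (ℤ.- (+ m ℤ.* + suc n))     ≈⟨ embed-neg (+ m ℤ.* + suc n) ⟩
        - embed (+ m ℤ.* + suc n)         ≡⟨ ≡.cong (λ t → - embed t) (ℤₚ.pos-* m (suc n)) ⟨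
        - ((m ℕ.* suc n) · 1#)            ≈⟨ -‿cong (×1-homo-* m (suc n)) ⟩
        - (m · 1# * suc n · 1#)           ≈⟨ -‿distribʳ-* _ _ ⟩
        m · 1# * - (suc n · 1#) ∎

      embed-* : ∀ i j → embed (i ℤ.* j) ≈ embed i * embed j
      embed-* (+ m) j = embed-pos* m j
      embed-* -[1+ m ] j = begin
        embed ((ℤ.- (+ suc m)) ℤ.* j)  ≡⟨ ≡.cong embed (ℤₚ.neg-distribˡ-* (+ suc m) j) ⟨
        embed (ℤ.- (+ suc m ℤ.* j))    ≈⟨ embed-neg (+ suc m ℤ.* j) ⟩
        - embed (+ suc m ℤ.* j)        ≈⟨ -‿cong (embed-pos* (suc m) j) ⟩
        - (suc m · 1# * embed j)       ≈⟨ -‿distribˡ-* _ _ ⟩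
        - (suc m · 1#) * embed j ∎

      target : ACR.AlmostCommutativeRing 0ℓ 0ℓ
      target = ACR.fromCommutativeRing R

      morphism : CommutativeRing.rawRing ℤₚ.+-*-commutativeRing ACR.-Raw-AlmostCommutative⟶ target
      morphism = record
        { ⟦_⟧    = embed
        ; +-homo = embed-+
        ; *-homo = embed-*
        ; -‿homo = embed-neg
        ; 0-homo = refl
        ; 1-homo = refl
        }

      _≟_ : ∀ i j → Maybe (embed i ≈ embed j)
      i ≟ j with i ℤ.≟ j
      ... | yes p = just (reflexive (≡.cong embed p))
      ... | no  _ = nothing

    open RS (CommutativeRing.rawRing ℤₚ.+-*-commutativeRing) target morphism _≟_ public
      using (solve; _:=_; _:+_; _:*_; _:-_; :-_; con)

-- Alternating sums, Lagrange interpolation and the recursion for L.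

module AlternatingSums where

  open RingSolving
  open import Algebra.Bundles using (CommutativeRing)
  open import Data.Integer using (+_)
  open import Data.List using (List; []; _∷_; length; map)
  open import Data.List.Relation.Binary.Permutation.Propositional
    using (_↭_; ↭-refl; ↭-trans; prep; swap)
  import Data.List.Relation.Binary.Permutation.Propositional as Perm
  open import Data.Nat using (_<_; s≤s)
  import Data.Nat.Properties as ℕₚ
  import Relation.Binary.PropositionalEquality as ≡
  open ≡ using (_≡_)

  -- The permutation relation on lists carries no sign, whereas an exchange of two neighbours always
  -- contributes exactly one; all antisymmetry statements are reduced to this case.
  data SwapAdj {I : Set} : List I → List I → Set where
    here  : ∀ {a b l} → SwapAdj (a ∷ b ∷ l) (b ∷ a ∷ l)
    there : ∀ {a l l′} → SwapAdj l l′ → SwapAdj (a ∷ l) (a ∷ l′)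

  SwapAdj⇒↭ : ∀ {I : Set} {l l′ : List I} → SwapAdj l l′ → l ↭ l′
  SwapAdj⇒↭ here      = swap _ _ ↭-refl
  SwapAdj⇒↭ (there s) = prep _ (SwapAdj⇒↭ s)

  SwapAdj-map : ∀ {I J : Set} (f : I → J) {l l′ : List I} → SwapAdj l l′ → SwapAdj (map f l) (map f l′)
  SwapAdj-map f here      = here
  SwapAdj-map f (there s) = there (SwapAdj-map f s)

  module ListAlgebra (R : CRing) where
    open CommutativeRing R
    open import Algebra.Properties.Ring ring
    open import Relation.Binary.Reasoning.Setoid setoid
    open IntegerSolver R

    ∏ : {I : Set} → (I → Carrier) → List I → Carrier
    ∏ f []       = 1#
    ∏ f (i ∷ is) = f i * ∏ f is

    ∑ : {I : Set} → (I → Carrier) → List I → Carrier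
    ∑ f []       = 0#
    ∑ f (i ∷ is) = f i + ∑ f is

    -- The alternating sum Σ_r (-1)^r h(i_r, is without i_r).
    altSum : {I : Set} → (I → List I → Carrier) → List I → Carrier
    altSum h []       = 0#
    altSum h (i ∷ is) = h i is - altSum (λ j js → h j (i ∷ js)) is

    module _ {I : Set} where

      ∏-cong : ∀ {f g : I → Carrier} → (∀ i → f i ≈ g i) → ∀ is → ∏ f is ≈ ∏ g is
      ∏-cong e []       = refl
      ∏-cong e (i ∷ is) = *-cong (e i) (∏-cong e is)

      ∏-* : ∀ (f g : I → Carrier) is → ∏ (λ i → f i * g i) is ≈ ∏ f is * ∏ g is
      ∏-* f g []       = sym (*-identityˡ 1#)
      ∏-* f g (i ∷ is) = begin
        f i * g i * ∏ (λ j → f j * g j) is ≈⟨ *-congˡ (∏-* f g is) ⟩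
        f i * g i * (∏ f is * ∏ g is)      ≈⟨ solve 4 (λ a b c d → a :* b :* (c :* d) := a :* c :* (b :* d)) refl _ _ _ _ ⟩
        f i * ∏ f is * (g i * ∏ g is) ∎

      ∏-1 : ∀ is → ∏ {I} (λ _ → 1#) is ≈ 1#
      ∏-1 []       = refl
      ∏-1 (i ∷ is) = trans (*-identityˡ _) (∏-1 is)

      ∏-↭ : ∀ (f : I → Carrier) {is js} → is ↭ js → ∏ f is ≈ ∏ f js
      ∏-↭ f Perm.refl          = refl
      ∏-↭ f (Perm.prep i p)    = *-congˡ (∏-↭ f p)
      ∏-↭ f (Perm.swap i j p)  = begin
        f i * (f j * _)  ≈⟨ *-congˡ (*-congˡ (∏-↭ f p)) ⟩
        f i * (f j * _)  ≈⟨ solve 3 (λ a b c → a :* (b :* c) := b :* (a :* c)) refl _ _ _ ⟩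
        f j * (f i * _) ∎
      ∏-↭ f (Perm.trans p q)   = trans (∏-↭ f p) (∏-↭ f q)

      ∏-map : ∀ {J : Set} (f : J → Carrier) (g : I → J) is → ∏ f (map g is) ≈ ∏ (λ i → f (g i)) is
      ∏-map f g []       = refl
      ∏-map f g (i ∷ is) = *-congˡ (∏-map f g is)

      -- Agreement is asked only where `i ∷ js` rearranges `is`. Inside a summand this allows a
      -- product over the whole list to be exchanged for the factor at `i` times the product over
      -- `js`.
      altSum-cong : ∀ {h h′ : I → List I → Carrier} is →
        (∀ i js → (i ∷ js) ↭ is → h i js ≈ h′ i js) → altSum h is ≈ altSum h′ is
      altSum-cong []       e = refl
      altSum-cong (x ∷ is) e = +-cong (e x is ↭-refl)
        (-‿cong (altSum-cong is (λ i js p → e i (x ∷ js) (↭-trans (swap i x ↭-refl) (prep x p)))))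

      altSum-scale : ∀ c (h : I → List I → Carrier) is → c * altSum h is ≈ altSum (λ i js → c * h i js) is
      altSum-scale c h []       = zeroʳ c
      altSum-scale c h (i ∷ is) = begin
        c * (h i is - altSum _ is)           ≈⟨ solve 3 (λ c a b → c :* (a :- b) := c :* a :- c :* b) refl _ _ _ ⟩
        c * h i is - c * altSum _ is         ≈⟨ +-congˡ (-‿cong (altSum-scale c _ is)) ⟩
        c * h i is - altSum (λ j js → c * h j (i ∷ js)) is ∎

      altSum-sub : ∀ (h h′ : I → List I → Carrier) is →
        altSum (λ i js → h i js - h′ i js) is ≈ altSum h is - altSum h′ is
      altSum-sub h h′ []       = sym (-‿inverseʳ 0#)
      altSum-sub h h′ (i ∷ is) = begin
        (h i is - h′ i is) - altSum (λ j js → h j (i ∷ js) - h′ j (i ∷ js)) is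
          ≈⟨ +-congˡ (-‿cong (altSum-sub _ _ is)) ⟩
        (h i is - h′ i is) - (altSum _ is - altSum _ is)
          ≈⟨ solve 4 (λ a b c d → (a :- b) :- (c :- d) := (a :- c) :- (b :- d)) refl _ _ _ _ ⟩
        (h i is - altSum _ is) - (h′ i is - altSum _ is) ∎

      -- The two terms that pick out an exchanged element trade places, and their signs differ;
      -- every other term changes sign by `anti`.
      altSum-swap : ∀ (h : I → List I → Carrier) →
        (∀ i {js ks} → SwapAdj js ks → h i js ≈ - h i ks) →
        ∀ {is ls} → SwapAdj is ls → altSum h is ≈ - altSum h ls
      altSum-swap h anti {a ∷ b ∷ l} here = begin
        h a (b ∷ l) - (h b (a ∷ l) - S a b)
          ≈⟨ +-congˡ (-‿cong (+-congˡ (-‿cong (trans (altSum-cong l (λ j js _ → anti j here)) (neg l))))) ⟩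
        h a (b ∷ l) - (h b (a ∷ l) - - S b a)
          ≈⟨ solve 3 (λ x y s → x :- (y :- :- s) := :- (y :- (x :- s))) refl _ _ _ ⟩
        - (h b (a ∷ l) - (h a (b ∷ l) - S b a)) ∎
        where
        S : I → I → Carrier
        S a b = altSum (λ j js → h j (a ∷ b ∷ js)) l
        neg : ∀ {h : I → List I → Carrier} is → altSum (λ j js → - h j js) is ≈ - altSum h is
        neg []       = sym -0#≈0#
        neg (i ∷ is) = trans (+-congˡ (-‿cong (neg is)))
          (solve 2 (λ x s → :- x :- :- s := :- (x :- s)) refl _ _)
      altSum-swap h anti {a ∷ is} {_ ∷ ls} (there s) = begin
        h a is - altSum (λ j js → h j (a ∷ js)) is
          ≈⟨ +-cong (anti a s) (-‿cong (altSum-swap _ (λ i t → anti i (there t)) s)) ⟩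
        - h a ls - - altSum (λ j js → h j (a ∷ js)) ls
          ≈⟨ solve 2 (λ x s → :- x :- :- s := :- (x :- s)) refl _ _ ⟩
        - (h a ls - altSum (λ j js → h j (a ∷ js)) ls) ∎

      altSum-map : ∀ {J : Set} (h : J → List J → Carrier) (g : I → J) is →
        altSum h (map g is) ≈ altSum (λ i js → h (g i) (map g js)) is
      altSum-map h g []       = refl
      altSum-map h g (i ∷ is) = +-congˡ (-‿cong (altSum-map _ g is))

    module Vandermonde {I : Set} (x : I → Carrier) where

      vandermonde : List I → Carrier
      vandermonde []       = 1#
      vandermonde (i ∷ is) = ∏ (λ j → x j - x i) is * vandermonde is

      private
        V : List I → Carrier
        V = vandermonde

        shift : Carrier → List I → Carrier
        shift z = ∏ (λ j → x j - z)

        dual : List I → Carrier → Carrier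
        dual bs y = ∏ (λ b → 1# - y * x b) bs

        -- lagrange z bs is / vandermonde is is the value at z of the polynomial
        -- interpolating dual bs at the points x i, i ∈ is.
        lagrange : Carrier → List I → List I → Carrier
        lagrange z bs = altSum (λ i js → dual bs (x i) * (shift z js * V js))

        -- Up to sign and the Vandermonde factor, the divided difference of `dual bs` at the nodes.
        -- On `i ∷ is` it unfolds to the value at `x i` minus what the nodes `is` interpolate there,
        -- both times `V is`; the inductions below use it in this form.
        leading : List I → List I → Carrier
        leading bs = altSum (λ i js → dual bs (x i) * V js)

        -- At a node, 1 - x_i x_b = (1 - z x_b) - x_b (x_i - z), and the factor x_i - z completes
        -- `shift z js` to `shift z is`, which does not depend on `i` and leaves the sum.
        lagrange-∷ : ∀ z b bs is → lagrange z (b ∷ bs) is ≈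
          (1# - z * x b) * lagrange z bs is - x b * shift z is * leading bs is
        lagrange-∷ z b bs is = begin
          lagrange z (b ∷ bs) is
            ≈⟨ altSum-cong is (λ i js p → begin
                 (1# - x i * x b) * d i * (shift z js * V js)
                   ≈⟨ solve 6 (λ xi xb d s v z → (con (+ 1) :- xi :* xb) :* d :* (s :* v)
                        := (con (+ 1) :- z :* xb) :* (d :* (s :* v)) :- xb :* ((xi :- z) :* s) :* (d :* v))
                        refl (x i) (x b) (d i) (shift z js) (V js) z ⟩
                 (1# - z * x b) * (d i * (shift z js * V js)) - x b * ((x i - z) * shift z js) * (d i * V js)
                   ≈⟨ +-congˡ (-‿cong (*-congʳ (*-congˡ (∏-↭ (λ j → x j - z) p)))) ⟩
                 (1# - z * x b) * (d i * (shift z js * V js)) - x b * shift z is * (d i * V js) ∎) ⟩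
          altSum (λ i js → (1# - z * x b) * (d i * (shift z js * V js)) - x b * shift z is * (d i * V js)) is
            ≈⟨ altSum-sub _ _ is ⟩
          altSum (λ i js → (1# - z * x b) * (d i * (shift z js * V js))) is
            - altSum (λ i js → x b * shift z is * (d i * V js)) is
            ≈⟨ +-cong (altSum-scale _ _ is) (-‿cong (altSum-scale _ _ is)) ⟨
          (1# - z * x b) * lagrange z bs is - x b * shift z is * leading bs is ∎
          where
          d : I → Carrier
          d i = dual bs (x i)

        -- The constant 1 interpolates to itself. Writing x_i - z = (x_j - z) - (x_j - x_i) splits
        -- the tail into two interpolations of 1 at the nodes `is`, with arguments x_i and z.
        lagrange-[] : ∀ z i is → lagrange z [] (i ∷ is) ≈ V (i ∷ is)
        lagrange-[] z i [] = solve 0 (con (+ 1) :* (con (+ 1) :* con (+ 1)) :- con (+ 0) := con (+ 1) :* con (+ 1)) refl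
        lagrange-[] z i (k ∷ ks) = begin
          1# * (A * V is) - altSum (λ j js → 1# * ((x i - z) * shift z js * (shift (x i) js * V js))) is
            ≈⟨ +-cong (*-identityˡ _) (-‿cong (altSum-cong is (λ j js p → begin
                 1# * ((x i - z) * shift z js * (shift (x i) js * V js))
                   ≈⟨ solve 6 (λ xi xj z s t v → con (+ 1) :* ((xi :- z) :* s :* (t :* v))
                        := (xj :- z) :* s :* (con (+ 1) :* (t :* v)) :- (xj :- xi) :* t :* (con (+ 1) :* (s :* v)))
                        refl (x i) (x j) z (shift z js) (shift (x i) js) (V js) ⟩
                 (x j - z) * shift z js * (1# * (shift (x i) js * V js))
                   - (x j - x i) * shift (x i) js * (1# * (shift z js * V js))
                   ≈⟨ +-cong (*-congʳ (∏-↭ (λ l → x l - z) p)) (-‿cong (*-congʳ (∏-↭ (λ l → x l - x i) p))) ⟩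
                 A * (1# * (shift (x i) js * V js)) - B * (1# * (shift z js * V js)) ∎))) ⟩
          A * V is - altSum (λ j js → A * (1# * (shift (x i) js * V js)) - B * (1# * (shift z js * V js))) is
            ≈⟨ +-congˡ (-‿cong (altSum-sub (λ j js → A * hA j js) (λ j js → B * hB j js) is)) ⟩
          A * V is - (altSum (λ j js → A * (1# * (shift (x i) js * V js))) is
                      - altSum (λ j js → B * (1# * (shift z js * V js))) is)
            ≈⟨ +-congˡ (-‿cong (+-cong (altSum-scale A hA is) (-‿cong (altSum-scale B hB is)))) ⟨
          A * V is - (A * lagrange (x i) [] is - B * lagrange z [] is)
            ≈⟨ +-congˡ (-‿cong (+-cong (*-congˡ (lagrange-[] (x i) k ks)) (-‿cong (*-congˡ (lagrange-[] z k ks))))) ⟩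
          A * V is - (A * V is - B * V is)
            ≈⟨ solve 3 (λ a b v → a :* v :- (a :* v :- b :* v) := b :* v) refl A B (V is) ⟩
          B * V is ∎
          where
          is = k ∷ ks
          A B : Carrier
          A = shift z is
          B = shift (x i) is
          hA hB : I → List I → Carrier
          hA j js = 1# * (shift (x i) js * V js)
          hB j js = 1# * (shift z js * V js)

        -- Interpolation is exact when the degree is below the number of nodes: the divided
        -- difference in `lagrange-∷` then vanishes by induction.
        lagrange-< : ∀ z bs is → length bs < length is → lagrange z bs is ≈ dual bs z * V is
        lagrange-< z bs [] ()
        lagrange-< z [] (i ∷ is) lt = trans (lagrange-[] z i is) (sym (*-identityˡ _))
        lagrange-< z (b ∷ bs) (i ∷ is) (s≤s lt) = begin
          lagrange z (b ∷ bs) (i ∷ is)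
            ≈⟨ lagrange-∷ z b bs (i ∷ is) ⟩
          (1# - z * x b) * lagrange z bs (i ∷ is) - x b * shift z (i ∷ is) * (dual bs (x i) * V is - lagrange (x i) bs is)
            ≈⟨ +-cong (*-congˡ (lagrange-< z bs (i ∷ is) (ℕₚ.m≤n⇒m≤1+n lt)))
                      (-‿cong (*-congˡ (+-congˡ (-‿cong (lagrange-< (x i) bs is lt))))) ⟩
          (1# - z * x b) * (dual bs z * V (i ∷ is)) - x b * shift z (i ∷ is) * (dual bs (x i) * V is - dual bs (x i) * V is)
            ≈⟨ solve 5 (λ a d v s e → a :* (d :* v) :- s :* (e :- e) := a :* d :* v) refl _ _ _ _ _ ⟩
          (1# - z * x b) * dual bs z * V (i ∷ is) ∎

        -- When the degree equals the number n of nodes, the error is the top coefficient times the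
        -- nodal polynomial; each has the sign (-1)^n relative to `∏ x bs` and `shift z is`, and the
        -- signs cancel.
        lagrange-≡ : ∀ z bs is → length bs ≡ length is →
          lagrange z bs is ≈ (dual bs z - ∏ x bs * shift z is) * V is
        lagrange-≡ z [] [] eq = solve 0 (con (+ 0) := (con (+ 1) :- con (+ 1) :* con (+ 1)) :* con (+ 1)) refl
        lagrange-≡ z (b ∷ bs) (i ∷ is) eq = begin
          lagrange z (b ∷ bs) (i ∷ is)
            ≈⟨ lagrange-∷ z b bs (i ∷ is) ⟩
          (1# - z * x b) * lagrange z bs (i ∷ is) - x b * shift z (i ∷ is) * (dual bs (x i) * V is - lagrange (x i) bs is)
            ≈⟨ +-cong (*-congˡ (lagrange-< z bs (i ∷ is) (s≤s (ℕₚ.≤-reflexive eq′))))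
                      (-‿cong (*-congˡ (+-congˡ (-‿cong (lagrange-≡ (x i) bs is eq′))))) ⟩
          (1# - z * x b) * (dual bs z * (shift (x i) is * V is))
            - x b * shift z (i ∷ is) * (dual bs (x i) * V is - (dual bs (x i) - ∏ x bs * shift (x i) is) * V is)
            ≈⟨ solve 8 (λ a d t v xb s e p → a :* (d :* (t :* v)) :- xb :* s :* (e :* v :- (e :- p :* t) :* v)
                 := (a :* d :- xb :* p :* s) :* (t :* v)) refl
                 (1# - z * x b) (dual bs z) (shift (x i) is) (V is) (x b) (shift z (i ∷ is)) (dual bs (x i)) (∏ x bs) ⟩
          ((1# - z * x b) * dual bs z - x b * ∏ x bs * shift z (i ∷ is)) * (shift (x i) is * V is) ∎
          where
          eq′ : length bs ≡ length is
          eq′ = ℕₚ.suc-injective eq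

        shift-0 : ∀ is → shift 0# is ≈ ∏ x is
        shift-0 = ∏-cong (λ i → solve 1 (λ a → a :- con (+ 0) := a) refl (x i))

        -- The factor 1 + x_j is spelled x_j - (-1), which makes this product literally `shift` at
        -- -1, so that the interpolation lemmas apply to it directly.
        plus : List I → Carrier
        plus = ∏ (λ j → x j - - 1#)

        dual-0 : ∀ bs → dual bs 0# ≈ 1#
        dual-0 bs = trans (∏-cong (λ b → solve 1 (λ a → con (+ 1) :- con (+ 0) :* a := con (+ 1)) refl (x b)) bs) (∏-1 bs)

        dual-neg1 : ∀ bs → dual bs (- 1#) ≈ plus bs
        dual-neg1 = ∏-cong (λ b → solve 1 (λ a → con (+ 1) :- (:- con (+ 1)) :* a := a :- :- con (+ 1)) refl (x b))

      -- Interpolation at the points 0 and -1 of y ↦ ∏_{b ∈ is} (1 - y x_b).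
      plus*peel : ∀ is → plus is * altSum (λ i js → (1# - x i) * (∏ x js * dual js (x i)) * V js) is
                  ≈ plus is * ((1# - ∏ x is) * V is)
      plus*peel is = begin
        A * altSum (λ i js → (1# - x i) * (∏ x js * dual js (x i)) * V js) is
          ≈⟨ altSum-scale A _ is ⟩
        altSum (λ i js → A * ((1# - x i) * (∏ x js * dual js (x i)) * V js)) is
          ≈⟨ altSum-cong is (λ i js p → begin
               A * ((1# - x i) * (∏ x js * dual js (x i)) * V js)
                 ≈⟨ *-congʳ (∏-↭ (λ j → x j - - 1#) p) ⟨
               (x i - - 1#) * plus js * ((1# - x i) * (∏ x js * dual js (x i)) * V js)
                 -- From 1 + x_i and 1 - x_i comes the factor 1 - x_i x_i that `dual js (x i)` lacks
                 -- to be `dual is (x i)`. The split 1 = (1 + x_i) - x_i then yields one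
                 -- interpolation at 0 and one at -1.
                 ≈⟨ solve 5 (λ xi q X d v →
                      (xi :- :- con (+ 1)) :* q :* ((con (+ 1) :- xi) :* (X :* d) :* v)
                      := (xi :- :- con (+ 1)) :* q :* ((con (+ 1) :- xi :* xi) :* d :* (X :* v))
                         :- xi :* X :* ((con (+ 1) :- xi :* xi) :* d :* (q :* v)))
                      refl (x i) (plus js) (∏ x js) (dual js (x i)) (V js) ⟩
               (x i - - 1#) * plus js * (dual (i ∷ js) (x i) * (∏ x js * V js))
                 - x i * ∏ x js * (dual (i ∷ js) (x i) * (plus js * V js))
                 ≈⟨ +-cong (*-cong (∏-↭ _ p) (*-cong (∏-↭ _ p) (*-congʳ (sym (shift-0 js)))))
                           (-‿cong (*-cong (∏-↭ x p) (*-congʳ (∏-↭ _ p)))) ⟩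
               A * (dual is (x i) * (shift 0# js * V js)) - X * (dual is (x i) * (plus js * V js)) ∎) ⟩
        altSum (λ i js → A * (dual is (x i) * (shift 0# js * V js)) - X * (dual is (x i) * (plus js * V js))) is
          ≈⟨ altSum-sub _ _ is ⟩
        altSum (λ i js → A * (dual is (x i) * (shift 0# js * V js))) is - altSum (λ i js → X * (dual is (x i) * (plus js * V js))) is
          ≈⟨ +-cong (altSum-scale A _ is) (-‿cong (altSum-scale X _ is)) ⟨
        A * lagrange 0# is is - X * lagrange (- 1#) is is
          ≈⟨ +-cong (*-congˡ (lagrange-≡ 0# is is ≡.refl)) (-‿cong (*-congˡ (lagrange-≡ (- 1#) is is ≡.refl))) ⟩
        A * ((dual is 0# - X * shift 0# is) * V is) - X * ((dual is (- 1#) - X * plus is) * V is)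
          ≈⟨ +-cong (*-congˡ (*-congʳ (+-cong (dual-0 is) (-‿cong (*-congˡ (shift-0 is))))))
                    (-‿cong (*-congˡ (*-congʳ (+-congʳ (dual-neg1 is))))) ⟩
        A * ((1# - X * X) * V is) - X * ((A - X * A) * V is)
          ≈⟨ solve 3 (λ a X v → a :* ((con (+ 1) :- X :* X) :* v) :- X :* ((a :- X :* a) :* v)
               := a :* ((con (+ 1) :- X) :* v)) refl A X (V is) ⟩
        A * ((1# - X) * V is) ∎
        where
        A X : Carrier
        A = plus is
        X = ∏ x is

      vandermonde-swap : ∀ {is js} → SwapAdj is js → V is ≈ - V js
      vandermonde-swap {a ∷ b ∷ l} here =
        solve 5 (λ p q r s t → (q :- p) :* r :* (s :* t) := :- ((p :- q) :* s :* (r :* t))) refl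
          (x a) (x b) _ _ _
      vandermonde-swap {a ∷ is} {_ ∷ js} (there s) = begin
        shift (x a) is * V is    ≈⟨ *-cong (∏-↭ _ (SwapAdj⇒↭ s)) (vandermonde-swap s) ⟩
        shift (x a) js * - V js  ≈⟨ -‿distribʳ-* _ _ ⟨
        - (shift (x a) js * V js) ∎

      module Littlewood
        (geo : I → Carrier) (geo-inv : ∀ i → (1# - x i) * geo i ≈ 1#)
        (gp : I → I → Carrier) (gp-inv : ∀ i j → (1# - x i * x j) * gp i j ≈ 1#)
        (pl : I → Carrier) (pl-inv : ∀ i → (x i - - 1#) * pl i ≈ 1#) where

        inv-unique : ∀ {a b c} → a * b ≈ 1# → a * c ≈ 1# → b ≈ c
        inv-unique {a} {b} {c} p q = begin
          b            ≈⟨ *-identityʳ b ⟨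
          b * 1#       ≈⟨ *-congˡ q ⟨
          b * (a * c)  ≈⟨ solve 3 (λ a b c → b :* (a :* c) := a :* b :* c) refl a b c ⟩
          a * b * c    ≈⟨ *-congʳ p ⟩
          1# * c       ≈⟨ *-identityˡ c ⟩
          c ∎

        gp-sym : ∀ i j → gp i j ≈ gp j i
        gp-sym i j = inv-unique (gp-inv i j)
          (trans (*-congʳ (+-congˡ (-‿cong (*-comm (x i) (x j))))) (gp-inv j i))

        cauchy : List I → Carrier
        cauchy []       = 1#
        cauchy (i ∷ is) = geo i * ∏ (gp i) is * cauchy is

        -- By Littlewood's identity `cauchy` is the sum of all Schur polynomials in these variables,
        -- so this product is the sum of all alternants.
        littlewood : List I → Carrier
        littlewood is = cauchy is * V is

        cauchy-↭ : ∀ {is js} → is ↭ js → cauchy is ≈ cauchy js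
        cauchy-↭ Perm.refl         = refl
        cauchy-↭ (Perm.prep i p)   = *-cong (*-congˡ (∏-↭ _ p)) (cauchy-↭ p)
        cauchy-↭ {_ ∷ _ ∷ l} {_ ∷ _ ∷ l′} (Perm.swap i j p)  = begin
          geo i * (gp i j * ∏ (gp i) l) * (geo j * ∏ (gp j) l * cauchy l)
            ≈⟨ *-cong (*-congˡ (*-cong (gp-sym i j) (∏-↭ _ p))) (*-cong (*-congˡ (∏-↭ _ p)) (cauchy-↭ p)) ⟩
          geo i * (gp j i * ∏ (gp i) l′) * (geo j * ∏ (gp j) l′ * cauchy l′)
            ≈⟨ solve 6 (λ a b c d e f → a :* (b :* c) :* (d :* e :* f) := d :* (b :* e) :* (a :* c :* f)) refl _ _ _ _ _ _ ⟩
          geo j * (gp j i * ∏ (gp j) l′) * (geo i * ∏ (gp i) l′ * cauchy l′) ∎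
        cauchy-↭ (Perm.trans p q)  = trans (cauchy-↭ p) (cauchy-↭ q)

        littlewood-swap : ∀ {is js} → SwapAdj is js → littlewood is ≈ - littlewood js
        littlewood-swap s = trans (*-cong (cauchy-↭ (SwapAdj⇒↭ s)) (vandermonde-swap s)) (sym (-‿distribʳ-* _ _))

        cauchy-cancel : ∀ i js → ((1# - x i) * dual js (x i)) * (geo i * ∏ (gp i) js) ≈ 1#
        cauchy-cancel i js = begin
          ((1# - x i) * dual js (x i)) * (geo i * ∏ (gp i) js)
            ≈⟨ solve 4 (λ a b c d → a :* b :* (c :* d) := (a :* c) :* (b :* d)) refl _ _ _ _ ⟩
          ((1# - x i) * geo i) * (dual js (x i) * ∏ (gp i) js)
            ≈⟨ *-cong (geo-inv i) (trans (sym (∏-* _ _ js)) (trans (∏-cong (gp-inv i) js) (∏-1 js))) ⟩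
          1# * 1# ≈⟨ *-identityˡ 1# ⟩
          1# ∎

        -- The factor (1 - x_i) ∏ (1 - x_i x_j) cancels exactly the factors by which `cauchy is`
        -- differs from `cauchy js`. The coefficients `c` are left free because the same step serves
        -- both the recursion for L and the expansion of R.
        cauchy*altSum : ∀ (c : I → List I → Carrier) is →
          cauchy is * altSum (λ i js → c i js * ((1# - x i) * ∏ (λ j → 1# - x i * x j) js) * V js) is
            ≈ altSum (λ i js → c i js * littlewood js) is
        cauchy*altSum c is = trans (altSum-scale _ _ is) (altSum-cong is (λ i js p → begin
          cauchy is * (c i js * ((1# - x i) * dual js (x i)) * V js)
            ≈⟨ *-congʳ (cauchy-↭ p) ⟨
          geo i * ∏ (gp i) js * cauchy js * (c i js * ((1# - x i) * dual js (x i)) * V js)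
            ≈⟨ solve 5 (λ g y c d v → g :* y :* (c :* d :* v) := (d :* g) :* (c :* (y :* v))) refl
                 (geo i * ∏ (gp i) js) (cauchy js) (c i js) _ (V js) ⟩
          ((1# - x i) * dual js (x i)) * (geo i * ∏ (gp i) js) * (c i js * (cauchy js * V js))
            ≈⟨ *-congʳ (cauchy-cancel i js) ⟩
          1# * (c i js * littlewood js)
            ≈⟨ *-identityˡ _ ⟩
          c i js * littlewood js ∎))

        littlewood-peel : ∀ is → (1# - ∏ x is) * littlewood is ≈ altSum (λ i js → ∏ x js * littlewood js) is
        littlewood-peel is = begin
          (1# - ∏ x is) * (cauchy is * V is)
            ≈⟨ solve 3 (λ a c v → a :* (c :* v) := c :* (a :* v)) refl _ _ _ ⟩
          cauchy is * ((1# - ∏ x is) * V is)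
            ≈⟨ *-congˡ (cancel-plus (plus*peel is)) ⟨
          cauchy is * altSum (λ i js → (1# - x i) * (∏ x js * dual js (x i)) * V js) is
            ≈⟨ *-congˡ (altSum-cong is (λ i js _ →
                 solve 4 (λ a b d v → a :* (b :* d) :* v := b :* (a :* d) :* v) refl _ _ _ _)) ⟩
          cauchy is * altSum (λ i js → ∏ x js * ((1# - x i) * dual js (x i)) * V js) is
            ≈⟨ cauchy*altSum (λ _ → ∏ x) is ⟩
          altSum (λ i js → ∏ x js * littlewood js) is ∎
          where
          plus-inv : ∀ is → plus is * ∏ pl is ≈ 1#
          plus-inv is = trans (sym (∏-* _ _ is)) (trans (∏-cong pl-inv is) (∏-1 is))
          cancel-plus : ∀ {a b} → plus is * a ≈ plus is * b → a ≈ b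
          cancel-plus {a} {b} e = begin
            a                          ≈⟨ lemma a ⟨
            ∏ pl is * (plus is * a)    ≈⟨ *-congˡ e ⟩
            ∏ pl is * (plus is * b)    ≈⟨ lemma b ⟩
            b ∎
            where
            lemma : ∀ c → ∏ pl is * (plus is * c) ≈ c
            lemma c = trans (solve 3 (λ q p c → q :* (p :* c) := p :* q :* c) refl _ _ _)
                       (trans (*-congʳ (plus-inv is)) (*-identityˡ c))

-- Power series in several variables as iterated univariate series.

module PowerSeriesTower where

  open RingSolving
  open AlternatingSums
  open import Algebra.Bundles using (CommutativeRing)
  open import Data.Empty using (⊥-elim)
  open import Data.Fin using (Fin; toℕ) renaming (zero to fz; suc to fs)
  open import Data.Integer using (+_)
  open import Data.List using (List; []; _∷_; map)
  open import Data.List.Properties using (map-∘)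
  open import Data.Nat as ℕ using (ℕ; zero; suc; _<_; s≤s)
  open import Data.Product using (_,_)
  open import Function using (_∘_)
  import Relation.Binary.PropositionalEquality as ≡
  open ≡ using (_≡_; _≢_)

  record Hom (R S : CRing) : Set where
    private
      module R = CommutativeRing R
      module S = CommutativeRing S
    field
      ⟦_⟧    : R.Carrier → S.Carrier
      ⟦⟧-cong : ∀ {a b} → a R.≈ b → ⟦ a ⟧ S.≈ ⟦ b ⟧
      +-homo : ∀ a b → ⟦ a R.+ b ⟧ S.≈ ⟦ a ⟧ S.+ ⟦ b ⟧
      *-homo : ∀ a b → ⟦ a R.* b ⟧ S.≈ ⟦ a ⟧ S.* ⟦ b ⟧
      1-homo : ⟦ R.1# ⟧ S.≈ S.1#

    open import Algebra.Properties.Ring S.ring using (+-cancelˡ)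
    open import Relation.Binary.Reasoning.Setoid S.setoid

    0-homo : ⟦ R.0# ⟧ S.≈ S.0#
    0-homo = +-cancelˡ ⟦ R.0# ⟧ _ _ (begin
      ⟦ R.0# ⟧ S.+ ⟦ R.0# ⟧  ≈⟨ +-homo _ _ ⟨
      ⟦ R.0# R.+ R.0# ⟧      ≈⟨ ⟦⟧-cong (R.+-identityˡ _) ⟩
      ⟦ R.0# ⟧               ≈⟨ S.+-identityʳ _ ⟨
      ⟦ R.0# ⟧ S.+ S.0# ∎)

    neg-homo : ∀ a → ⟦ R.- a ⟧ S.≈ S.- ⟦ a ⟧
    neg-homo a = +-cancelˡ ⟦ a ⟧ _ _ (begin
      ⟦ a ⟧ S.+ ⟦ R.- a ⟧    ≈⟨ +-homo _ _ ⟨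
      ⟦ a R.+ R.- a ⟧        ≈⟨ ⟦⟧-cong (R.-‿inverseʳ a) ⟩
      ⟦ R.0# ⟧               ≈⟨ 0-homo ⟩
      S.0#                   ≈⟨ S.-‿inverseʳ _ ⟨
      ⟦ a ⟧ S.+ S.- ⟦ a ⟧ ∎)

    sub-homo : ∀ a b → ⟦ a R.- b ⟧ S.≈ ⟦ a ⟧ S.- ⟦ b ⟧
    sub-homo a b = S.trans (+-homo _ _) (S.+-congˡ (neg-homo b))

  idHom : ∀ {R} → Hom R R
  idHom {R} = record
    { ⟦_⟧ = λ a → a ; ⟦⟧-cong = λ e → e
    ; +-homo = λ _ _ → refl ; *-homo = λ _ _ → refl ; 1-homo = refl }
    where open CommutativeRing R

  _∘ᴴ_ : ∀ {R S T} → Hom S T → Hom R S → Hom R T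
  _∘ᴴ_ {T = T} g f = record
    { ⟦_⟧ = G.⟦_⟧ ∘ F.⟦_⟧ ; ⟦⟧-cong = G.⟦⟧-cong ∘ F.⟦⟧-cong
    ; +-homo = λ _ _ → trans (G.⟦⟧-cong (F.+-homo _ _)) (G.+-homo _ _)
    ; *-homo = λ _ _ → trans (G.⟦⟧-cong (F.*-homo _ _)) (G.*-homo _ _)
    ; 1-homo = trans (G.⟦⟧-cong F.1-homo) G.1-homo }
    where
    module F = Hom f
    module G = Hom g
    open CommutativeRing T

  module Univariate (R : CRing) where
    open CommutativeRing R
    open import Relation.Binary.Reasoning.Setoid setoid
    open IntegerSolver R

    -- The Cauchy product, with the first coefficient of `f` split off at each step; this avoids the
    -- truncated difference of indices.
    conv : (ℕ → Carrier) → (ℕ → Carrier) → ℕ → Carrier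
    conv f g zero    = f 0 * g 0
    conv f g (suc n) = f 0 * g (suc n) + conv (f ∘ suc) g n

    constant : Carrier → ℕ → Carrier
    constant a zero    = a
    constant a (suc n) = 0#

    indet : ℕ → Carrier
    indet zero    = 0#
    indet (suc n) = constant 1# n

    conv-cong : ∀ {f f′ g g′} → (∀ n → f n ≈ f′ n) → (∀ n → g n ≈ g′ n) → ∀ n → conv f g n ≈ conv f′ g′ n
    conv-cong p q zero    = *-cong (p 0) (q 0)
    conv-cong p q (suc n) = +-cong (*-cong (p 0) (q (suc n))) (conv-cong (p ∘ suc) q n)

    conv-0ˡ : ∀ g n → conv (λ _ → 0#) g n ≈ 0#
    conv-0ˡ g zero    = zeroˡ _
    conv-0ˡ g (suc n) = trans (+-cong (zeroˡ _) (conv-0ˡ g n)) (+-identityˡ _)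

    conv-constant : ∀ a g n → conv (constant a) g n ≈ a * g n
    conv-constant a g zero    = refl
    conv-constant a g (suc n) = trans (+-congˡ (conv-0ˡ g n)) (+-identityʳ _)

    conv-indet-0 : ∀ g → conv indet g 0 ≈ 0#
    conv-indet-0 g = zeroˡ _

    conv-indet-suc : ∀ g n → conv indet g (suc n) ≈ g n
    conv-indet-suc g n = begin
      0# * g (suc n) + conv (constant 1#) g n  ≈⟨ +-cong (zeroˡ _) (conv-constant 1# g n) ⟩
      0# + 1# * g n                            ≈⟨ solve 1 (λ a → con (+ 0) :+ con (+ 1) :* a := a) refl _ ⟩
      g n ∎

    conv-+ˡ : ∀ f g h n → conv (λ k → f k + g k) h n ≈ conv f h n + conv g h n
    conv-+ˡ f g h zero    = distribʳ _ _ _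
    conv-+ˡ f g h (suc n) = begin
      (f 0 + g 0) * h (suc n) + conv (λ k → f (suc k) + g (suc k)) h n  ≈⟨ +-congˡ (conv-+ˡ _ _ h n) ⟩
      (f 0 + g 0) * h (suc n) + (conv (f ∘ suc) h n + conv (g ∘ suc) h n)
        ≈⟨ solve 5 (λ a b c d e → (a :+ b) :* c :+ (d :+ e) := (a :* c :+ d) :+ (b :* c :+ e)) refl _ _ _ _ _ ⟩
      conv f h (suc n) + conv g h (suc n) ∎

    conv-*ˡ : ∀ a f h n → conv (λ k → a * f k) h n ≈ a * conv f h n
    conv-*ˡ a f h zero    = *-assoc _ _ _
    conv-*ˡ a f h (suc n) = trans (+-cong (*-assoc _ _ _) (conv-*ˡ a _ h n)) (sym (distribˡ _ _ _))

    -- Splits off the last coefficient of `f` instead of the first; commutativity exchanges the two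
    -- ways of splitting.
    conv-suc : ∀ f g n → conv f g (suc n) ≈ conv f (g ∘ suc) n + f (suc n) * g 0
    conv-suc f g zero    = refl
    conv-suc f g (suc n) = trans (+-congˡ (conv-suc (f ∘ suc) g n)) (sym (+-assoc _ _ _))

    conv-comm : ∀ f g n → conv f g n ≈ conv g f n
    conv-comm f g zero    = *-comm _ _
    conv-comm f g (suc n) = begin
      f 0 * g (suc n) + conv (f ∘ suc) g n   ≈⟨ +-cong (*-comm _ _) (conv-comm (f ∘ suc) g n) ⟩
      g (suc n) * f 0 + conv g (f ∘ suc) n   ≈⟨ +-comm _ _ ⟩
      conv g (f ∘ suc) n + g (suc n) * f 0   ≈⟨ conv-suc g f n ⟨
      conv g f (suc n) ∎

    conv-assoc : ∀ f g h n → conv (conv f g) h n ≈ conv f (conv g h) n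
    conv-assoc f g h zero    = *-assoc _ _ _
    conv-assoc f g h (suc n) = begin
      f 0 * g 0 * h (suc n) + conv (λ k → f 0 * g (suc k) + conv (f ∘ suc) g k) h n
        ≈⟨ +-congˡ (conv-+ˡ _ _ h n) ⟩
      f 0 * g 0 * h (suc n) + (conv (λ k → f 0 * g (suc k)) h n + conv (conv (f ∘ suc) g) h n)
        ≈⟨ +-congˡ (+-cong (conv-*ˡ (f 0) _ h n) (conv-assoc (f ∘ suc) g h n)) ⟩
      f 0 * g 0 * h (suc n) + (f 0 * conv (g ∘ suc) h n + conv (f ∘ suc) (conv g h) n)
        ≈⟨ solve 5 (λ a b c d e → a :* b :* c :+ (a :* d :+ e) := a :* (b :* c :+ d) :+ e) refl _ _ _ _ _ ⟩
      f 0 * conv g h (suc n) + conv (f ∘ suc) (conv g h) n ∎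

    powerSeries : CRing
    powerSeries = record
      { Carrier = ℕ → Carrier
      ; _≈_ = λ f g → ∀ n → f n ≈ g n
      ; _+_ = λ f g n → f n + g n
      ; _*_ = conv
      ; -_ = λ f n → - f n
      ; 0# = λ _ → 0#
      ; 1# = constant 1#
      ; isCommutativeRing = record
        { isRing = record
          { +-isAbelianGroup = record
            { isGroup = record
              { isMonoid = record
                { isSemigroup = record
                  { isMagma = record
                    { isEquivalence = record
                      { refl = λ _ → refl ; sym = λ e n → sym (e n) ; trans = λ e e′ n → trans (e n) (e′ n) }
                    ; ∙-cong = λ e e′ n → +-cong (e n) (e′ n) }
                  ; assoc = λ _ _ _ _ → +-assoc _ _ _ }
                ; identity = (λ _ _ → +-identityˡ _) , (λ _ _ → +-identityʳ _) }
              ; inverse = (λ _ _ → -‿inverseˡ _) , (λ _ _ → -‿inverseʳ _)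
              ; ⁻¹-cong = λ e n → -‿cong (e n) }
            ; comm = λ _ _ _ → +-comm _ _ }
          ; *-cong = conv-cong
          ; *-assoc = conv-assoc
          ; *-identity = oneˡ , (λ f n → trans (conv-comm f _ n) (oneˡ f n))
          ; distrib = (λ f g h n → trans (conv-comm f _ n) (trans (conv-+ˡ g h f n) (+-cong (conv-comm g f n) (conv-comm h f n))))
                    , (λ f g h → conv-+ˡ g h f) }
        ; *-comm = conv-comm } }
      where
      oneˡ : ∀ f n → conv (constant 1#) f n ≈ f n
      oneˡ f n = trans (conv-constant 1# f n) (*-identityˡ _)

    constantHom : Hom R powerSeries
    constantHom = record
      { ⟦_⟧ = constant
      ; ⟦⟧-cong = λ { e zero → e ; e (suc n) → refl }
      ; +-homo = λ { a b zero → refl ; a b (suc n) → sym (+-identityʳ _) }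
      ; *-homo = λ { a b zero → refl ; a b (suc n) → sym (trans (conv-constant a (constant b) (suc n)) (zeroʳ _)) }
      ; 1-homo = λ _ → refl }

    evalZero : Hom powerSeries R
    evalZero = record
      { ⟦_⟧ = λ f → f 0 ; ⟦⟧-cong = λ e → e 0
      ; +-homo = λ _ _ → refl ; *-homo = λ _ _ → refl ; 1-homo = refl }

  open Univariate using (powerSeries)

  mapHom : ∀ {R S} → Hom R S → Hom (powerSeries R) (powerSeries S)
  mapHom {R} {S} h = record
    { ⟦_⟧ = λ f n → ⟦ f n ⟧
    ; ⟦⟧-cong = λ e n → ⟦⟧-cong (e n)
    ; +-homo = λ f g n → +-homo _ _
    ; *-homo = conv-homo
    ; 1-homo = λ { zero → 1-homo ; (suc n) → 0-homo } }
    where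
    open Hom h
    open CommutativeRing S
    conv-homo : ∀ f g n → ⟦ Univariate.conv R f g n ⟧ ≈ Univariate.conv S (λ k → ⟦ f k ⟧) (λ k → ⟦ g k ⟧) n
    conv-homo f g zero    = *-homo _ _
    conv-homo f g (suc n) = trans (+-homo _ _) (+-cong (*-homo _ _) (conv-homo (f ∘ suc) g n))

  swapHom : ∀ {R} → Hom (powerSeries (powerSeries R)) (powerSeries (powerSeries R))
  swapHom {R} = record
    { ⟦_⟧ = transpose
    ; ⟦⟧-cong = λ e a b → e b a
    ; +-homo = λ _ _ _ _ → refl
    ; *-homo = λ f g a b → sym (conv-transpose f g a b)
    ; 1-homo = λ { zero zero → refl ; zero (suc b) → refl ; (suc a) zero → refl ; (suc a) (suc b) → refl } }
    where
    open CommutativeRing R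
    open Univariate R using (conv)
    open Univariate (powerSeries R) using () renaming (conv to conv₂)
    open import Relation.Binary.Reasoning.Setoid setoid
    open IntegerSolver R

    transpose : (ℕ → ℕ → Carrier) → (ℕ → ℕ → Carrier)
    transpose f a b = f b a

    inner-zero : ∀ f g b → conv (λ k → f k 0) (λ k → g k 0) b ≈ conv₂ f g b 0
    inner-zero f g zero    = refl
    inner-zero f g (suc b) = +-congˡ (inner-zero (f ∘ suc) g b)

    -- Each inner product on the right splits off its term with inner index 0 of `f`, and these
    -- terms together form the first convolution on the left. This is one step of exchanging the two
    -- summations in a product of double series.
    inner-suc : ∀ f g a b →
      conv (λ k → f k 0) (λ k → g k (suc a)) b + conv₂ (λ k → f k ∘ suc) g b a ≈ conv₂ f g b (suc a)
    inner-suc f g a zero    = refl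
    inner-suc f g a (suc b) = begin
      (f 0 0 * g (suc b) (suc a) + conv (λ k → f (suc k) 0) (λ k → g k (suc a)) b)
        + (conv (f 0 ∘ suc) (g (suc b)) a + conv₂ (λ k → f (suc k) ∘ suc) g b a)
        ≈⟨ solve 4 (λ a b c d → (a :+ b) :+ (c :+ d) := (a :+ c) :+ (b :+ d)) refl _ _ _ _ ⟩
      (f 0 0 * g (suc b) (suc a) + conv (f 0 ∘ suc) (g (suc b)) a)
        + (conv (λ k → f (suc k) 0) (λ k → g k (suc a)) b + conv₂ (λ k → f (suc k) ∘ suc) g b a)
        ≈⟨ +-congˡ (inner-suc (f ∘ suc) g a b) ⟩
      conv₂ f g (suc b) (suc a) ∎

    conv-transpose : ∀ f g a b → conv₂ (transpose f) (transpose g) a b ≈ conv₂ f g b a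
    conv-transpose f g zero    b = inner-zero f g b
    conv-transpose f g (suc a) b =
      trans (+-congˡ (conv-transpose (λ k → f k ∘ suc) g a b)) (inner-suc f g a b)

  fins : ∀ K → List (Fin K)
  fins zero    = []
  fins (suc K) = fz ∷ map fs (fins K)

  adjacent : ∀ {K} → ℕ → Fin K → Fin K
  adjacent               (suc c) fz          = fz
  adjacent               (suc c) (fs i)      = fs (adjacent c i)
  adjacent {suc zero}    zero    i           = i
  adjacent {suc (suc K)} zero    fz          = fs fz
  adjacent {suc (suc K)} zero    (fs fz)     = fz
  adjacent {suc (suc K)} zero    (fs (fs i)) = fs (fs i)

  module Tower (A : CRing) where
    module A = CommutativeRing A

    -- The base ring will be the ring of power series in P, so that a single coefficient in the x_i
    -- is itself a series in P.
    PS : ℕ → CRing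
    PS zero    = A
    PS (suc K) = powerSeries (PS K)

    ∣_∣ : ℕ → Set
    ∣ K ∣ = CommutativeRing.Carrier (PS K)

    infixl 7 mul
    infixl 6 add
    infix  4 equal

    add mul : ∀ K → ∣ K ∣ → ∣ K ∣ → ∣ K ∣
    add K = CommutativeRing._+_ (PS K)
    mul K = CommutativeRing._*_ (PS K)

    equal : ∀ K → ∣ K ∣ → ∣ K ∣ → Set
    equal K = CommutativeRing._≈_ (PS K)

    syntax add K f g = f +[ K ] g
    syntax mul K f g = f *[ K ] g
    syntax equal K f g = f ≈[ K ] g

    module Op (K : ℕ) = CommutativeRing (PS K)

    coeff : ∀ K → ∣ K ∣ → (Fin K → ℕ) → A.Carrier
    coeff zero    f z = f
    coeff (suc K) f z = coeff K (f (z fz)) (z ∘ fs)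

    scalarHom : ∀ K → Hom A (PS K)
    scalarHom zero    = idHom
    scalarHom (suc K) = Univariate.constantHom (PS K) ∘ᴴ scalarHom K

    scalar : ∀ K → A.Carrier → ∣ K ∣
    scalar K = Hom.⟦_⟧ (scalarHom K)

    X : ∀ {K} → Fin K → ∣ K ∣
    X {suc K} fz     = Univariate.indet (PS K)
    X {suc K} (fs i) = Univariate.constant (PS K) (X i)

    coeff-cong : ∀ K {f g : ∣ K ∣} → f ≈[ K ] g → ∀ z → coeff K f z A.≈ coeff K g z
    coeff-cong zero    e z = e
    coeff-cong (suc K) e z = coeff-cong K (e (z fz)) (z ∘ fs)

    coeff-≗ : ∀ K (f : ∣ K ∣) {z z′} → (∀ i → z i ≡ z′ i) → coeff K f z ≡ coeff K f z′
    coeff-≗ zero    f e = ≡.refl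
    coeff-≗ (suc K) f {z} {z′} e rewrite e fz = coeff-≗ K (f (z′ fz)) (e ∘ fs)

    coeff-ext : ∀ K {f g : ∣ K ∣} → (∀ z → coeff K f z A.≈ coeff K g z) → f ≈[ K ] g
    coeff-ext zero    e = e (λ ())
    coeff-ext (suc K) e n = coeff-ext K (λ z → e (λ { fz → n ; (fs i) → z i }))

    coeff-+ : ∀ K (f g : ∣ K ∣) z → coeff K (f +[ K ] g) z ≡ coeff K f z A.+ coeff K g z
    coeff-+ zero    f g z = ≡.refl
    coeff-+ (suc K) f g z = coeff-+ K (f (z fz)) (g (z fz)) (z ∘ fs)

    coeff-neg : ∀ K (f : ∣ K ∣) z → coeff K (Op.-_ K f) z ≡ A.- coeff K f z
    coeff-neg zero    f z = ≡.refl
    coeff-neg (suc K) f z = coeff-neg K (f (z fz)) (z ∘ fs)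

    coeff-0 : ∀ K z → coeff K (Op.0# K) z ≡ A.0#
    coeff-0 zero    z = ≡.refl
    coeff-0 (suc K) z = coeff-0 K (z ∘ fs)

    coeff-scalar* : ∀ K a (f : ∣ K ∣) z → coeff K (scalar K a *[ K ] f) z A.≈ a A.* coeff K f z
    coeff-scalar* zero    a f z = A.refl
    coeff-scalar* (suc K) a f z = A.trans
      (coeff-cong K (Univariate.conv-constant (PS K) _ f (z fz)) (z ∘ fs))
      (coeff-scalar* K a (f (z fz)) (z ∘ fs))

    coeff-X-zero : ∀ {K} (i : Fin K) (f : ∣ K ∣) z → z i ≡ 0 → coeff K (X i *[ K ] f) z A.≈ A.0#
    coeff-X-zero {suc K} fz f z e rewrite e = A.trans
      (coeff-cong K (Univariate.conv-indet-0 (PS K) f) (z ∘ fs)) (A.reflexive (coeff-0 K (z ∘ fs)))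
    coeff-X-zero {suc K} (fs i) f z e = A.trans
      (coeff-cong K (Univariate.conv-constant (PS K) (X i) f (z fz)) (z ∘ fs))
      (coeff-X-zero i (f (z fz)) (z ∘ fs) e)

    coeff-X-suc : ∀ {K} (i : Fin K) (f : ∣ K ∣) z z′ → z i ≡ suc (z′ i) → (∀ j → j ≢ i → z j ≡ z′ j) →
      coeff K (X i *[ K ] f) z A.≈ coeff K f z′
    coeff-X-suc {suc K} fz f z z′ e o rewrite e = A.trans
      (coeff-cong K (Univariate.conv-indet-suc (PS K) f (z′ fz)) (z ∘ fs))
      (A.reflexive (coeff-≗ K (f (z′ fz)) (λ i → o (fs i) (λ ()))))
    coeff-X-suc {suc K} (fs i) f z z′ e o rewrite o fz (λ ()) = A.trans
      (coeff-cong K (Univariate.conv-constant (PS K) (X i) f (z′ fz)) (z ∘ fs))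
      (coeff-X-suc i (f (z′ fz)) (z ∘ fs) (z′ ∘ fs) e (λ j j≢i → o (fs j) (λ { ≡.refl → j≢i ≡.refl })))

    -- A series fixed by this map does not involve the variable `i`, hence has coefficient 0
    -- wherever the exponent of that variable is positive. Summands of the alternating sums are
    -- eliminated in this way.
    setZero : ∀ {K} → Fin K → Hom (PS K) (PS K)
    setZero {suc K} fz     = Univariate.constantHom (PS K) ∘ᴴ Univariate.evalZero (PS K)
    setZero {suc K} (fs i) = mapHom (setZero i)

    coeff-setZero : ∀ {K} (i : Fin K) (f : ∣ K ∣) z {n} → z i ≡ suc n → coeff K (Hom.⟦_⟧ (setZero i) f) z A.≈ A.0#
    coeff-setZero {suc K} fz f z e rewrite e = A.reflexive (coeff-0 K (z ∘ fs))
    coeff-setZero {suc K} (fs i) f z e = coeff-setZero i (f (z fz)) (z ∘ fs) e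

    setZero-X : ∀ {K} (i j : Fin K) → j ≢ i → Hom.⟦_⟧ (setZero i) (X j) ≈[ K ] X j
    setZero-X {suc K} fz fz j≢i = ⊥-elim (j≢i ≡.refl)
    setZero-X {suc K} fz (fs j) j≢i zero    = Op.refl K
    setZero-X {suc K} fz (fs j) j≢i (suc n) = Op.refl K
    setZero-X {suc K} (fs i) fz j≢i zero          = Hom.0-homo (setZero i)
    setZero-X {suc K} (fs i) fz j≢i (suc zero)    = Hom.1-homo (setZero i)
    setZero-X {suc K} (fs i) fz j≢i (suc (suc n)) = Hom.0-homo (setZero i)
    setZero-X {suc K} (fs i) (fs j) j≢i zero      = setZero-X i j (λ { ≡.refl → j≢i ≡.refl })
    setZero-X {suc K} (fs i) (fs j) j≢i (suc n)   = Hom.0-homo (setZero i)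

    -- Exchanges the variables number c and c + 1, counted from 0; the identity if
    -- there are fewer variables.
    σ : ∀ K → ℕ → Hom (PS K) (PS K)
    σ zero          c       = idHom
    σ (suc K)       (suc c) = mapHom (σ K c)
    σ (suc zero)    zero    = idHom
    σ (suc (suc K)) zero    = swapHom

    σ-X : ∀ {K} c (i : Fin K) → Hom.⟦_⟧ (σ K c) (X i) ≈[ K ] X (adjacent c i)
    σ-X {suc K}       (suc c) fz zero          = Hom.0-homo (σ K c)
    σ-X {suc K}       (suc c) fz (suc zero)    = Hom.1-homo (σ K c)
    σ-X {suc K}       (suc c) fz (suc (suc n)) = Hom.0-homo (σ K c)
    σ-X {suc K}       (suc c) (fs i) zero      = σ-X c i
    σ-X {suc K}       (suc c) (fs i) (suc n)   = Hom.0-homo (σ K c)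
    σ-X {suc zero}    zero    fz n = Op.refl 0
    σ-X {suc (suc K)} zero    fz zero          zero          = Op.refl K
    σ-X {suc (suc K)} zero    fz zero          (suc zero)    = Op.refl K
    σ-X {suc (suc K)} zero    fz zero          (suc (suc n)) = Op.refl K
    σ-X {suc (suc K)} zero    fz (suc n)       zero          = Op.refl K
    σ-X {suc (suc K)} zero    fz (suc n)       (suc zero)    = Op.refl K
    σ-X {suc (suc K)} zero    fz (suc n)       (suc (suc m)) = Op.refl K
    σ-X {suc (suc K)} zero    (fs fz) zero          zero     = Op.refl K
    σ-X {suc (suc K)} zero    (fs fz) zero          (suc n)  = Op.refl K
    σ-X {suc (suc K)} zero    (fs fz) (suc zero)    zero     = Op.refl K
    σ-X {suc (suc K)} zero    (fs fz) (suc zero)    (suc n)  = Op.refl K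
    σ-X {suc (suc K)} zero    (fs fz) (suc (suc m)) zero     = Op.refl K
    σ-X {suc (suc K)} zero    (fs fz) (suc (suc m)) (suc n)  = Op.refl K
    σ-X {suc (suc K)} zero    (fs (fs i)) zero    zero    = Op.refl K
    σ-X {suc (suc K)} zero    (fs (fs i)) zero    (suc n) = Op.refl K
    σ-X {suc (suc K)} zero    (fs (fs i)) (suc n) zero    = Op.refl K
    σ-X {suc (suc K)} zero    (fs (fs i)) (suc n) (suc m) = Op.refl K

    coeff-σ : ∀ K c (f : ∣ K ∣) z → (∀ i j → toℕ i ≡ c → toℕ j ≡ suc c → z i ≡ z j) →
      coeff K (Hom.⟦_⟧ (σ K c) f) z ≡ coeff K f z
    coeff-σ zero          c       f z e = ≡.refl
    coeff-σ (suc K)       (suc c) f z e =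
      coeff-σ K c (f (z fz)) (z ∘ fs) (λ i j p q → e (fs i) (fs j) (≡.cong suc p) (≡.cong suc q))
    coeff-σ (suc zero)    zero    f z e = ≡.refl
    coeff-σ (suc (suc K)) zero    f z e rewrite e fz (fs fz) ≡.refl ≡.refl = ≡.refl

    -- Exchanging two equal exponents shows only a = - a for a coefficient of an antisymmetric
    -- series; this property turns that into a = 0.
    TorsionFree : Set
    TorsionFree = ∀ a → a A.≈ A.- a → a A.≈ A.0#

    Antisym : ∀ K → ℕ → ∣ K ∣ → Set
    Antisym K c f = Hom.⟦_⟧ (σ K c) f ≈[ K ] Op.-_ K f

    antisym-vanish : TorsionFree → ∀ K c (f : ∣ K ∣) → Antisym K c f → ∀ z →
      (∀ i j → toℕ i ≡ c → toℕ j ≡ suc c → z i ≡ z j) → coeff K f z A.≈ A.0#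
    antisym-vanish tf K c f anti z e = tf _ (A.trans (A.reflexive (≡.sym (coeff-σ K c f z e)))
      (A.trans (coeff-cong K anti z) (A.reflexive (coeff-neg K f z))))

  fins-swap : ∀ {K} c → suc c < K → SwapAdj (fins K) (map (adjacent c) (fins K))
  fins-swap {suc (suc K)} zero    lt       =
    ≡.subst (λ l → SwapAdj (fins (suc (suc K))) (fs fz ∷ fz ∷ l)) (≡.sym map²) here
    where
    map² : map (adjacent 0) (map fs (map fs (fins K))) ≡ map fs (map fs (fins K))
    map² = ≡.trans (≡.cong (map (adjacent 0)) (≡.sym (map-∘ (fins K))))
            (≡.trans (≡.sym (map-∘ (fins K))) (map-∘ (fins K)))
  fins-swap {suc K} (suc c) (s≤s lt) =
    ≡.subst (λ l → SwapAdj (fins (suc K)) (fz ∷ l)) (≡.trans (≡.sym (map-∘ (fins K))) (map-∘ (fins K)))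
      (there (SwapAdj-map fs (fins-swap c lt)))

-- The coefficients of L at strictly increasing exponents.

module LittlewoodSeries where

  open RingSolving
  open AlternatingSums
  open PowerSeriesTower
  open import Data.Fin using (Fin; toℕ) renaming (zero to fz; suc to fs)
  import Data.Fin.Properties as Finₚ
  open import Data.Integer using (+_)
  open import Data.List using (List; []; _∷_; map)
  open import Data.List.Membership.Propositional.Properties using (∈-map⁻)
  open import Data.List.Relation.Binary.Permutation.Propositional using (_↭_; ↭-refl; ↭-trans; ↭-sym; prep; swap)
  import Data.List.Relation.Binary.Permutation.Propositional as Perm
  open import Data.List.Relation.Binary.Permutation.Propositional.Properties using (∈-resp-↭)
  open import Data.List.Relation.Binary.Permutation.Setoid.Properties using (Unique-resp-↭)
  open import Data.List.Relation.Unary.All as All using (All; []; _∷_)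
  import Data.List.Relation.Unary.All.Properties as Allₚ
  open import Data.List.Relation.Unary.Any using (here)
  open import Data.List.Relation.Unary.AllPairs using ([]; _∷_)
  open import Data.List.Relation.Unary.Unique.Propositional using (Unique)
  import Data.List.Relation.Unary.Unique.Propositional.Properties as Uniqueₚ
  open import Data.Nat as ℕ using (ℕ; zero; suc; _<_; s≤s; z≤n; pred)
  import Data.Nat.Properties as ℕₚ
  open import Data.Product using (_,_)
  open import Function using (_∘_)
  import Relation.Binary.PropositionalEquality as ≡
  open ≡ using (_≡_; _≢_)

  fins-unique : ∀ K → Unique (fins K)
  fins-unique zero    = []
  fins-unique (suc K) = Allₚ.map⁺ (All.universal (λ _ ()) (fins K)) ∷ Uniqueₚ.map⁺ Finₚ.suc-injective (fins-unique K)

  ∉-of-pick : ∀ {I : Set} {i : I} {js is} → Unique is → (i ∷ js) ↭ is → All (_≢ i) js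
  ∉-of-pick u p with Unique-resp-↭ (≡.setoid _) (Perm.↭⇒↭ₛ (↭-sym p)) u
  ... | ne ∷ _ = All.map (λ q r → q (≡.sym r)) ne

  module Series (A : CRing) where
    open Tower A public

    module LA (K : ℕ) = ListAlgebra (PS K)

    module _ (K L : ℕ) (h : Hom (PS K) (PS L)) {I J : Set} (π : I → J) where
      open Hom h
      open Op L

      ∏-homo : ∀ {f : I → ∣ K ∣} {g : J → ∣ L ∣} is → All (λ i → ⟦ f i ⟧ ≈[ L ] g (π i)) is →
        ⟦ LA.∏ K f is ⟧ ≈[ L ] LA.∏ L g (map π is)
      ∏-homo []       e = 1-homo
      ∏-homo (i ∷ is) (e ∷ es) = Op.trans L (*-homo _ _) (Op.*-cong L e (∏-homo is es))

      altSum-homo : ∀ {f : I → List I → ∣ K ∣} {g : J → List J → ∣ L ∣} is →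
        (∀ i js → ⟦ f i js ⟧ ≈[ L ] g (π i) (map π js)) →
        ⟦ LA.altSum K f is ⟧ ≈[ L ] LA.altSum L g (map π is)
      altSum-homo []       e = 0-homo
      altSum-homo (i ∷ is) e = Op.trans L (sub-homo _ _)
        (Op.+-cong L (e i is) (Op.-‿cong L (altSum-homo is (λ j js → e j (i ∷ js)))))

    module _ (K : ℕ) where
      open Op K
      open Univariate (PS K)
      open IntegerSolver (PS K)
      open import Relation.Binary.Reasoning.Setoid setoid
      private module S = Op (suc K)

      geomSeries : ∣ K ∣ → ∣ suc K ∣
      geomSeries r zero    = Op.1# K
      geomSeries r (suc n) = r * geomSeries r n

      geomSeries-inv : ∀ r → (S.1# S.- constant r S.* X (fz {K})) S.* geomSeries r S.≈ S.1#
      geomSeries-inv r n = begin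
        ((S.1# S.- constant r S.* X (fz {K})) S.* g) n
          ≈⟨ solve′ 3 (λ r y g → (con′ (+ 1) `- r `* y) `* g `= g `- y `* (r `* g)) S.refl (constant r) (X (fz {K})) g n ⟩
        (g S.- X (fz {K}) S.* (constant r S.* g)) n
          ≈⟨ step n ⟩
        S.1# n ∎
        where
        open IntegerSolver (PS (suc K)) using () renaming (solve to solve′; con to con′; _:=_ to _`=_; _:-_ to _`-_; _:*_ to _`*_)
        g = geomSeries r
        step : ∀ n → (g S.- X (fz {K}) S.* (constant r S.* g)) n ≈ S.1# n
        step zero    = trans (+-congˡ (-‿cong (conv-indet-0 (constant r S.* g))))
                             (solve 1 (λ a → a :- con (+ 0) := a) refl _)
        step (suc n) = trans (+-congˡ (-‿cong (trans (conv-indet-suc (constant r S.* g) n) (conv-constant r g n))))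
                             (-‿inverseʳ _)

    geo : ∀ {K} → Fin K → ∣ K ∣
    geo {suc K} fz     = geomSeries K (Op.1# K)
    geo {suc K} (fs i) = Univariate.constant (PS K) (geo i)

    pl : ∀ {K} → Fin K → ∣ K ∣
    pl {suc K} fz     = geomSeries K (Op.-_ K (Op.1# K))
    pl {suc K} (fs i) = Univariate.constant (PS K) (pl i)

    -- The inverse of 1 - x_i x_j: a geometric series in the outer variable whose ratio is the other
    -- variable, and on the diagonal the product of the inverses of 1 - x and 1 + x.
    gp : ∀ {K} → Fin K → Fin K → ∣ K ∣
    gp {suc K} fz     fz     = geo (fz {K}) *[ suc K ] pl (fz {K})
    gp {suc K} fz     (fs j) = geomSeries K (X j)
    gp {suc K} (fs i) fz     = geomSeries K (X i)
    gp {suc K} (fs i) (fs j) = Univariate.constant (PS K) (gp i j)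

    private
      module _ (K : ℕ) where
        open Op (suc K)
        open Hom (Univariate.constantHom (PS K))

        constant-1-*-homo : ∀ a b → ⟦ (Op._-_ K (Op.1# K) (a *[ K ] b)) ⟧ ≈ (1# - ⟦ a ⟧ * ⟦ b ⟧)
        constant-1-*-homo a b = trans (sub-homo _ _) (+-cong 1-homo (-‿cong (*-homo a b)))

    geo-inv : ∀ {K} (i : Fin K) → (Op._-_ K (Op.1# K) (X i)) *[ K ] geo i ≈[ K ] Op.1# K
    geo-inv {suc K} fz = begin
        (1# - X (fz {K})) * geo (fz {K})
          ≈⟨ *-congʳ (+-congˡ (-‿cong (trans (*-congʳ 1-homo) (*-identityˡ _)))) ⟨
        (1# - ⟦ Op.1# K ⟧ * X (fz {K})) * geo (fz {K}) ≈⟨ geomSeries-inv K (Op.1# K) ⟩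
        1# ∎
      where
      open Op (suc K)
      open Hom (Univariate.constantHom (PS K))
      open import Relation.Binary.Reasoning.Setoid setoid
    geo-inv {suc K} (fs i) = begin
        (1# - ⟦ X i ⟧) * ⟦ geo i ⟧ ≈⟨ *-congʳ (trans (sub-homo _ _) (+-congʳ 1-homo)) ⟨
        ⟦ Op._-_ K (Op.1# K) (X i) ⟧ * ⟦ geo i ⟧ ≈⟨ *-homo _ _ ⟨
        ⟦ Op._-_ K (Op.1# K) (X i) *[ K ] geo i ⟧ ≈⟨ ⟦⟧-cong (geo-inv i) ⟩
        ⟦ Op.1# K ⟧ ≈⟨ 1-homo ⟩
        1# ∎
      where
      open Op (suc K)
      open Hom (Univariate.constantHom (PS K))
      open import Relation.Binary.Reasoning.Setoid setoid

    pl-inv : ∀ {K} (i : Fin K) → (Op._-_ K (X i) (Op.-_ K (Op.1# K))) *[ K ] pl i ≈[ K ] Op.1# K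
    pl-inv {suc K} fz = begin
        (X (fz {K}) - - 1#) * pl (fz {K})
          ≈⟨ *-congʳ (solve 1 (λ x → x :- :- con (+ 1) := con (+ 1) :- (:- con (+ 1)) :* x) refl (X (fz {K}))) ⟩
        (1# - - 1# * X (fz {K})) * pl (fz {K})
          ≈⟨ *-congʳ (+-congˡ (-‿cong (*-congʳ (trans (neg-homo _) (-‿cong 1-homo))))) ⟨
        (1# - ⟦ Op.-_ K (Op.1# K) ⟧ * X (fz {K})) * pl (fz {K}) ≈⟨ geomSeries-inv K (Op.-_ K (Op.1# K)) ⟩
        1# ∎
      where
      open Op (suc K)
      open IntegerSolver (PS (suc K))
      open Hom (Univariate.constantHom (PS K))
      open import Relation.Binary.Reasoning.Setoid setoid
    pl-inv {suc K} (fs i) = begin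
        (⟦ X i ⟧ - - 1#) * ⟦ pl i ⟧
          ≈⟨ *-congʳ (trans (sub-homo _ _) (+-congˡ (-‿cong (trans (neg-homo _) (-‿cong 1-homo))))) ⟨
        ⟦ Op._-_ K (X i) (Op.-_ K (Op.1# K)) ⟧ * ⟦ pl i ⟧ ≈⟨ *-homo _ _ ⟨
        ⟦ Op._-_ K (X i) (Op.-_ K (Op.1# K)) *[ K ] pl i ⟧ ≈⟨ ⟦⟧-cong (pl-inv i) ⟩
        ⟦ Op.1# K ⟧ ≈⟨ 1-homo ⟩
        1# ∎
      where
      open Op (suc K)
      open Hom (Univariate.constantHom (PS K))
      open import Relation.Binary.Reasoning.Setoid setoid

    gp-inv : ∀ {K} (i j : Fin K) → (Op._-_ K (Op.1# K) (X i *[ K ] X j)) *[ K ] gp i j ≈[ K ] Op.1# K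
    gp-inv {suc K} fz fz = begin
        (1# - X (fz {K}) * X (fz {K})) * (geo (fz {K}) * pl (fz {K}))
          ≈⟨ solve 3 (λ x g p → (con (+ 1) :- x :* x) :* (g :* p)
               := ((con (+ 1) :- x) :* g) :* ((x :- :- con (+ 1)) :* p)) refl (X (fz {K})) (geo (fz {K})) (pl (fz {K})) ⟩
        ((1# - X (fz {K})) * geo (fz {K})) * ((X (fz {K}) - - 1#) * pl (fz {K}))
          ≈⟨ *-cong (geo-inv {suc K} fz) (pl-inv {suc K} fz) ⟩
        1# * 1# ≈⟨ *-identityˡ _ ⟩
        1# ∎
      where
      open Op (suc K)
      open IntegerSolver (PS (suc K))
      open import Relation.Binary.Reasoning.Setoid setoid
    gp-inv {suc K} fz (fs j) = Op.trans (suc K) (Op.*-congʳ (suc K) (Op.+-congˡ (suc K) (Op.-‿cong (suc K)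
      (Op.*-comm (suc K) (X (fz {K})) (X (fs j)))))) (geomSeries-inv K (X j))
    gp-inv {suc K} (fs i) fz = geomSeries-inv K (X i)
    gp-inv {suc K} (fs i) (fs j) = begin
        (1# - ⟦ X i ⟧ * ⟦ X j ⟧) * ⟦ gp i j ⟧
          ≈⟨ *-congʳ (constant-1-*-homo K (X i) (X j)) ⟨
        ⟦ Op._-_ K (Op.1# K) (X i *[ K ] X j) ⟧ * ⟦ gp i j ⟧ ≈⟨ *-homo _ _ ⟨
        ⟦ (Op._-_ K (Op.1# K) (X i *[ K ] X j)) *[ K ] gp i j ⟧ ≈⟨ ⟦⟧-cong (gp-inv i j) ⟩
        ⟦ Op.1# K ⟧ ≈⟨ 1-homo ⟩
        1# ∎
      where
      open Op (suc K)
      open Hom (Univariate.constantHom (PS K))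
      open import Relation.Binary.Reasoning.Setoid setoid

    module V (K : ℕ) = ListAlgebra.Vandermonde (PS K) {Fin K} X
    module Lw (K : ℕ) = ListAlgebra.Vandermonde.Littlewood (PS K) {Fin K} X geo geo-inv gp gp-inv pl pl-inv

    littlewood : ∀ K → List (Fin K) → ∣ K ∣
    littlewood K = Lw.littlewood K

    module _ (K L : ℕ) (h : Hom (PS K) (PS L)) (π : Fin K → Fin L) where
      open Hom h
      open Op L
      open import Relation.Binary.Reasoning.Setoid setoid

      private
        hX : Fin K → Set
        hX i = ⟦ X i ⟧ ≈[ L ] X (π i)

      -- Inverses are unique, so a homomorphism that sends variables to variables also carries these
      -- series along, without a look at their coefficients. The same argument gives `gp-homo`.
      geo-homo : ∀ {i} → hX i → ⟦ geo i ⟧ ≈[ L ] geo (π i)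
      geo-homo {i} e = Lw.inv-unique L {Op._-_ L (Op.1# L) (X (π i))} (begin
        (Op._-_ L (Op.1# L) (X (π i))) * ⟦ geo i ⟧
          ≈⟨ *-congʳ (trans (sub-homo _ _) (+-cong 1-homo (-‿cong e))) ⟨
        ⟦ Op._-_ K (Op.1# K) (X i) ⟧ * ⟦ geo i ⟧ ≈⟨ *-homo _ _ ⟨
        ⟦ Op._-_ K (Op.1# K) (X i) *[ K ] geo i ⟧ ≈⟨ ⟦⟧-cong (geo-inv i) ⟩
        ⟦ Op.1# K ⟧ ≈⟨ 1-homo ⟩
        Op.1# L ∎) (geo-inv (π i))

      gp-homo : ∀ {i j} → hX i → hX j → ⟦ gp i j ⟧ ≈[ L ] gp (π i) (π j)
      gp-homo {i} {j} e e′ = Lw.inv-unique L {Op._-_ L (Op.1# L) (X (π i) *[ L ] X (π j))} (begin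
        (Op._-_ L (Op.1# L) (X (π i) * X (π j))) * ⟦ gp i j ⟧
          ≈⟨ *-congʳ (trans (sub-homo _ _) (+-cong 1-homo (-‿cong (trans (*-homo _ _) (*-cong e e′))))) ⟨
        ⟦ Op._-_ K (Op.1# K) (X i *[ K ] X j) ⟧ * ⟦ gp i j ⟧ ≈⟨ *-homo _ _ ⟨
        ⟦ (Op._-_ K (Op.1# K) (X i *[ K ] X j)) *[ K ] gp i j ⟧ ≈⟨ ⟦⟧-cong (gp-inv i j) ⟩
        ⟦ Op.1# K ⟧ ≈⟨ 1-homo ⟩
        Op.1# L ∎) (gp-inv (π i) (π j))

      cauchy-homo : ∀ {is} → All hX is → ⟦ Lw.cauchy K is ⟧ ≈[ L ] Lw.cauchy L (map π is)
      cauchy-homo []       = 1-homo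
      cauchy-homo {i ∷ is} (e ∷ es) = trans (*-homo _ _) (*-cong (trans (*-homo _ _)
        (*-cong (geo-homo e) (∏-homo K L h π is (All.map (gp-homo e) es)))) (cauchy-homo es))

      vandermonde-homo : ∀ {is} → All hX is → ⟦ V.vandermonde K is ⟧ ≈[ L ] V.vandermonde L (map π is)
      vandermonde-homo []       = 1-homo
      vandermonde-homo {i ∷ is} (e ∷ es) = trans (*-homo _ _) (*-cong
        (∏-homo K L h π is (All.map (λ e′ → trans (sub-homo _ _) (+-cong e′ (-‿cong e))) es))
        (vandermonde-homo es))

      littlewood-homo : ∀ {is} → All hX is → ⟦ littlewood K is ⟧ ≈[ L ] littlewood L (map π is)
      littlewood-homo es = trans (*-homo _ _) (*-cong (cauchy-homo es) (vandermonde-homo es))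

    coeff-altSum-0 : ∀ {K} (h : Fin K → List (Fin K) → ∣ K ∣) z is →
      (∀ i js → (i ∷ js) ↭ is → coeff K (h i js) z A.≈ A.0#) → coeff K (LA.altSum K h is) z A.≈ A.0#
    coeff-altSum-0 {K} h z []       e = A.reflexive (coeff-0 K z)
    coeff-altSum-0 {K} h z (x ∷ is) e = begin
      coeff K (Op._-_ K (h x is) rest) z          ≡⟨ coeff-+ K _ _ z ⟩
      coeff K (h x is) z A.+ coeff K (Op.-_ K rest) z
        ≈⟨ A.+-cong (e x is ↭-refl) (A.trans (A.reflexive (coeff-neg K rest z)) (A.-‿cong
             (coeff-altSum-0 _ z is (λ i js p → e i (x ∷ js) (↭-trans (swap i x ↭-refl) (prep x p)))))) ⟩
      A.0# A.- A.0#   ≈⟨ A.-‿inverseʳ A.0# ⟩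
      A.0# ∎
      where
      open import Relation.Binary.Reasoning.Setoid A.setoid
      rest = LA.altSum K (λ j js → h j (x ∷ js)) is

    coeff-fixed-0 : ∀ {K} (i : Fin K) (f : ∣ K ∣) z {n} → Hom.⟦_⟧ (setZero i) f ≈[ K ] f → z i ≡ suc n →
      coeff K f z A.≈ A.0#
    coeff-fixed-0 {K} i f z e p = A.trans (A.sym (coeff-cong K e z)) (coeff-setZero i f z p)

    map-id-≡ : ∀ {I : Set} (is : List I) → map (λ i → i) is ≡ is
    map-id-≡ is = map-id is
      where open import Data.List.Properties using (map-id)

    setZero-∏X*littlewood : ∀ {K} (i : Fin K) js → All (_≢ i) js →
      Hom.⟦_⟧ (setZero i) (LA.∏ K X js *[ K ] littlewood K js) ≈[ K ] LA.∏ K X js *[ K ] littlewood K js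
    setZero-∏X*littlewood {K} i js ne = ≡.subst
      (λ l → Hom.⟦_⟧ (setZero i) (LA.∏ K X js *[ K ] littlewood K js) ≈[ K ] LA.∏ K X l *[ K ] littlewood K l)
      (map-id-≡ js)
      (Op.trans K (Hom.*-homo (setZero i) _ _)
        (Op.*-cong K (∏-homo K K (setZero i) (λ j → j) js fixed) (littlewood-homo K K (setZero i) (λ j → j) fixed)))
      where fixed = All.map (λ {j} → setZero-X i j) ne

    constantX : ∀ K is → All (λ (i : Fin K) → Univariate.constant (PS K) (X i) ≈[ suc K ] X (fs i)) is
    constantX K = All.universal (λ i → Op.refl (suc K) {X (fs i)})

    coeff-∏X-suc : ∀ K (f : ∣ K ∣) z z′ → (∀ i → z i ≡ suc (z′ i)) →
      coeff K (LA.∏ K X (fins K) *[ K ] f) z A.≈ coeff K f z′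
    coeff-∏X-suc zero    f z z′ e = A.*-identityˡ f
    coeff-∏X-suc (suc K) f z z′ e rewrite e fz = begin
      coeff (suc K) (X (fz {K}) * Q * f) z″
        ≈⟨ coeff-cong (suc K) {X (fz {K}) * Q * f} {X (fz {K}) * (constant Q′ * f)} (trans (*-assoc (X (fz {K})) Q f)
             (*-congˡ (*-congʳ (sym (∏-homo K (suc K) cH fs (fins K) (constantX K (fins K))))))) z″ ⟩
      coeff (suc K) (X (fz {K}) * (constant Q′ * f)) z″
        ≈⟨ coeff-cong K (conv-indet-suc (constant Q′ * f) (z′ fz)) (z ∘ fs) ⟩
      coeff K ((constant Q′ * f) (z′ fz)) (z ∘ fs)
        ≈⟨ coeff-cong K (conv-constant Q′ f (z′ fz)) (z ∘ fs) ⟩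
      coeff K (Q′ *[ K ] f (z′ fz)) (z ∘ fs)
        ≈⟨ coeff-∏X-suc K (f (z′ fz)) (z ∘ fs) (z′ ∘ fs) (e ∘ fs) ⟩
      coeff K (f (z′ fz)) (z′ ∘ fs) ∎
      where
      open Op (suc K)
      open Univariate (PS K)
      cH = constantHom
      open import Relation.Binary.Reasoning.Setoid A.setoid
      Q  = LA.∏ (suc K) X (map fs (fins K))
      Q′ = LA.∏ K X (fins K)
      z″ : Fin (suc K) → ℕ
      z″ fz     = suc (z′ fz)
      z″ (fs i) = z (fs i)

    Strict : ∀ {K} → (Fin K → ℕ) → Set
    Strict z = ∀ {i j} → toℕ i < toℕ j → z i < z j

    -- Induction on the number of variables and on the smallest exponent, with L = (∏ x_j) L +
    -- alternating sum. If the smallest exponent is positive, the i-th summand vanishes because it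
    -- does not involve x_i, and the first term lowers all exponents by 1. If it is 0, the first
    -- term vanishes, and by strictness all other exponents are positive, so only the summand
    -- without the first variable survives.
    coeff-littlewood : ∀ K z → Strict z → coeff K (littlewood K (fins K)) z A.≈ A.1#
    coeff-littlewood zero    z st = A.*-identityˡ _
    coeff-littlewood (suc K) z st = go (z fz) z ≡.refl st
      where
      open Op (suc K)
      open import Relation.Binary.Reasoning.Setoid A.setoid
      open IntegerSolver (PS (suc K))
      is = fins (suc K)
      H : Fin (suc K) → List (Fin (suc K)) → ∣ suc K ∣
      H i js = LA.∏ (suc K) X js * littlewood (suc K) js

      peel : littlewood (suc K) is ≈[ suc K ] (LA.∏ (suc K) X is * littlewood (suc K) is) + LA.altSum (suc K) H is
      peel = trans (solve 2 (λ p l → l := p :* l :+ (con (+ 1) :- p) :* l) refl (LA.∏ (suc K) X is) (littlewood (suc K) is))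
                   (+-congˡ (Lw.littlewood-peel (suc K) is))

      vanish : ∀ z i js {n} → (i ∷ js) ↭ is → z i ≡ suc n → coeff (suc K) (H i js) z A.≈ A.0#
      vanish z i js p = coeff-fixed-0 i (H i js) z (setZero-∏X*littlewood i js (∉-of-pick (fins-unique (suc K)) p))

      go : ∀ n z → z fz ≡ n → Strict z → coeff (suc K) (littlewood (suc K) is) z A.≈ A.1#
      go zero z e st = begin
        coeff (suc K) (littlewood (suc K) is) z
          ≈⟨ coeff-cong (suc K) peel z ⟩
        coeff (suc K) ((X (fz {K}) * Q * littlewood (suc K) is) + (H fz rest - R)) z
          ≡⟨ coeff-+ (suc K) (X (fz {K}) * Q * littlewood (suc K) is) (H fz rest - R) z ⟩
        coeff (suc K) (X (fz {K}) * Q * littlewood (suc K) is) z A.+ coeff (suc K) (H fz rest - R) z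
          ≈⟨ A.+-cong
               (A.trans (coeff-cong (suc K) (*-assoc (X (fz {K})) Q _) z) (coeff-X-zero fz (Q * littlewood (suc K) is) z e))
               (A.trans (A.reflexive (coeff-+ (suc K) (H fz rest) (- R) z)) (A.+-cong first
                 (A.trans (A.reflexive (coeff-neg (suc K) R z)) (A.-‿cong others)))) ⟩
        A.0# A.+ (A.1# A.- A.0#)
          ≈⟨ solveA 0 (conA (+ 0) +A (conA (+ 1) -A conA (+ 0)) =A conA (+ 1)) A.refl ⟩
        A.1# ∎
        where
        open IntegerSolver A using () renaming (solve to solveA; con to conA; _:+_ to _+A_; _:-_ to _-A_; _:=_ to _=A_)
        rest = map fs (fins K)
        Q = LA.∏ (suc K) X rest
        R = LA.altSum (suc K) (λ j js → H j (fz ∷ js)) rest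
        positive : ∀ i → z (fs i) ≡ suc (pred (z (fs i)))
        positive i = ≡.sym (ℕₚ.suc-pred (z (fs i)) {{ℕ.>-nonZero (ℕₚ.≤-<-trans z≤n (st {fz} {fs i} (s≤s z≤n)))}})
        others : coeff (suc K) R z A.≈ A.0#
        others = coeff-altSum-0 _ z rest λ i js p →
          vanish-rest i js (↭-trans (swap i fz ↭-refl) (prep fz p)) (rest-positive i p)
          where
          vanish-rest : ∀ i js → (i ∷ fz ∷ js) ↭ is → ∀ {n} → z i ≡ suc n → coeff (suc K) (H i (fz ∷ js)) z A.≈ A.0#
          vanish-rest i js p e = vanish z i (fz ∷ js) p e
          rest-positive : ∀ i {js} → (i ∷ js) ↭ rest → z i ≡ suc (pred (z i))
          rest-positive i p with ∈-map⁻ fs (∈-resp-↭ p (here ≡.refl))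
          ... | j , _ , ≡.refl = positive j
        first : coeff (suc K) (H fz rest) z A.≈ A.1#
        first = begin
          coeff (suc K) (H fz rest) z
            ≈⟨ coeff-cong (suc K) (*-cong (∏-homo K (suc K) cH fs (fins K) (constantX K (fins K)))
                                          (littlewood-homo K (suc K) cH fs {fins K} (constantX K (fins K)))) z ⟨
          coeff (suc K) (constant Q′ * constant (littlewood K (fins K))) z
            ≈⟨ coeff-cong (suc K) (Hom.*-homo cH Q′ (littlewood K (fins K))) z ⟨
          coeff (suc K) (constant (Q′ *[ K ] littlewood K (fins K))) z
            ≡⟨ ≡.cong (λ m → coeff K (constant (Q′ *[ K ] littlewood K (fins K)) m) (z ∘ fs)) e ⟩
          coeff K (Q′ *[ K ] littlewood K (fins K)) (z ∘ fs)
            ≈⟨ coeff-∏X-suc K (littlewood K (fins K)) (z ∘ fs) (pred ∘ z ∘ fs) positive ⟩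
          coeff K (littlewood K (fins K)) (pred ∘ z ∘ fs)
            ≈⟨ coeff-littlewood K (pred ∘ z ∘ fs) (λ {i} {j} i<j → ℕ.s≤s⁻¹
                 (≡.subst₂ _<_ (positive i) (positive j) (st {fs i} {fs j} (s≤s i<j)))) ⟩
          A.1# ∎
          where
          open Univariate (PS K)
          cH = constantHom
          Q′ = LA.∏ K X (fins K)
      go (suc n) z e st = begin
        coeff (suc K) (littlewood (suc K) is) z
          ≈⟨ coeff-cong (suc K) peel z ⟩
        coeff (suc K) ((LA.∏ (suc K) X is * littlewood (suc K) is) + LA.altSum (suc K) H is) z
          ≡⟨ coeff-+ (suc K) (LA.∏ (suc K) X is * littlewood (suc K) is) (LA.altSum (suc K) H is) z ⟩
        coeff (suc K) (LA.∏ (suc K) X is * littlewood (suc K) is) z A.+ coeff (suc K) (LA.altSum (suc K) H is) z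
          ≈⟨ A.+-cong (coeff-∏X-suc (suc K) (littlewood (suc K) is) z (pred ∘ z) positive)
                      (coeff-altSum-0 H z is (λ i js p → vanish z i js p (positive i))) ⟩
        coeff (suc K) (littlewood (suc K) is) (pred ∘ z) A.+ A.0#
          ≈⟨ A.+-identityʳ _ ⟩
        coeff (suc K) (littlewood (suc K) is) (pred ∘ z)
          ≈⟨ go n (pred ∘ z) (≡.cong pred e) (λ {i} {j} i<j → ℕ.s≤s⁻¹
               (≡.subst₂ _<_ (positive i) (positive j) (st i<j))) ⟩
        A.1# ∎
        where
        0<z : ∀ i → 0 < z i
        0<z fz     = ≡.subst (0 <_) (≡.sym e) (s≤s z≤n)
        0<z (fs i) = ℕₚ.<-trans (0<z fz) (st {fz} {fs i} (s≤s z≤n))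
        positive : ∀ i → z i ≡ suc (pred (z i))
        positive i = ≡.sym (ℕₚ.suc-pred (z i) {{ℕ.>-nonZero (0<z i)}})

-- Sums over successive rows as coefficients of products of linear factors.

module RowEvolution where

  open RingSolving
  open AlternatingSums
  open PowerSeriesTower
  open LittlewoodSeries
  open import Defs using (allFuns)
  open import Algebra.Bundles using (CommutativeRing)
  open import Data.Bool using (if_then_else_)
  open import Data.Empty using (⊥-elim)
  open import Data.Fin using (Fin; toℕ; fromℕ<) renaming (zero to fz; suc to fs)
  import Data.Fin.Properties as Finₚ
  open import Data.Integer using (+_)
  open import Data.List using (List; []; _∷_; map; concatMap; applyUpTo; upTo; _++_)
  open import Data.List.Relation.Unary.All as All using (All; []; _∷_)
  open import Data.Nat as ℕ using (ℕ; zero; suc; _<_; _≤_; s≤s; z≤n)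
  import Data.Nat.Properties as ℕₚ
  open import Data.Product using (_×_; _,_; proj₁; proj₂)
  open import Data.Sum using (_⊎_; inj₁; inj₂)
  open import Data.Vec.Functional using () renaming (_∷_ to _∷ᶠ_)
  open import Function using (_∘_)
  open import Relation.Nullary using (Dec; yes; no; does; ¬_)
  open import Relation.Nullary.Decidable using (_×-dec_; _→-dec_)
  import Relation.Binary.PropositionalEquality as ≡
  open ≡ using (_≡_; _≢_)

  -- Used with bound k-1 as long as column 1 is present, and with bound k for the remaining columns
  -- once it has left.
  Good : ∀ {K} → ℕ → (Fin K → ℕ) → Set
  Good b ℓ = (∀ i → ℓ i ≤ b) × (∀ i j → toℕ i < toℕ j → ℓ j ≤ ℓ i)

  good? : ∀ {K} b (ℓ : Fin K → ℕ) → Dec (Good b ℓ)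
  good? b ℓ = Finₚ.all? (λ i → ℓ i ℕ.≤? b)
    ×-dec Finₚ.all? (λ i → Finₚ.all? (λ j → (toℕ i ℕ.<? toℕ j) →-dec (ℓ j ℕ.≤? ℓ i)))

  module Sums (A : CRing) where
    open CommutativeRing A
    open ListAlgebra A public using (∑)
    open import Relation.Binary.Reasoning.Setoid setoid
    open IntegerSolver A

    guard : ∀ {P : Set} → Dec P → Carrier → Carrier
    guard p x = if does p then x else 0#

    guard-yes : ∀ {P : Set} (p : Dec P) {x} → P → guard p x ≡ x
    guard-yes (yes _) _ = ≡.refl
    guard-yes (no ¬p) p = ⊥-elim (¬p p)

    guard-no : ∀ {P : Set} (p : Dec P) {x} → ¬ P → guard p x ≡ 0#
    guard-no (yes p) ¬p = ⊥-elim (¬p p)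
    guard-no (no _) _ = ≡.refl

    module _ {I : Set} where

      ∑-cong : ∀ {f g : I → Carrier} → (∀ i → f i ≈ g i) → ∀ is → ∑ f is ≈ ∑ g is
      ∑-cong e []       = refl
      ∑-cong e (i ∷ is) = +-cong (e i) (∑-cong e is)

      ∑-0 : ∀ {f : I → Carrier} → (∀ i → f i ≈ 0#) → ∀ is → ∑ f is ≈ 0#
      ∑-0 e []       = refl
      ∑-0 e (i ∷ is) = trans (+-cong (e i) (∑-0 e is)) (+-identityˡ 0#)

      ∑-+ : ∀ (f g : I → Carrier) is → ∑ (λ i → f i + g i) is ≈ ∑ f is + ∑ g is
      ∑-+ f g []       = sym (+-identityˡ 0#)
      ∑-+ f g (i ∷ is) = trans (+-congˡ (∑-+ f g is))
        (solve 4 (λ a b c d → (a :+ b) :+ (c :+ d) := (a :+ c) :+ (b :+ d)) refl _ _ _ _)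

      ∑-* : ∀ c (f : I → Carrier) is → ∑ (λ i → c * f i) is ≈ c * ∑ f is
      ∑-* c f []       = sym (zeroʳ c)
      ∑-* c f (i ∷ is) = trans (+-congˡ (∑-* c f is)) (sym (distribˡ c _ _))

      ∑-++ : ∀ (f : I → Carrier) is js → ∑ f (is ++ js) ≈ ∑ f is + ∑ f js
      ∑-++ f []       js = sym (+-identityˡ _)
      ∑-++ f (i ∷ is) js = trans (+-congˡ (∑-++ f is js)) (sym (+-assoc _ _ _))

      ∑-map : ∀ {J : Set} (f : J → Carrier) (g : I → J) is → ∑ f (map g is) ≈ ∑ (f ∘ g) is
      ∑-map f g []       = refl
      ∑-map f g (i ∷ is) = +-congˡ (∑-map f g is)

    ∑-concatMap : ∀ {I J : Set} (f : J → Carrier) (g : I → List J) is →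
      ∑ f (concatMap g is) ≈ ∑ (λ i → ∑ f (g i)) is
    ∑-concatMap f g []       = refl
    ∑-concatMap f g (i ∷ is) = trans (∑-++ f (g i) _) (+-congˡ (∑-concatMap f g is))

    ∑-swap : ∀ {I J : Set} (f : I → J → Carrier) is js →
      ∑ (λ i → ∑ (f i) js) is ≈ ∑ (λ j → ∑ (λ i → f i j) is) js
    ∑-swap f []       js = sym (∑-0 (λ _ → refl) js)
    ∑-swap f (i ∷ is) js = trans (+-congˡ (∑-swap f is js)) (sym (∑-+ _ _ js))

    ∑-allFuns : ∀ {I : Set} d xs (f : (Fin (suc d) → I) → Carrier) →
      ∑ f (allFuns (suc d) xs) ≈ ∑ (λ a → ∑ (λ g → f (a ∷ᶠ g)) (allFuns d xs)) xs
    ∑-allFuns d xs f = trans (∑-concatMap f _ xs) (∑-cong (λ a → ∑-map f (a ∷ᶠ_) (allFuns d xs)) xs)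

    ∑-single : ∀ (g : ℕ → Carrier) c → (∀ a → a ≢ c → g a ≈ 0#) → ∀ B → c < B → ∑ g (upTo B) ≈ g c
    ∑-single g c e B = go (λ a → a) c (λ a a≢c → e a a≢c) B
      where
      go : ∀ f c → (∀ a → a ≢ c → g (f a) ≈ 0#) → ∀ B → c < B → ∑ g (applyUpTo f B) ≈ g (f c)
      go f zero    e (suc B) (s≤s _)  = trans (+-congˡ (zeros (f ∘ suc) (λ a → e (suc a) (λ ())) B)) (+-identityʳ _)
        where
        zeros : ∀ f → (∀ a → g (f a) ≈ 0#) → ∀ B → ∑ g (applyUpTo f B) ≈ 0#
        zeros f e zero    = refl
        zeros f e (suc B) = trans (+-cong (e 0) (zeros (f ∘ suc) (e ∘ suc) B)) (+-identityˡ 0#)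
      go f (suc c) e (suc B) (s≤s lt) = trans
        (+-cong (e 0 (λ ())) (go (f ∘ suc) c (λ a a≢c → e (suc a) (a≢c ∘ ℕₚ.suc-injective)) B lt)) (+-identityˡ _)

    -- A sum of two indicators rather than a case distinction, so that summation over the new length
    -- splits by linearity into two terms, matching the summands 1 and v x of a linear factor.
    grow : Carrier → ℕ → ℕ → Carrier
    grow v ℓ ℓ′ = guard (ℓ′ ℕ.≟ ℓ) 1# + guard (ℓ′ ℕ.≟ suc ℓ) v

    ∑-grow : ∀ v ℓ (S : ℕ → Carrier) B → suc ℓ < B →
      ∑ (λ a → grow v ℓ a * S a) (upTo B) ≈ S ℓ + v * S (suc ℓ)
    ∑-grow v ℓ S B lt = begin
      ∑ (λ a → grow v ℓ a * S a) (upTo B)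
        ≈⟨ ∑-cong (λ a → distribʳ _ _ _) (upTo B) ⟩
      ∑ (λ a → guard (a ℕ.≟ ℓ) 1# * S a + guard (a ℕ.≟ suc ℓ) v * S a) (upTo B)
        ≈⟨ ∑-+ _ _ (upTo B) ⟩
      ∑ (λ a → guard (a ℕ.≟ ℓ) 1# * S a) (upTo B) + ∑ (λ a → guard (a ℕ.≟ suc ℓ) v * S a) (upTo B)
        ≈⟨ +-cong (∑-single _ ℓ (λ a ne → trans (*-congʳ (reflexive (guard-no (a ℕ.≟ ℓ) ne))) (zeroˡ _)) B (ℕₚ.<-trans (ℕₚ.n<1+n ℓ) lt))
                  (∑-single _ (suc ℓ) (λ a ne → trans (*-congʳ (reflexive (guard-no (a ℕ.≟ suc ℓ) ne))) (zeroˡ _)) B lt) ⟩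
      guard (ℓ ℕ.≟ ℓ) 1# * S ℓ + guard (suc ℓ ℕ.≟ suc ℓ) v * S (suc ℓ)
        ≈⟨ +-cong (*-congʳ (reflexive (guard-yes (ℓ ℕ.≟ ℓ) ≡.refl))) (*-congʳ (reflexive (guard-yes (suc ℓ ℕ.≟ suc ℓ) ≡.refl))) ⟩
      1# * S ℓ + v * S (suc ℓ)
        ≈⟨ +-congʳ (*-identityˡ _) ⟩
      S ℓ + v * S (suc ℓ) ∎

    growAll : ∀ {K} → (Fin K → Carrier) → (ℓ ℓ′ : Fin K → ℕ) → Carrier
    growAll {zero}  v ℓ ℓ′ = 1#
    growAll {suc K} v ℓ ℓ′ = grow (v fz) (ℓ fz) (ℓ′ fz) * growAll (v ∘ fs) (ℓ ∘ fs) (ℓ′ ∘ fs)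

    ∑-growAll : ∀ K v (ℓ : Fin (suc K) → ℕ) B → suc (ℓ fz) < B → ∀ (h : (Fin (suc K) → ℕ) → Carrier) →
      let S : ℕ → Carrier
          S a = ∑ (λ g → growAll (v ∘ fs) (ℓ ∘ fs) g * h (a ∷ᶠ g)) (allFuns K (upTo B))
      in ∑ (λ ℓ′ → growAll v ℓ ℓ′ * h ℓ′) (allFuns (suc K) (upTo B)) ≈ S (ℓ fz) + v fz * S (suc (ℓ fz))
    ∑-growAll K v ℓ B lt h = begin
      ∑ (λ ℓ′ → growAll v ℓ ℓ′ * h ℓ′) (allFuns (suc K) (upTo B))
        ≈⟨ ∑-allFuns K (upTo B) _ ⟩
      ∑ (λ a → ∑ (λ g → grow (v fz) (ℓ fz) a * growAll (v ∘ fs) (ℓ ∘ fs) g * h (a ∷ᶠ g)) (allFuns K (upTo B))) (upTo B)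
        ≈⟨ ∑-cong (λ a → trans (∑-cong (λ g → *-assoc _ _ _) (allFuns K (upTo B))) (∑-* _ _ (allFuns K (upTo B)))) (upTo B) ⟩
      ∑ (λ a → grow (v fz) (ℓ fz) a * S a) (upTo B)
        ≈⟨ ∑-grow (v fz) (ℓ fz) S B lt ⟩
      S (ℓ fz) + v fz * S (suc (ℓ fz)) ∎
      where
      S : ℕ → Carrier
      S a = ∑ (λ g → growAll (v ∘ fs) (ℓ ∘ fs) g * h (a ∷ᶠ g)) (allFuns K (upTo B))

  module Evolution (A : CRing) (P : CommutativeRing.Carrier A) where
    open Series A public
    open import Data.Nat using (_+_)
    open Sums A public

    -- Weight of adding a cell to column c (from 0) when the first a columns
    -- may grow: the last of these carries a maximum.
    growth : ℕ → ℕ → A.Carrier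
    growth zero          c       = A.0#
    growth (suc a)       (suc c) = growth a c
    growth (suc zero)    zero    = P
    growth (suc (suc a)) zero    = A.1#

    growth-inactive : ∀ a c → growth a c ≡ A.0# ⊎ c < a
    growth-inactive zero          c       = inj₁ ≡.refl
    growth-inactive (suc zero)    zero    = inj₂ (s≤s z≤n)
    growth-inactive (suc (suc a)) zero    = inj₂ (s≤s z≤n)
    growth-inactive (suc a)       (suc c) with growth-inactive a c
    ... | inj₁ e = inj₁ e
    ... | inj₂ l = inj₂ (s≤s l)

    -- The newest column has index a - 1. Under this bound the exchanged columns c and c + 1 both
    -- precede it, so both have weight 1.
    growth-adjacent : ∀ {K} a c (i : Fin K) → 2 + c < a → growth a (toℕ (adjacent c i)) ≡ growth a (toℕ i)
    growth-adjacent (suc a) (suc c) fz     lt = ≡.refl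
    growth-adjacent (suc a) (suc c) (fs i) (s≤s lt) = growth-adjacent a c i lt
    growth-adjacent {suc zero}    a zero i lt = ≡.refl
    growth-adjacent {suc (suc K)} (suc (suc (suc a))) zero fz          lt = ≡.refl
    growth-adjacent {suc (suc K)} (suc (suc (suc a))) zero (fs fz)     lt = ≡.refl
    growth-adjacent {suc (suc K)} (suc (suc (suc a))) zero (fs (fs i)) lt = ≡.refl
    growth-adjacent {suc (suc K)} (suc zero)       zero i (s≤s ())
    growth-adjacent {suc (suc K)} (suc (suc zero)) zero i (s≤s (s≤s ()))

    linear : ∀ K → A.Carrier → Fin K → ∣ K ∣
    linear K v i = Op._+_ K (Op.1# K) (scalar K v *[ K ] X i)

    factor : ∀ K → ℕ → Fin K → ∣ K ∣
    factor K a i = linear K (growth a (toℕ i)) i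

    step : ∀ K → ℕ → ∣ K ∣
    step K a = LA.∏ K (factor K a) (fins K)

    evolve : ∀ K → ℕ → ℕ → ∣ K ∣ → ∣ K ∣
    evolve K zero    a f = f
    evolve K (suc d) a f = step K a *[ K ] evolve K d (suc a) f

    σ-scalar : ∀ K c v → Hom.⟦_⟧ (σ K c) (scalar K v) ≈[ K ] scalar K v
    σ-scalar zero          c       v = A.refl
    σ-scalar (suc K)       (suc c) v zero    = σ-scalar K c v
    σ-scalar (suc K)       (suc c) v (suc n) = Hom.0-homo (σ K c)
    σ-scalar (suc zero)    zero    v n = A.refl
    σ-scalar (suc (suc K)) zero    v zero    zero    = Op.refl K
    σ-scalar (suc (suc K)) zero    v zero    (suc n) = Op.refl K
    σ-scalar (suc (suc K)) zero    v (suc n) zero    = Op.refl K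
    σ-scalar (suc (suc K)) zero    v (suc n) (suc m) = Op.refl K

    σ-linear : ∀ K c v i → Hom.⟦_⟧ (σ K c) (linear K v i) ≈[ K ] linear K v (adjacent c i)
    σ-linear K c v i = Op.trans K (+-homo _ _) (Op.+-cong K 1-homo
      (Op.trans K (*-homo _ _) (Op.*-cong K (σ-scalar K c v) (σ-X c i))))
      where open Hom (σ K c)

    σ-factor : ∀ K c a i → 2 + c < a → Hom.⟦_⟧ (σ K c) (factor K a i) ≈[ K ] factor K a (adjacent c i)
    σ-factor K c a i lt = ≡.subst (λ v → Hom.⟦_⟧ (σ K c) (factor K a i) ≈[ K ] linear K v (adjacent c i))
      (≡.sym (growth-adjacent a c i lt)) (σ-linear K c _ i)

    σ-step : ∀ K c a → suc c < K → 2 + c < a → Hom.⟦_⟧ (σ K c) (step K a) ≈[ K ] step K a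
    σ-step K c a lt lt′ = Op.trans K
      (∏-homo K K (σ K c) (adjacent c) (fins K) (All.universal (λ i → σ-factor K c a i lt′) (fins K)))
      (Op.sym K (LA.∏-↭ K (factor K a) (SwapAdj⇒↭ (fins-swap c lt))))

    antisym-* : ∀ K c {s f} → Hom.⟦_⟧ (σ K c) s ≈[ K ] s → Antisym K c f → Antisym K c (s *[ K ] f)
    antisym-* K c {s} {f} e e′ = Op.trans K (Hom.*-homo (σ K c) s f)
      (Op.trans K (Op.*-cong K e e′) (Op.sym K (-‿distribʳ-* s f)))
      where open import Algebra.Properties.Ring (CommutativeRing.ring (PS K))

    antisym-evolve : ∀ K c d a f → suc c < K → 2 + c < a → Antisym K c f → Antisym K c (evolve K d a f)
    antisym-evolve K c zero    a f lt lt′ e = e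
    antisym-evolve K c (suc d) a f lt lt′ e =
      antisym-* K c (σ-step K c a lt lt′) (antisym-evolve K c d (suc a) f lt (ℕₚ.m<n⇒m<1+n lt′) e)

    antisym-littlewood : ∀ K c → suc c < K → Antisym K c (littlewood K (fins K))
    antisym-littlewood K c lt = Op.trans K
      (littlewood-homo K K (σ K c) (adjacent c) (All.universal (σ-X c) (fins K)))
      (Op.trans K (Op.sym K (-‿involutive _)) (Op.-‿cong K (Op.sym K (Lw.littlewood-swap K (fins-swap c lt)))))
      where open import Algebra.Properties.Ring (CommutativeRing.ring (PS K))

    Shrinks : ∀ {K} → (Fin K → Set) → (z z′ : Fin K → ℕ) → Set
    Shrinks act z z′ = ∀ i → z′ i ≡ z i ⊎ (act i × suc (z′ i) ≡ z i)

    -- Variable by variable: the summand 1 of a linear factor keeps the length, the summand v x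
    -- lowers the exponent and raises the length, and the sum `T` of both is preserved. Hence `h`
    -- has to agree with `f` only at exponents reachable in one row. A length above `T` would
    -- correspond to a negative exponent; there the coefficient is 0, and the last hypothesis makes
    -- `h` vanish too.
    coeff-∏linear : ∀ K (v : Fin K → A.Carrier) (act : Fin K → Set) → (∀ i → v i ≡ A.0# ⊎ act i) →
      ∀ B (T z ℓ : Fin K → ℕ) → (∀ i → z i + ℓ i ≡ T i) → (∀ i → suc (ℓ i) < B) →
      ∀ (f : ∣ K ∣) (h : (Fin K → ℕ) → A.Carrier) →
      (∀ z′ ℓ′ → Shrinks act z z′ → (∀ i → z′ i + ℓ′ i ≡ T i) → h ℓ′ A.≈ coeff K f z′) →
      (∀ ℓ′ i → T i < ℓ′ i → h ℓ′ A.≈ A.0#) →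
      ∑ (λ ℓ′ → growAll v ℓ ℓ′ A.* h ℓ′) (allFuns K (upTo B))
        A.≈ coeff K (LA.∏ K (λ i → linear K (v i) i) (fins K) *[ K ] f) z
    coeff-∏linear zero    v act av B T z ℓ e lt f h H1 H2 = begin
      A.1# A.* h _ A.+ A.0#  ≈⟨ A.+-identityʳ _ ⟩
      A.1# A.* h _           ≈⟨ A.*-congˡ (H1 z _ (λ ()) (λ ())) ⟩
      A.1# A.* f ∎
      where open import Relation.Binary.Reasoning.Setoid A.setoid
    coeff-∏linear (suc K) v act av B T z ℓ e lt f h H1 H2 = begin
      ∑ (λ ℓ′ → growAll v ℓ ℓ′ A.* h ℓ′) (allFuns (suc K) (upTo B))
        ≈⟨ ∑-growAll K v ℓ B (lt fz) h ⟩
      S (ℓ fz) A.+ v fz A.* S (suc (ℓ fz))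
        ≈⟨ A.+-cong stay (moves (z fz) ≡.refl) ⟩
      coeff K (Q *[ K ] f (z fz)) (z ∘ fs) A.+ v fz A.* coeff (suc K) (X (fz {K}) * (constant Q * f)) z
        ≈⟨ A.+-cong (coeff-cong K (conv-constant Q f (z fz)) (z ∘ fs)) (coeff-scalar* (suc K) (v fz) (X (fz {K}) * (constant Q * f)) z) ⟨
      coeff (suc K) (constant Q * f) z A.+ coeff (suc K) (scalar (suc K) (v fz) * (X (fz {K}) * (constant Q * f))) z
        ≡⟨ coeff-+ (suc K) (constant Q * f) (scalar (suc K) (v fz) * (X (fz {K}) * (constant Q * f))) z ⟨
      coeff (suc K) (constant Q * f +ₚ scalar (suc K) (v fz) * (X (fz {K}) * (constant Q * f))) z
        ≈⟨ coeff-cong (suc K) {constant Q * f +ₚ scalar (suc K) (v fz) * (X (fz {K}) * (constant Q * f))}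
             (trans (solve 4 (λ s x q f → q :* f :+ s :* (x :* (q :* f)) := (con (+ 1) :+ s :* x) :* q :* f) refl
                     (scalar (suc K) (v fz)) (X (fz {K})) (constant Q) f)
                    (*-congʳ (*-congˡ (∏-homo K (suc K) constantHom fs (fins K) (All.universal linear-constant (fins K)))))) z ⟩
      coeff (suc K) (LA.∏ (suc K) (λ i → linear (suc K) (v i) i) (fins (suc K)) * f) z ∎
      where
      open import Relation.Binary.Reasoning.Setoid A.setoid
      open Op (suc K) using (_*_; trans; refl; *-congʳ; *-congˡ; +-cong; sym) renaming (_+_ to _+ₚ_)
      open IntegerSolver (PS (suc K))
      open Univariate (PS K)
      Q = LA.∏ K (λ i → linear K (v (fs i)) i) (fins K)
      S : ℕ → A.Carrier
      S a = ∑ (λ g → growAll (v ∘ fs) (ℓ ∘ fs) g A.* h (a ∷ᶠ g)) (allFuns K (upTo B))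

      linear-constant : ∀ i → Hom.⟦_⟧ constantHom (linear K (v (fs i)) i) ≈[ suc K ] linear (suc K) (v (fs i)) (fs i)
      linear-constant i = trans (Hom.+-homo constantHom (Op.1# K) (scalar K (v (fs i)) *[ K ] X i))
        (+-cong (Hom.1-homo constantHom) (Hom.*-homo constantHom (scalar K (v (fs i))) (X i)))

      cons : ∀ {n} {z′ : Fin K → ℕ} → n ≡ z fz ⊎ (act fz × suc n ≡ z fz) → Shrinks (act ∘ fs) (z ∘ fs) z′ → Shrinks act z (n ∷ᶠ z′)
      cons p q fz     = p
      cons p q (fs i) = q i

      consT : ∀ {n m} {z′ ℓ′ : Fin K → ℕ} → n + m ≡ T fz → (∀ i → z′ i + ℓ′ i ≡ T (fs i)) →
        ∀ i → (n ∷ᶠ z′) i + (m ∷ᶠ ℓ′) i ≡ T i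
      consT p q fz     = p
      consT p q (fs i) = q i

      tailSum : ∀ n m → n ≡ z fz ⊎ (act fz × suc n ≡ z fz) → n + m ≡ T fz →
        S m A.≈ coeff K (Q *[ K ] f n) (z ∘ fs)
      tailSum n m p q = coeff-∏linear K (v ∘ fs) (act ∘ fs) (av ∘ fs) B (T ∘ fs) (z ∘ fs) (ℓ ∘ fs) (e ∘ fs) (lt ∘ fs) (f n)
        (λ g → h (m ∷ᶠ g))
        (λ z′ ℓ′ r t → H1 (n ∷ᶠ z′) (m ∷ᶠ ℓ′) (cons p r) (consT q t))
        (λ ℓ′ i l → H2 (m ∷ᶠ ℓ′) (fs i) l)

      stay : S (ℓ fz) A.≈ coeff K (Q *[ K ] f (z fz)) (z ∘ fs)
      stay = tailSum (z fz) (ℓ fz) (inj₁ ≡.refl) (e fz)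

      moves : ∀ n → z fz ≡ n → v fz A.* S (suc (ℓ fz)) A.≈ v fz A.* coeff (suc K) (X (fz {K}) * (constant Q * f)) z
      moves zero z0 = A.*-congˡ (A.trans
        (∑-0 (λ g → A.trans (A.*-congˡ (H2 (suc (ℓ fz) ∷ᶠ g) fz
          (ℕₚ.≤-reflexive (≡.cong suc (≡.trans (≡.sym (e fz)) (≡.cong (λ t → t + ℓ fz) z0)))))) (A.zeroʳ _)) (allFuns K (upTo B)))
        (A.sym (coeff-X-zero (fz {K}) (constant Q * f) z z0)))
      moves (suc n) zn with av fz
      ... | inj₁ v0 = A.trans (A.trans (A.*-congʳ (A.reflexive v0)) (A.zeroˡ _))
                        (A.sym (A.trans (A.*-congʳ (A.reflexive v0)) (A.zeroˡ _)))
      ... | inj₂ a0 = A.*-congˡ (A.trans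
        (tailSum n (suc (ℓ fz)) (inj₂ (a0 , ≡.sym zn))
          (≡.trans (ℕₚ.+-suc n (ℓ fz)) (≡.trans (≡.cong (λ t → t + ℓ fz) (≡.sym zn)) (e fz))))
        (A.sym (A.trans (coeff-X-suc (fz {K}) (constant Q * f) z (n ∷ᶠ (z ∘ fs)) zn (λ { fz ne → ⊥-elim (ne ≡.refl) ; (fs i) _ → ≡.refl }))
          (coeff-cong K (conv-constant Q f n) (z ∘ fs)))))

    -- Total weight of d successive rows of column lengths starting from ℓ.
    total : ∀ (B K b d a : ℕ) → ((Fin K → ℕ) → A.Carrier) → (Fin K → ℕ) → A.Carrier
    total B K b zero    a F ℓ = F ℓ
    total B K b (suc d) a F ℓ =
      ∑ (λ ℓ′ → growAll (growth a ∘ toℕ) ℓ ℓ′ A.* guard (good? b ℓ′) (total B K b d (suc a) F ℓ′)) (allFuns K (upTo B))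

    module _ (torsionFree : TorsionFree) (K b : ℕ) (T : Fin K → ℕ) (T-def : ∀ i → T i ≡ b + toℕ i) where

      good⇒strict : ∀ z ℓ → (∀ i → z i + ℓ i ≡ T i) → Good b ℓ → Strict z
      good⇒strict z ℓ e (_ , decr) {i} {j} i<j = ℕₚ.+-cancelʳ-< (ℓ i) (z i) (z j) (begin-strict
        z i + ℓ i     ≡⟨ ≡.trans (e i) (T-def i) ⟩
        b + toℕ i     <⟨ ℕₚ.+-monoʳ-< b i<j ⟩
        b + toℕ j     ≡⟨ ≡.trans (e j) (T-def j) ⟨
        z j + ℓ j     ≤⟨ ℕₚ.+-monoʳ-≤ (z j) (decr i j i<j) ⟩
        z j + ℓ i ∎)
        where open ℕₚ.≤-Reasoning

      -- Integers that increase at every step increase by at least j - i from i to j; written with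
      -- sums to avoid truncated subtraction.
      adjacent-strict : ∀ (z : Fin K → ℕ) → (∀ i j → toℕ j ≡ suc (toℕ i) → z i < z j) →
        ∀ i j → toℕ i < toℕ j → z i + toℕ j ≤ z j + toℕ i
      adjacent-strict z adj i j lt = go (toℕ j ℕ.∸ suc (toℕ i)) j (≡.sym (ℕₚ.m∸n+n≡m lt))
        where
        open ℕₚ.≤-Reasoning
        go : ∀ n j → toℕ j ≡ n + suc (toℕ i) → z i + toℕ j ≤ z j + toℕ i
        go zero j e = begin
          z i + toℕ j       ≡⟨ ≡.cong (λ t → z i + t) e ⟩
          z i + suc (toℕ i) ≡⟨ ℕₚ.+-suc (z i) (toℕ i) ⟩
          suc (z i) + toℕ i ≤⟨ ℕₚ.+-monoˡ-≤ (toℕ i) (adj i j e) ⟩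
          z j + toℕ i ∎
        go (suc n) j e = begin
          z i + toℕ j         ≡⟨ ≡.cong (λ t → z i + t) (≡.trans e (≡.cong suc (≡.sym j′≡))) ⟩
          z i + suc (toℕ j′)  ≡⟨ ℕₚ.+-suc (z i) (toℕ j′) ⟩
          suc (z i + toℕ j′)  ≤⟨ s≤s (go n j′ j′≡) ⟩
          suc (z j′ + toℕ i)  ≤⟨ ℕₚ.+-monoˡ-≤ (toℕ i) (adj j′ j (≡.trans e (≡.cong suc (≡.sym j′≡)))) ⟩
          z j + toℕ i ∎
          where
          bound : n + suc (toℕ i) < K
          bound = ℕₚ.<-trans (ℕₚ.≤-reflexive (≡.sym e)) (Finₚ.toℕ<n j)
          j′ : Fin K
          j′ = fromℕ< bound
          j′≡ : toℕ j′ ≡ n + suc (toℕ i)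
          j′≡ = Finₚ.toℕ-fromℕ< bound

      -- Only neighbours are compared in the hypothesis, so that a row that is not `Good` produces
      -- two neighbouring exponents out of order, which is where antisymmetry can be applied.
      strict⇒good : ∀ z ℓ → (∀ i → z i + ℓ i ≡ T i) → (∀ i j → toℕ j ≡ suc (toℕ i) → z i < z j) → Good b ℓ
      strict⇒good z ℓ e adj = bound , decr
        where
        open ℕₚ.≤-Reasoning
        decr : ∀ i j → toℕ i < toℕ j → ℓ j ≤ ℓ i
        decr i j lt = ℕₚ.+-cancelˡ-≤ (z i + toℕ j) (ℓ j) (ℓ i) (begin
          z i + toℕ j + ℓ j   ≤⟨ ℕₚ.+-monoˡ-≤ (ℓ j) (adjacent-strict z adj i j lt) ⟩
          z j + toℕ i + ℓ j   ≡⟨ xyz (z j) (toℕ i) (ℓ j) ⟩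
          z j + ℓ j + toℕ i   ≡⟨ ≡.cong (λ t → t + toℕ i) (≡.trans (e j) (T-def j)) ⟩
          b + toℕ j + toℕ i   ≡⟨ xyz b (toℕ j) (toℕ i) ⟩
          b + toℕ i + toℕ j   ≡⟨ ≡.cong (λ t → t + toℕ j) (≡.trans (e i) (T-def i)) ⟨
          z i + ℓ i + toℕ j   ≡⟨ xyz (z i) (ℓ i) (toℕ j) ⟩
          z i + toℕ j + ℓ i ∎)
          where
          xyz : ∀ x y w → x + y + w ≡ x + w + y
          xyz x y w = ≡.trans (ℕₚ.+-assoc x y w) (≡.trans (≡.cong (λ t → x + t) (ℕₚ.+-comm y w)) (≡.sym (ℕₚ.+-assoc x w y)))
        -- Strictly increasing natural numbers satisfy z_i ≥ i, and this caps the length b + i - z_i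
        -- at b.
        bound : ∀ i → ℓ i ≤ b
        bound i = ℕₚ.+-cancelʳ-≤ (toℕ i) (ℓ i) b (begin
          ℓ i + toℕ i   ≤⟨ ℕₚ.+-monoʳ-≤ (ℓ i) (toℕ≤z i) ⟩
          ℓ i + z i     ≡⟨ ≡.trans (ℕₚ.+-comm (ℓ i) (z i)) (≡.trans (e i) (T-def i)) ⟩
          b + toℕ i ∎)
          where
          toℕ≤z : ∀ i → toℕ i ≤ z i
          toℕ≤z i with toℕ i in eq
          ... | zero  = z≤n
          ... | suc t = ≡.subst (_≤ z i) (≡.trans (≡.cong (toℕ i ℕ.∸_) first≡) eq) (ℕₚ.m≤n+o⇒m∸n≤o (toℕ i) (toℕ first)
              (ℕₚ.≤-trans (ℕₚ.m≤n+m (toℕ i) (z first)) (ℕₚ.≤-trans (adjacent-strict z adj first i (≡.subst₂ _<_ (≡.sym first≡) (≡.sym eq) (s≤s z≤n)))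
                (ℕₚ.≤-reflexive (ℕₚ.+-comm (z i) (toℕ first))))))
            where
            0<K : 0 < K
            0<K = ℕₚ.≤-<-trans z≤n (Finₚ.toℕ<n i)
            first : Fin K
            first = fromℕ< 0<K
            first≡ : toℕ first ≡ 0
            first≡ = Finₚ.toℕ-fromℕ< 0<K

      -- Antisymmetry of `f` is required only for neighbours active in the last of the d rows, which
      -- has d + a - 1 active columns. In every earlier row the remaining product starts with one
      -- more active column, so its factors are symmetric in all columns active now.
      coeff-evolve : ∀ B → suc b < B → ∀ d a (f : ∣ K ∣) F →
        (∀ c → suc c < K → 2 + c < d + a → Antisym K c f) →
        (∀ z ℓ → Strict z → (∀ i → ℓ i ≤ b) → (∀ i → z i + ℓ i ≡ T i) → F ℓ A.≈ coeff K f z) →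
        ∀ z ℓ → Strict z → (∀ i → ℓ i ≤ b) → (∀ i → z i + ℓ i ≡ T i) →
        total B K b d a F ℓ A.≈ coeff K (evolve K d a f) z
      coeff-evolve B b<B zero    a f F anti base z ℓ st ℓ≤b e = base z ℓ st ℓ≤b e
      coeff-evolve B b<B (suc d) a f F anti base z ℓ st ℓ≤b e =
        coeff-∏linear K (growth a ∘ toℕ) (λ i → toℕ i < a) (λ i → growth-inactive a (toℕ i)) B T z ℓ e
          (λ i → ℕₚ.≤-<-trans (s≤s (ℓ≤b i)) b<B) f′ (λ ℓ′ → guard (good? b ℓ′) (total B K b d (suc a) F ℓ′)) H1 H2
        where
        f′ = evolve K d (suc a) f
        anti′ : ∀ c → suc c < K → suc c < a → Antisym K c f′
        anti′ c lt lt′ = antisym-evolve K c d (suc a) f lt (s≤s lt′)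
          (anti c lt (ℕₚ.<-≤-trans (s≤s lt′) (s≤s (ℕₚ.m≤n+m a d))))

        H2 : ∀ ℓ′ i → T i < ℓ′ i → guard (good? b ℓ′) (total B K b d (suc a) F ℓ′) A.≈ A.0#
        H2 ℓ′ i lt = A.reflexive (guard-no (good? b ℓ′) (λ { (bnd , _) → ℕₚ.<⇒≱ lt
          (ℕₚ.≤-trans (bnd i) (ℕₚ.≤-trans (ℕₚ.m≤m+n b (toℕ i)) (ℕₚ.≤-reflexive (≡.sym (T-def i))))) }))

        -- A step from strictly increasing exponents that loses strictness makes two
        -- adjacent active exponents equal, where an antisymmetric series vanishes.
        vanish : ∀ z′ ℓ′ → Shrinks (λ i → toℕ i < a) z z′ → (∀ i → z′ i + ℓ′ i ≡ T i) → ¬ Good b ℓ′ →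
          coeff K f′ z′ A.≈ A.0#
        vanish z′ ℓ′ r e′ ¬g with Finₚ.¬∀⟶∃¬ K _ (λ i → Finₚ.all? (λ j → (toℕ j ℕ.≟ suc (toℕ i)) →-dec (z′ i ℕ.<? z′ j)))
                           (λ adj → ¬g (strict⇒good z′ ℓ′ e′ adj))
        ... | i , ¬i with Finₚ.¬∀⟶∃¬ K _ (λ j → (toℕ j ℕ.≟ suc (toℕ i)) →-dec (z′ i ℕ.<? z′ j)) ¬i
        ... | j , ¬ij with toℕ j ℕ.≟ suc (toℕ i)
        ...   | no j≢ = ⊥-elim (¬ij (λ j≡ → ⊥-elim (j≢ j≡)))
        ...   | yes j≡ = antisym-vanish torsionFree K (toℕ i) f′
                  (anti′ (toℕ i) (≡.subst (_< K) j≡ (Finₚ.toℕ<n j)) (≡.subst (_< a) j≡ (proj₁ moved)))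
                  z′ (λ i′ j′ p q → ≡.trans (≡.cong z′ (Finₚ.toℕ-injective p)) (≡.trans (proj₂ moved)
                       (≡.cong z′ (Finₚ.toℕ-injective (≡.trans j≡ (≡.sym q))))))
          where
          z′j≤z′i : z′ j ≤ z′ i
          z′j≤z′i = ℕₚ.≮⇒≥ (λ lt → ¬ij (λ _ → lt))
          zi<zj : z i < z j
          zi<zj = st (ℕₚ.≤-reflexive (≡.sym j≡))
          z′i≤zi : z′ i ≤ z i
          z′i≤zi with r i
          ... | inj₁ q = ℕₚ.≤-reflexive q
          ... | inj₂ (_ , q) = ℕₚ.≤-trans (ℕₚ.n≤1+n _) (ℕₚ.≤-reflexive q)
          moved : toℕ j < a × z′ i ≡ z′ j
          moved with r j
          ... | inj₁ q = ⊥-elim (ℕₚ.<⇒≱ zi<zj (ℕₚ.≤-trans (ℕₚ.≤-reflexive (≡.sym q)) (ℕₚ.≤-trans z′j≤z′i z′i≤zi)))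
          ... | inj₂ (l , q) = l , ℕₚ.≤-antisym
                  (ℕₚ.≤-trans z′i≤zi (ℕ.s≤s⁻¹ (≡.subst (z i <_) (≡.sym q) zi<zj))) z′j≤z′i

        H1 : ∀ z′ ℓ′ → Shrinks (λ i → toℕ i < a) z z′ → (∀ i → z′ i + ℓ′ i ≡ T i) →
          guard (good? b ℓ′) (total B K b d (suc a) F ℓ′) A.≈ coeff K f′ z′
        H1 z′ ℓ′ r e′ = by (good? b ℓ′)
          where
          by : Dec (Good b ℓ′) → guard (good? b ℓ′) (total B K b d (suc a) F ℓ′) A.≈ coeff K f′ z′
          by (yes g) = A.trans (A.reflexive (guard-yes (good? b ℓ′) g)) (coeff-evolve B b<B d (suc a) f F
            (λ c lt lt′ → anti c lt (ℕₚ.<-≤-trans lt′ (ℕₚ.≤-reflexive (ℕₚ.+-suc d a)))) base z′ ℓ′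
            (good⇒strict z′ ℓ′ e′ g) (proj₁ g) e′)
          by (no ¬g) = A.trans (A.reflexive (guard-no (good? b ℓ′) ¬g)) (A.sym (vanish z′ ℓ′ r e′ ¬g))

-- The series after column 1 has reached its final length.

module ColumnExit where

  open RingSolving
  open AlternatingSums
  open PowerSeriesTower
  open LittlewoodSeries
  open RowEvolution
  open import Algebra.Bundles using (CommutativeRing)
  open import Data.Fin using (Fin; toℕ) renaming (zero to fz; suc to fs)
  open import Data.List using (List; []; _∷_; map)
  open import Data.List.Membership.Propositional.Properties using (∈-map⁻)
  open import Data.List.Properties using (map-id)
  open import Data.List.Relation.Binary.Permutation.Propositional using (_↭_; ↭-refl; ↭-trans; prep; swap)
  open import Data.List.Relation.Binary.Permutation.Propositional.Properties using (∈-resp-↭)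
  open import Data.List.Relation.Unary.All as All using (All; []; _∷_)
  open import Data.List.Relation.Unary.Any using (here)
  open import Data.Nat as ℕ using (ℕ; zero; suc; _<_; _≤_; s≤s; z≤n; pred; _+_)
  import Data.Nat.Properties as ℕₚ
  open import Data.Product using (_,_)
  open import Function using (_∘_)
  open import Relation.Nullary using (Dec; yes; no)
  import Relation.Binary.PropositionalEquality as ≡
  open ≡ using (_≡_; _≢_)

  adjacent-< : ∀ {K} c M (i : Fin K) → suc c < M → toℕ i < M → toℕ (adjacent c i) < M
  adjacent-< (suc c) (suc M) fz lt l = s≤s z≤n
  adjacent-< (suc c) (suc M) (fs i) (s≤s lt) (s≤s l) = s≤s (adjacent-< c M i lt l)
  adjacent-< {suc zero}    zero M i lt l = l
  adjacent-< {suc (suc K)} zero M fz lt l = lt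
  adjacent-< {suc (suc K)} zero M (fs fz) lt l = ℕₚ.<-trans (s≤s z≤n) lt
  adjacent-< {suc (suc K)} zero M (fs (fs i)) lt l = l

  adjacent-involutive : ∀ {K} c (i : Fin K) → adjacent c (adjacent c i) ≡ i
  adjacent-involutive (suc c) fz = ≡.refl
  adjacent-involutive (suc c) (fs i) = ≡.cong fs (adjacent-involutive c i)
  adjacent-involutive {suc zero}    zero i = ≡.refl
  adjacent-involutive {suc (suc K)} zero fz = ≡.refl
  adjacent-involutive {suc (suc K)} zero (fs fz) = ≡.refl
  adjacent-involutive {suc (suc K)} zero (fs (fs i)) = ≡.refl

  module Bounded (A : CRing) (P : CommutativeRing.Carrier A) where
    open Evolution A P public

    factors : ∀ K → ℕ → ℕ → Fin K → ∣ K ∣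
    factors K zero    a i = Op.1# K
    factors K (suc d) a i = factor K a i *[ K ] factors K d (suc a) i

    -- Regroups the product of the rows by columns: the right-hand side of the theorem is a product
    -- over columns, and the expansion omits all factors of one column.
    evolve-∏ : ∀ K d a f → evolve K d a f ≈[ K ] LA.∏ K (factors K d a) (fins K) *[ K ] f
    evolve-∏ K zero    a f = Op.sym K (Op.trans K (Op.*-congʳ K (LA.∏-1 K (fins K))) (Op.*-identityˡ K f))
    evolve-∏ K (suc d) a f = Op.trans K (Op.*-congˡ K (evolve-∏ K d (suc a) f))
      (Op.trans K (Op.sym K (Op.*-assoc K _ _ _)) (Op.*-congʳ K (Op.sym K (LA.∏-* K _ _ (fins K)))))

    factors-homo : ∀ K L (h : Hom (PS K) (PS L)) {i j} s d a →
      (∀ a → s ≤ a → Hom.⟦_⟧ h (factor K a i) ≈[ L ] factor L a j) → s ≤ a →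
      Hom.⟦_⟧ h (factors K d a i) ≈[ L ] factors L d a j
    factors-homo K L h s zero    a e le = Hom.1-homo h
    factors-homo K L h s (suc d) a e le = Op.trans L (Hom.*-homo h _ _)
      (Op.*-cong L (e a le) (factors-homo K L h s d (suc a) e (ℕₚ.m≤n⇒m≤1+n le)))

    setZero-scalar : ∀ {K} (i : Fin K) v → Hom.⟦_⟧ (setZero i) (scalar K v) ≈[ K ] scalar K v
    setZero-scalar {suc K} fz     v zero    = Op.refl K
    setZero-scalar {suc K} fz     v (suc n) = Op.refl K
    setZero-scalar {suc K} (fs i) v zero    = setZero-scalar i v
    setZero-scalar {suc K} (fs i) v (suc n) = Hom.0-homo (setZero i)

    setZero-factor : ∀ {K} (i j : Fin K) a → j ≢ i → Hom.⟦_⟧ (setZero i) (factor K a j) ≈[ K ] factor K a j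
    setZero-factor {K} i j a ne = Op.trans K (+-homo _ _) (Op.+-cong K 1-homo
      (Op.trans K (*-homo _ _) (Op.*-cong K (setZero-scalar i _) (setZero-X i j ne))))
      where open Hom (setZero i)

    constant-factor : ∀ K a i → Hom.⟦_⟧ (Univariate.constantHom (PS K)) (factor K a i) ≈[ suc K ] factor (suc K) (suc a) (fs i)
    constant-factor K a i = Op.trans (suc K) (+-homo (Op.1# K) _) (Op.+-cong (suc K) 1-homo (*-homo _ (X i)))
      where open Hom (Univariate.constantHom (PS K))

    constant-factors : ∀ K d a i → Hom.⟦_⟧ (Univariate.constantHom (PS K)) (factors K d a i) ≈[ suc K ] factors (suc K) d (suc a) (fs i)
    constant-factors K zero    a i = Hom.1-homo (Univariate.constantHom (PS K))
    constant-factors K (suc d) a i = Op.trans (suc K) (Hom.*-homo (Univariate.constantHom (PS K)) (factor K a i) _)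
      (Op.*-cong (suc K) (constant-factor K a i) (constant-factors K d (suc a) i))

    expansionTerm : ∀ N → ℕ → ℕ → Fin N → List (Fin N) → ∣ N ∣
    expansionTerm N d M i js = LA.∏ N (factors N d (suc M)) js *[ N ] littlewood N js

    -- In the application the exit row has M + 1 active columns. The columns i < M are then those
    -- that are older than its newest one, so their factors from that row on are plain powers of 1 +
    -- x_i.
    expansionPick : ∀ N → ℕ → ℕ → Fin N → List (Fin N) → ∣ N ∣
    expansionPick N d M i js = Sums.guard (PS N) (toℕ i ℕ.<? M) (expansionTerm N d M i js)

    -- Column i has reached its final length, the others carry on for d rows.
    expansion : ∀ N → ℕ → ℕ → ∣ N ∣
    expansion N d M = LA.altSum N (expansionPick N d M) (fins N)

    ones : ∀ {K} → (Fin K → ℕ) → A.Carrier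
    ones _ = A.1#

    module _ (torsionFree : TorsionFree) (B : ℕ) where

      -- Every admissible last row counts with weight 1, and L is the antisymmetric series with
      -- coefficient 1 at all strictly increasing exponents.
      coeff-evolve-littlewood : ∀ K b (T : Fin K → ℕ) → (∀ i → T i ≡ b + toℕ i) → suc b < B → ∀ d a z ℓ → Strict z → (∀ i → ℓ i ≤ b) → (∀ i → z i + ℓ i ≡ T i) →
        total B K b d a ones ℓ A.≈ coeff K (evolve K d a (littlewood K (fins K))) z
      coeff-evolve-littlewood K b T T-def b<B d a = coeff-evolve torsionFree K b T T-def B b<B d a _ ones
        (λ c lt _ → antisym-littlewood K c lt)
        (λ z ℓ st _ _ → A.sym (coeff-littlewood K z st))

      module Expansion (b K d M : ℕ) (0<M : 0 < M) where
        open Op (suc K) hiding (_+_)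

        private
          open module G = Sums (PS (suc K)) using () renaming (guard to guardK; guard-yes to guardK-yes; guard-no to guardK-no)

        term : Fin (suc K) → List (Fin (suc K)) → ∣ suc K ∣
        term = expansionTerm (suc K) d M

        picked : Fin (suc K) → List (Fin (suc K)) → ∣ suc K ∣
        picked = expansionPick (suc K) d M

        picked-swap : ∀ i {js ks} → SwapAdj js ks → picked i js ≈ - picked i ks
        picked-swap i {js} {ks} s = by (toℕ i ℕ.<? M)
          where
          open import Algebra.Properties.Ring ring
          by : (p : Dec (toℕ i < M)) → guardK p (term i js) ≈ - guardK p (term i ks)
          by (yes _) = trans (*-cong (LA.∏-↭ (suc K) _ (SwapAdj⇒↭ s)) (Lw.littlewood-swap (suc K) s)) (sym (-‿distribʳ-* _ (littlewood (suc K) ks)))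
          by (no _)  = sym -0#≈0#

        σ-picked : ∀ c → suc c < M → ∀ i js →
          Hom.⟦_⟧ (σ (suc K) c) (picked i js) ≈ picked (adjacent c i) (map (adjacent c) js)
        σ-picked c lt i js = by (toℕ i ℕ.<? M)
          where
          open Hom (σ (suc K) c)
          by : Dec (toℕ i < M) → ⟦ picked i js ⟧ ≈ picked (adjacent c i) (map (adjacent c) js)
          by (yes l) = begin
            ⟦ picked i js ⟧   ≈⟨ ⟦⟧-cong (reflexive (guardK-yes (toℕ i ℕ.<? M) l)) ⟩
            ⟦ term i js ⟧     ≈⟨ *-homo _ _ ⟩
            _                 ≈⟨ *-cong (∏-homo (suc K) (suc K) (σ (suc K) c) (adjacent c) js
                                   (All.universal (λ j → factors-homo (suc K) (suc K) (σ (suc K) c) (suc M) d (suc M)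
                                     (λ a le → σ-factor (suc K) c a j (ℕₚ.<-≤-trans (s≤s lt) le)) ℕₚ.≤-refl) js))
                                   (littlewood-homo (suc K) (suc K) (σ (suc K) c) (adjacent c) (All.universal (σ-X c) js)) ⟩
            term (adjacent c i) (map (adjacent c) js) ≈⟨ reflexive (guardK-yes (toℕ (adjacent c i) ℕ.<? M) (adjacent-< c M i lt l)) ⟨
            picked (adjacent c i) (map (adjacent c) js) ∎
            where open import Relation.Binary.Reasoning.Setoid setoid
          by (no ¬l) = trans (⟦⟧-cong (reflexive (guardK-no (toℕ i ℕ.<? M) ¬l))) (trans 0-homo
            (sym (reflexive (guardK-no (toℕ (adjacent c i) ℕ.<? M)
              (λ l → ¬l (≡.subst (λ t → toℕ t < M) (adjacent-involutive c i) (adjacent-< c M (adjacent c i) lt l)))))))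

        -- An exchange among the first M indices preserves the guard `toℕ i < M` and permutes the
        -- summands, whose remaining factors are symmetric in both columns. This is what the
        -- summation over all i < M achieves; the summand for the first column alone would not be
        -- antisymmetric.
        antisym-expansion : ∀ c → suc c < suc K → suc c < M → Antisym (suc K) c (expansion (suc K) d M)
        antisym-expansion c lt lt′ = begin
          Hom.⟦_⟧ (σ (suc K) c) (expansion (suc K) d M)
            ≈⟨ altSum-homo (suc K) (suc K) (σ (suc K) c) (adjacent c) {g = picked} (fins (suc K)) (σ-picked c lt′) ⟩
          LA.altSum (suc K) picked (map (adjacent c) (fins (suc K)))
            ≈⟨ -‿involutive _ ⟨
          - - LA.altSum (suc K) picked (map (adjacent c) (fins (suc K)))
            ≈⟨ -‿cong (LA.altSum-swap (suc K) picked picked-swap (fins-swap c lt)) ⟨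
          - (expansion (suc K) d M) ∎
          where
          open import Algebra.Properties.Ring ring
          open import Relation.Binary.Reasoning.Setoid setoid

        -- The summand for `i` is built from the other variables only, since the list has no
        -- repetitions.
        picked-vanish : ∀ i js z {n} → (i ∷ js) ↭ fins (suc K) → z i ≡ suc n → coeff (suc K) (picked i js) z A.≈ A.0#
        picked-vanish i js z p e = by (toℕ i ℕ.<? M)
          where
          ne = ∉-of-pick (fins-unique (suc K)) p
          fixed : Hom.⟦_⟧ (setZero i) (term i js) ≈ term i js
          fixed = ≡.subst
            (λ l → Hom.⟦_⟧ (setZero i) (term i js) ≈ LA.∏ (suc K) (factors (suc K) d (suc M)) l * littlewood (suc K) l)
            (map-id js)
            (trans (Hom.*-homo (setZero i) _ _) (*-cong
              (∏-homo (suc K) (suc K) (setZero i) (λ j → j) js (All.map (λ {j} ne → factors-homo (suc K) (suc K) (setZero i) 0 d (suc M)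
                (λ a _ → setZero-factor i j a ne) z≤n) ne))
              (littlewood-homo (suc K) (suc K) (setZero i) (λ j → j) (All.map (λ {j} → setZero-X i j) ne))))
          by : (p : Dec (toℕ i < M)) → coeff (suc K) (guardK p (term i js)) z A.≈ A.0#
          by (no _)  = A.reflexive (coeff-0 (suc K) z)
          by (yes _) = coeff-fixed-0 i (term i js) z fixed e

        rest : List (Fin (suc K))
        rest = map fs (fins K)

        -- Without the first column the others are renumbered from 0, so `suc M` active columns
        -- become `M`.
        lower : ∣ K ∣
        lower = evolve K d M (littlewood K (fins K))

        picked-first : picked fz rest ≈ Univariate.constant (PS K) lower
        picked-first = begin
          picked fz rest
            ≈⟨ reflexive (guardK-yes (0 ℕ.<? M) 0<M) ⟩
          LA.∏ (suc K) (factors (suc K) d (suc M)) rest * littlewood (suc K) rest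
            ≈⟨ *-cong (∏-homo K (suc K) constantHom fs (fins K) (All.universal (constant-factors K d M) (fins K)))
                      (littlewood-homo K (suc K) constantHom fs {fins K} (constantX K (fins K))) ⟨
          constant (LA.∏ K (factors K d M) (fins K)) * constant (littlewood K (fins K))
            ≈⟨ Hom.*-homo constantHom _ (littlewood K (fins K)) ⟨
          constant (LA.∏ K (factors K d M) (fins K) *[ K ] littlewood K (fins K))
            ≈⟨ Hom.⟦⟧-cong constantHom (evolve-∏ K d M (littlewood K (fins K))) ⟨
          constant lower ∎
          where
          open Univariate (PS K)
          open import Relation.Binary.Reasoning.Setoid setoid

        -- Strictly increasing exponents are positive from the second one on, so `picked-vanish`
        -- removes every summand but the first.
        coeff-expansion : ∀ z → Strict z → coeff (suc K) (expansion (suc K) d M) z A.≈ coeff (suc K) (Univariate.constant (PS K) lower) z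
        coeff-expansion z st = begin
          coeff (suc K) (picked fz rest - R) z
            ≡⟨ coeff-+ (suc K) (picked fz rest) (- R) z ⟩
          coeff (suc K) (picked fz rest) z A.+ coeff (suc K) (- R) z
            ≈⟨ A.+-cong (coeff-cong (suc K) picked-first z)
                 (A.trans (A.reflexive (coeff-neg (suc K) R z)) (A.-‿cong others)) ⟩
          coeff (suc K) (Univariate.constant (PS K) lower) z A.- A.0#
            ≈⟨ A.trans (A.+-congˡ -0#≈0#) (A.+-identityʳ _) ⟩
          coeff (suc K) (Univariate.constant (PS K) lower) z ∎
          where
          open import Algebra.Properties.Ring A.ring
          open import Relation.Binary.Reasoning.Setoid A.setoid
          R = LA.altSum (suc K) (λ j js → picked j (fz ∷ js)) rest
          positive : ∀ i {js} → (i ∷ js) ↭ rest → z i ≡ suc (pred (z i))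
          positive i p with ∈-map⁻ fs (∈-resp-↭ p (here ≡.refl))
          ... | j , _ , ≡.refl = ≡.sym (ℕₚ.suc-pred (z (fs j)) {{ℕ.>-nonZero (ℕₚ.≤-<-trans z≤n (st {fz} {fs j} (s≤s z≤n)))}})
          others : coeff (suc K) R z A.≈ A.0#
          others = coeff-altSum-0 _ z rest λ i js p →
            picked-vanish i (fz ∷ js) z (↭-trans (swap i fz ↭-refl) (prep fz p)) (positive i p)

        -- The first column has to have length b = k-1, so that the next row completes it to k; from
        -- then on the other lengths may reach `suc b`.
        afterExit : (Fin (suc K) → ℕ) → A.Carrier
        afterExit ℓ = Sums.guard A (ℓ fz ℕ.≟ b) (total B K (suc b) d M ones (ℓ ∘ fs))

        afterExit-coeff : suc (suc b) < B → ∀ z ℓ → Strict z → (∀ i → ℓ i ≤ b) → (∀ i → z i + ℓ i ≡ b + toℕ i) →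
          afterExit ℓ A.≈ coeff (suc K) (expansion (suc K) d M) z
        afterExit-coeff b<B z ℓ st ℓ≤b e = A.trans (by (z fz) ≡.refl) (A.sym (coeff-expansion z st))
          where
          b≡ : b + 0 ≡ b
          b≡ = ℕₚ.+-identityʳ b
          by : ∀ n → z fz ≡ n → afterExit ℓ A.≈ coeff K (Univariate.constant (PS K) lower (z fz)) (z ∘ fs)
          by zero e₀ rewrite e₀ = A.trans (A.reflexive (Sums.guard-yes A (ℓ fz ℕ.≟ b)
              (≡.trans (≡.cong (λ t → t + ℓ fz) (≡.sym e₀)) (≡.trans (e fz) b≡))))
            -- Renumbering lowers the index of a column by 1 and the exit raises the bound by 1; the
            -- two changes cancel, so the remaining exponents stay as they are.
            (coeff-evolve-littlewood K (suc b) (λ i → suc b + toℕ i) (λ _ → ≡.refl) b<B d M (z ∘ fs) (ℓ ∘ fs)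
              (λ lt → st (s≤s lt)) (λ i → ℕₚ.m≤n⇒m≤1+n (ℓ≤b (fs i))) (λ i → ≡.trans (e (fs i)) (ℕₚ.+-suc b (toℕ i))))
          by (suc n) e₀ rewrite e₀ = A.trans
            (A.reflexive (Sums.guard-no A (ℓ fz ℕ.≟ b) (λ ℓ≡ → ℕₚ.m≢1+n+m b {n}
              (≡.sym (≡.trans (≡.cong₂ (λ s t → s + t) (≡.sym e₀) (≡.sym ℓ≡)) (≡.trans (e fz) b≡))))))
            (A.sym (A.reflexive (coeff-0 K (z ∘ fs))))

        total-expansion : suc (suc b) < B → ∀ s a → s + a ≡ suc M → ∀ z ℓ → Strict z → (∀ i → ℓ i ≤ b) → (∀ i → z i + ℓ i ≡ b + toℕ i) →
          total B (suc K) b s a afterExit ℓ A.≈ coeff (suc K) (evolve (suc K) s a (expansion (suc K) d M)) z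
        total-expansion b<B s a s+a = coeff-evolve torsionFree (suc K) b (λ i → b + toℕ i) (λ _ → ≡.refl) B (ℕₚ.<-trans (ℕₚ.n<1+n _) b<B) s a
          (expansion (suc K) d M) afterExit (λ c lt lt′ → antisym-expansion c lt (ℕ.s≤s⁻¹ (≡.subst (2 + c <_) s+a lt′)))
          (afterExit-coeff b<B)

-- The bijection between trapezoids and arrays of column lengths.

module ColumnLengths where

  open import Defs using (Array; InT; inT?; IsMagog; minima)
  open import Data.Bool using (true; false)
  open import Data.Empty using (⊥; ⊥-elim)
  open import Data.Fin using (Fin; toℕ; fromℕ<; inject₁) renaming (zero to fz; suc to fs)
  import Data.Fin.Properties as Finₚ
  open import Data.List using (List; []; _∷_; map; filter; length; allFin; cartesianProduct; tabulate)
  import Data.List.Properties as Listₚ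
  open import Data.Nat using (ℕ; zero; suc; _+_; _∸_; _<_; _≤_; _⊓_; _≟_; _<?_; _≤?_; s≤s; z≤n; s≤s⁻¹)
  open import Data.Nat.Properties
  open import Data.Product using (_×_; _,_; proj₁; proj₂; ∃)
  open import Data.Sum using (_⊎_; inj₁; inj₂)
  open import Function using (_∘_; id)
  open import Relation.Nullary using (Dec; yes; no; does; ¬_)
  open import Relation.Nullary.Decidable using (_×-dec_; _→-dec_; _⊎-dec_)
  open import Relation.Binary.PropositionalEquality

  threshold : ∀ {Q : ℕ → Set} → (∀ d → Dec (Q d)) → ℕ → ℕ
  threshold Q? zero = 0
  threshold Q? (suc w) with Q? 0
  ... | yes _ = suc (threshold (λ d → Q? (suc d)) w)
  ... | no  _ = 0

  threshold-≤ : ∀ {Q : ℕ → Set} (Q? : ∀ d → Dec (Q d)) w → threshold Q? w ≤ w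
  threshold-≤ Q? zero = z≤n
  threshold-≤ Q? (suc w) with Q? 0
  ... | yes _ = s≤s (threshold-≤ (λ d → Q? (suc d)) w)
  ... | no  _ = z≤n

  <threshold⇒ : ∀ {Q : ℕ → Set} (Q? : ∀ d → Dec (Q d)) w d → d < threshold Q? w → Q d
  <threshold⇒ Q? (suc w) d lt with Q? 0
  <threshold⇒ Q? (suc w) zero    lt       | yes p = p
  <threshold⇒ Q? (suc w) (suc d) (s≤s lt) | yes p = <threshold⇒ (λ d → Q? (suc d)) w d lt

  ⇒<threshold : ∀ {Q : ℕ → Set} (Q? : ∀ d → Dec (Q d)) w →
    (∀ d → suc d < w → Q (suc d) → Q d) → ∀ d → d < w → Q d → d < threshold Q? w
  ⇒<threshold Q? (suc w) down d lt q with Q? 0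
  ⇒<threshold Q? (suc w) down zero    lt       q | yes _ = s≤s z≤n
  ⇒<threshold Q? (suc w) down (suc d) (s≤s lt) q | yes _ =
    s≤s (⇒<threshold (λ d → Q? (suc d)) w (λ d l → down (suc d) (s≤s l)) d lt q)
  ⇒<threshold {Q} Q? (suc w) down d lt q | no ¬p = ⊥-elim (¬p (descend d lt q))
    where
    descend : ∀ d → d < suc w → Q d → Q 0
    descend zero    lt q = q
    descend (suc d) lt q = descend d (<-trans (n<1+n d) lt) (down d lt q)

  -- `Matches` describes a length only through the distances below it, so inequalities between
  -- lengths are proved in this form.
  ≤-from-< : ∀ x y → (∀ d → d < x → d < y) → x ≤ y
  ≤-from-< zero    y e = z≤n
  ≤-from-< (suc x) y e = e x ≤-refl

  count : ∀ {n} {Q : Fin n → Set} → (∀ i → Dec (Q i)) → ℕ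
  count {zero}  Q? = 0
  count {suc n} Q? with Q? fz
  ... | yes _ = suc (count (λ i → Q? (fs i)))
  ... | no  _ = count (λ i → Q? (fs i))

  length-filter-tabulate : ∀ {n} {I : Set} {Q : I → Set} (Q? : ∀ i → Dec (Q i)) (f : Fin n → I) →
    length (filter Q? (tabulate f)) ≡ count (λ i → Q? (f i))
  length-filter-tabulate {zero}  Q? f = refl
  length-filter-tabulate {suc n} Q? f with Q? (f fz)
  ... | yes _ = cong suc (length-filter-tabulate Q? (λ i → f (fs i)))
  ... | no  _ = length-filter-tabulate Q? (λ i → f (fs i))

  length-filter-map : ∀ {I J : Set} {Q : J → Set} (Q? : ∀ j → Dec (Q j)) (f : I → J) is →
    length (filter Q? (map f is)) ≡ length (filter (λ i → Q? (f i)) is)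
  length-filter-map Q? f [] = refl
  length-filter-map Q? f (i ∷ is) with does (Q? (f i))
  ... | true  = cong suc (length-filter-map Q? f is)
  ... | false = length-filter-map Q? f is

  count-cong : ∀ {n} {Q Q′ : Fin n → Set} (Q? : ∀ i → Dec (Q i)) (Q′? : ∀ i → Dec (Q′ i)) →
    (∀ i → Q i → Q′ i) → (∀ i → Q′ i → Q i) → count Q? ≡ count Q′?
  count-cong {zero}  Q? Q′? f g = refl
  count-cong {suc n} Q? Q′? f g with Q? fz | Q′? fz
  ... | yes _ | yes _ = cong suc (count-cong (Q? ∘ fs) (Q′? ∘ fs) (f ∘ fs) (g ∘ fs))
  ... | yes q | no ¬q = ⊥-elim (¬q (f fz q))
  ... | no ¬q | yes q = ⊥-elim (¬q (g fz q))
  ... | no _  | no _  = count-cong (Q? ∘ fs) (Q′? ∘ fs) (f ∘ fs) (g ∘ fs)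

  count-none : ∀ {n} {Q : Fin n → Set} (Q? : ∀ i → Dec (Q i)) → (∀ i → ¬ Q i) → count Q? ≡ 0
  count-none {zero}  Q? e = refl
  count-none {suc n} Q? e with Q? fz
  ... | yes q = ⊥-elim (e fz q)
  ... | no  _ = count-none (Q? ∘ fs) (e ∘ fs)

  count-one : ∀ {n} {Q : Fin n → Set} (Q? : ∀ i → Dec (Q i)) j → Q j → (∀ i → Q i → i ≡ j) → count Q? ≡ 1
  count-one {suc n} Q? j q u with Q? fz
  count-one {suc n} Q? j q u | yes q₀ = cong suc (count-none (Q? ∘ fs) (λ i qi → neq (u (fs i) qi) (u fz q₀)))
    where
    neq : ∀ {i : Fin n} {j} → fs i ≡ j → fz ≡ j → ⊥
    neq refl ()
  count-one {suc n} Q? fz     q u | no ¬q = ⊥-elim (¬q q)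
  count-one {suc n} Q? (fs j) q u | no ¬q = count-one (Q? ∘ fs) j q (λ i qi → Finₚ.suc-injective (u (fs i) qi))

  count-interval : ∀ {n} {Q : Fin n → Set} (Q? : ∀ i → Dec (Q i)) a t → a + t ≤ n →
    (∀ i → Q i → (a ≤ toℕ i) × (toℕ i < a + t)) → (∀ i → a ≤ toℕ i → toℕ i < a + t → Q i) → count Q? ≡ t
  count-interval {zero} Q? zero zero le f g = refl
  count-interval {suc n} Q? zero zero le f g = count-none Q? (λ i q → n≮0 (proj₂ (f i q)))
  count-interval {suc n} Q? zero (suc t) (s≤s le) f g with Q? fz
  ... | no ¬q = ⊥-elim (¬q (g fz z≤n (s≤s z≤n)))
  ... | yes _ = cong suc (count-interval (Q? ∘ fs) zero t le
                  (λ i q → z≤n , s≤s⁻¹ (proj₂ (f (fs i) q))) (λ i _ lt → g (fs i) z≤n (s≤s lt)))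
  count-interval {suc n} Q? (suc a) t (s≤s le) f g with Q? fz
  ... | yes q = ⊥-elim (n≮0 (proj₁ (f fz q)))
  ... | no _  = count-interval (Q? ∘ fs) a t le
                  (λ i q → s≤s⁻¹ (proj₁ (f (fs i) q)) , s≤s⁻¹ (proj₂ (f (fs i) q)))
                  (λ i l lt → g (fs i) (s≤s l) (s≤s lt))

  -- A row meets an SE-diagonal in at most one cell, so minima can be counted by rows.
  count-product : ∀ {n m} {Q : Fin n × Fin m → Set} (Q? : ∀ p → Dec (Q p)) {R : Fin n → Set} (R? : ∀ i → Dec (R i)) →
    (∀ i → R i → ∃ λ j → Q (i , j) × (∀ j′ → Q (i , j′) → j′ ≡ j)) → (∀ i j → Q (i , j) → R i) →
    length (filter Q? (cartesianProduct (allFin n) (allFin m))) ≡ count R?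
  count-product {n} {m} {Q} Q? {R} R? f g = go id
    where
    row : ∀ i → length (filter Q? (map (i ,_) (allFin m))) ≡ count (λ j → Q? (i , j))
    row i = trans (length-filter-map Q? (i ,_) (allFin m)) (length-filter-tabulate (λ j → Q? (i , j)) id)
    go : ∀ {n′} (h : Fin n′ → Fin n) →
      length (filter Q? (cartesianProduct (tabulate h) (allFin m))) ≡ count (λ i → R? (h i))
    go {zero} h = refl
    go {suc n′} h = trans (cong length (Listₚ.filter-++ Q? first others))
      (trans (Listₚ.length-++ (filter Q? first)) (trans (cong₂ _+_ (row (h fz)) (go (h ∘ fs))) total))
      where
      first = map (h fz ,_) (allFin m)
      others = cartesianProduct (tabulate (h ∘ fs)) (allFin m)
      total : count (λ j → Q? (h fz , j)) + count (λ i → R? (h (fs i))) ≡ count (λ i → R? (h i))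
      total with R? (h fz)
      ... | yes r = cong (_+ count (λ i → R? (h (fs i)))) (count-one (λ j → Q? (h fz , j)) (proj₁ (f (h fz) r))
                      (proj₁ (proj₂ (f (h fz) r))) (proj₂ (proj₂ (f (h fz) r))))
      ... | no ¬r = cong (_+ count (λ i → R? (h (fs i)))) (count-none (λ j → Q? (h fz , j)) (λ j q → ¬r (g (h fz) j q)))

  -- For m + n = 1 there are no columns. The value 0 is then the right length of column 1, as no
  -- entry exceeds 1.
  head₀ : ∀ {N} → (Fin N → ℕ) → ℕ
  head₀ {zero}  ℓ = 0
  head₀ {suc N} ℓ = ℓ fz

  Steps : ∀ {N} → ℕ → (ℓ ℓ′ : Fin N → ℕ) → Set
  Steps a ℓ ℓ′ = ∀ c → ℓ′ c ≡ ℓ c ⊎ (toℕ c < a × ℓ′ c ≡ suc (ℓ c))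

  steps? : ∀ {N} a (ℓ ℓ′ : Fin N → ℕ) → Dec (Steps a ℓ ℓ′)
  steps? a ℓ ℓ′ = Finₚ.all? (λ c → (ℓ′ c ≟ ℓ c) ⊎-dec ((toℕ c <? a) ×-dec (ℓ′ c ≟ suc (ℓ c))))

  previous : ∀ {d N} → (Fin N → ℕ) → (Fin d → Fin N → ℕ) → Fin d → Fin N → ℕ
  previous ℓ ℓs fz     = ℓ
  previous ℓ ℓs (fs t) = ℓs (inject₁ t)

  previous-suc : ∀ {d N} (ℓ : Fin N → ℕ) (ℓs : Fin d → Fin N → ℕ) i i′ → toℕ i′ ≡ suc (toℕ i) → previous ℓ ℓs i′ ≡ ℓs i
  previous-suc ℓ ℓs i (fs t) e = cong ℓs (Finₚ.toℕ-injective (trans (Finₚ.toℕ-inject₁ t) (suc-injective e)))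

  previous-zero : ∀ {d N} (ℓ : Fin N → ℕ) (ℓs : Fin d → Fin N → ℕ) i → toℕ i ≡ 0 → previous ℓ ℓs i ≡ ℓ
  previous-zero ℓ ℓs fz e = refl

  Fin-ind : ∀ {n} (Q : Fin n → Set) → (∀ i → toℕ i ≡ 0 → Q i) →
    (∀ i i′ → toℕ i′ ≡ suc (toℕ i) → Q i → Q i′) → ∀ i → Q i
  Fin-ind {n} Q base ind i = go (toℕ i) i refl
    where
    go : ∀ x i → toℕ i ≡ x → Q i
    go zero    i e = base i e
    go (suc x) i e = ind i₁ i (trans e (cong suc (sym i₁≡))) (go x i₁ i₁≡)
      where
      lt : x < n
      lt = <-trans (≤-reflexive (sym e)) (Finₚ.toℕ<n i)
      i₁ : Fin n
      i₁ = fromℕ< lt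
      i₁≡ : toℕ i₁ ≡ x
      i₁≡ = Finₚ.toℕ-fromℕ< lt

  head₀-≡ : ∀ {N} (ℓ : Fin N → ℕ) c → toℕ c ≡ 0 → head₀ ℓ ≡ ℓ c
  head₀-≡ ℓ fz e = refl

  head₀-or : ∀ {N} (ℓ : Fin N → ℕ) → (∃ λ c → toℕ c ≡ 0 × head₀ ℓ ≡ ℓ c) ⊎ (N ≡ 0 × head₀ ℓ ≡ 0)
  head₀-or {zero}  ℓ = inj₂ (refl , refl)
  head₀-or {suc N} ℓ = inj₁ (fz , refl , refl)

  Grew : ∀ {N} → ℕ → (ℓ ℓ′ : Fin N → ℕ) → Set
  Grew a ℓ ℓ′ = ∃ λ c → suc (toℕ c) ≡ a × ℓ′ c ≡ suc (ℓ c)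

  grew? : ∀ {N} a (ℓ ℓ′ : Fin N → ℕ) → Dec (Grew a ℓ ℓ′)
  grew? a ℓ ℓ′ = Finₚ.any? (λ c → (suc (toℕ c) ≟ a) ×-dec (ℓ′ c ≟ suc (ℓ c)))

  -- Rows of column lengths: ℓ c is the number of entries of a row of the
  -- trapezoid that exceed c + 1.  The first column has full length k exactly
  -- from row s on.
  module _ (m k s : ℕ) where

    RowOK : ∀ {N} → ℕ → (Fin N → ℕ) → Set
    RowOK i ℓ = (∀ c → ℓ c ≤ k) × (∀ c c′ → toℕ c < toℕ c′ → ℓ c′ ≤ ℓ c) × (i < s → head₀ ℓ < k) × (s ≤ i → head₀ ℓ ≡ k)

    rowOK? : ∀ {N} i (ℓ : Fin N → ℕ) → Dec (RowOK i ℓ)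
    rowOK? i ℓ = Finₚ.all? (λ c → ℓ c ≤? k)
      ×-dec Finₚ.all? (λ c → Finₚ.all? (λ c′ → (toℕ c <? toℕ c′) →-dec (ℓ c′ ≤? ℓ c)))
      ×-dec ((i <? s) →-dec (head₀ ℓ <? k)) ×-dec ((s ≤? i) →-dec (head₀ ℓ ≟ k))

    ValidFrom : ∀ {d N} → ℕ → (Fin N → ℕ) → (Fin d → Fin N → ℕ) → Set
    ValidFrom i ℓ ℓs = ∀ t → Steps (m + (i + toℕ t)) (previous ℓ ℓs t) (ℓs t) × RowOK (i + toℕ t) (ℓs t)

    validFrom? : ∀ {d N} i ℓ (ℓs : Fin d → Fin N → ℕ) → Dec (ValidFrom i ℓ ℓs)
    validFrom? i ℓ ℓs = Finₚ.all? (λ t → steps? (m + (i + toℕ t)) (previous ℓ ℓs t) (ℓs t) ×-dec rowOK? (i + toℕ t) (ℓs t))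

  module Correspondence (m n k q N : ℕ) (1≤k : 1 ≤ k) (k≤n : k ≤ n) (q≤ : q ≤ n ∸ k + 1) (N-def : suc N ≡ m + n) where

    -- The leftmost SE-diagonal begins in row k-1, counted from 0, so q minima at its top put its
    -- first larger entry into this row; the value n means that there is none.
    s : ℕ
    s = k ∸ 1 + q

    k≡ : k ≡ suc (k ∸ 1)
    k≡ = sym (trans (+-comm 1 (k ∸ 1)) (m∸n+n≡m 1≤k))

    Lengths : Set
    Lengths = Fin n → Fin N → ℕ

    Valid : Lengths → Set
    Valid = ValidFrom m k s 0 (λ _ → 0)

    -- Rows of a trapezoid increase weakly to the right, so the entries above c + 1 are the last
    -- ones of the row, and `toℕ i ∸ toℕ j` is the distance from its end. A relation instead of a
    -- function serves both directions of the bijection.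
    Matches : Array n → Lengths → Set
    Matches A ℓs = ∀ i j c → InT n k i j →
      (suc (toℕ c) < A i j → toℕ i ∸ toℕ j < ℓs i c) × (toℕ i ∸ toℕ j < ℓs i c → suc (toℕ c) < A i j)

    matches? : ∀ A ℓs → Dec (Matches A ℓs)
    matches? A ℓs = Finₚ.all? λ i → Finₚ.all? λ j → Finₚ.all? λ c → inT? n k i j →-dec
      (((suc (toℕ c) <? A i j) →-dec (toℕ i ∸ toℕ j <? ℓs i c)) ×-dec
       ((toℕ i ∸ toℕ j <? ℓs i c) →-dec (suc (toℕ c) <? A i j)))

    -- A row has at most k and at most i + 1 cells. `Matches` cannot detect a length beyond that, so
    -- these bounds are what makes the lengths unique.
    Bounded : Lengths → Set
    Bounded ℓs = ∀ i c → ℓs i c ≤ k × ℓs i c ≤ suc (toℕ i)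

    -- The first q entries of the leftmost SE-diagonal are its minima.
    MinimaAt : Array n → Set
    MinimaAt A = ∀ i j → InT n k i j → toℕ i ≡ toℕ j + (k ∸ 1) → (A i j ≡ 1 → toℕ i < s) × (toℕ i < s → A i j ≡ 1)

    cell : ∀ i d → d ≤ toℕ i → d < k → ∃ λ j → InT n k i j × toℕ j + d ≡ toℕ i
    cell i d d≤i d<k = j , (subst (_≤ toℕ i) (sym j≡) (m∸n≤m (toℕ i) d) ,
        subst (_< toℕ j + k) eq (+-monoʳ-< (toℕ j) d<k)) , eq
      where
      j : Fin n
      j = fromℕ< (≤-<-trans (m∸n≤m (toℕ i) d) (Finₚ.toℕ<n i))
      j≡ : toℕ j ≡ toℕ i ∸ d
      j≡ = Finₚ.toℕ-fromℕ< _
      eq : toℕ j + d ≡ toℕ i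
      eq = trans (cong (_+ d) j≡) (m∸n+n≡m d≤i)

    depth : ∀ {x y d} → y + d ≡ x → x ∸ y ≡ d
    depth {y = y} {d} refl = m+n∸m≡n y d

    cell-unique : ∀ (i j j′ : Fin n) d → toℕ j + d ≡ toℕ i → toℕ j′ + d ≡ toℕ i → j ≡ j′
    cell-unique i j j′ d p p′ = Finₚ.toℕ-injective (+-cancelʳ-≡ d (toℕ j) (toℕ j′) (trans p (sym p′)))

    depth-< : ∀ {i j : Fin n} → InT n k i j → toℕ i ∸ toℕ j < k
    depth-< {i} {j} (j≤i , i<j+k) = +-cancelˡ-< (toℕ j) _ _ (subst (_< toℕ j + k) (sym (m+[n∸m]≡n j≤i)) i<j+k)

    s≤n : s ≤ n
    s≤n = begin
      k ∸ 1 + q                 ≤⟨ +-monoʳ-≤ (k ∸ 1) q≤ ⟩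
      k ∸ 1 + (n ∸ k + 1)       ≡⟨ trans (cong (k ∸ 1 +_) (+-comm (n ∸ k) 1)) (+-suc (k ∸ 1) (n ∸ k)) ⟩
      suc (k ∸ 1) + (n ∸ k)     ≡⟨ cong (_+ (n ∸ k)) k≡ ⟨
      k + (n ∸ k)               ≡⟨ m+[n∸m]≡n k≤n ⟩
      n ∎
      where open ≤-Reasoning

    module _ {A : Array n} where

      LeftOne : Fin n → Set
      LeftOne i = ∃ λ j → (InT n k i j × (toℕ i ≡ toℕ j + (k ∸ 1))) × A i j ≡ 1

      leftOne? : ∀ i → Dec (LeftOne i)
      leftOne? i = Finₚ.any? (λ j → (inT? n k i j ×-dec (toℕ i ≟ toℕ j + (k ∸ 1))) ×-dec (A i j ≟ 1))

      minima≡count : minima n k A ≡ count leftOne?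
      minima≡count = count-product _ leftOne?
        (λ { i (j , (t , e) , a) → j , (t , e , a) , λ { j′ (t′ , e′ , a′) → cell-unique i j′ j (k ∸ 1) (sym e′) (sym e) } })
        (λ { i j (t , e , a) → j , (t , e) , a })

      left-cell : ∀ i → k ∸ 1 ≤ toℕ i → ∃ λ j → InT n k i j × (toℕ i ≡ toℕ j + (k ∸ 1))
      left-cell i le with cell i (k ∸ 1) le (subst (k ∸ 1 <_) (sym k≡) (n<1+n _))
      ... | j , t , e = j , t , sym e

      count-leftOne : ∀ t → k ∸ 1 + t ≤ n →
        (∀ i j → InT n k i j → toℕ i ≡ toℕ j + (k ∸ 1) → (A i j ≡ 1 → toℕ i < k ∸ 1 + t) × (toℕ i < k ∸ 1 + t → A i j ≡ 1)) →
        minima n k A ≡ t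
      count-leftOne t le f = trans minima≡count (count-interval leftOne? (k ∸ 1) t le
        (λ { i (j , (w , e) , a) → subst (k ∸ 1 ≤_) (sym e) (m≤n+m (k ∸ 1) (toℕ j)) , proj₁ (f i j w e) a })
        (λ i l lt → let (j , w , e) = left-cell i l in j , (w , e) , proj₂ (f i j w e) lt))

      minimaAt⇒minima : MinimaAt A → minima n k A ≡ q
      minimaAt⇒minima = count-leftOne q s≤n

      left-monotone : IsMagog m n k A → ∀ i i′ j j′ → toℕ i′ ≡ suc (toℕ i) → InT n k i j → toℕ i ≡ toℕ j + (k ∸ 1) →
        InT n k i′ j′ → toℕ i′ ≡ toℕ j′ + (k ∸ 1) → A i′ j′ ≡ 1 → A i j ≡ 1
      left-monotone (_ , rng , _ , dia) i i′ j j′ e w d w′ d′ a = ≤-antisym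
        (≤-trans (dia i i′ j j′ e (+-cancelʳ-≡ (k ∸ 1) (toℕ j′) (suc (toℕ j)) (trans (sym d′) (trans e (cong suc d)))) w w′) (≤-reflexive a))
        (proj₁ (rng i j w))

      -- Entries increase weakly down the leftmost SE-diagonal, so its ones form an initial segment.
      -- `threshold` finds the length of the segment, and counting identifies it with q.
      minima⇒minimaAt : IsMagog m n k A → minima n k A ≡ q → MinimaAt A
      minima⇒minimaAt M e i j w d = subst (λ x → (A i j ≡ 1 → toℕ i < k ∸ 1 + x) × (toℕ i < k ∸ 1 + x → A i j ≡ 1)) (trans (sym (count-leftOne t t≤n at)) e) (at i j w d)
        where
        Q : ℕ → Set
        Q y = ∃ λ i → ∃ λ j → (InT n k i j × (toℕ i ≡ toℕ j + (k ∸ 1)) × (toℕ j ≡ y)) × A i j ≡ 1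
        Q? : ∀ y → Dec (Q y)
        Q? y = Finₚ.any? (λ i → Finₚ.any? (λ j → (inT? n k i j ×-dec (toℕ i ≟ toℕ j + (k ∸ 1)) ×-dec (toℕ j ≟ y)) ×-dec (A i j ≟ 1)))
        -- The number of cells of the leftmost SE-diagonal.
        w₀ : ℕ
        w₀ = n ∸ (k ∸ 1)
        t : ℕ
        t = threshold Q? w₀
        t≤n : k ∸ 1 + t ≤ n
        t≤n = ≤-trans (+-monoʳ-≤ (k ∸ 1) (threshold-≤ Q? w₀)) (≤-reflexive (m+[n∸m]≡n (≤-trans (m∸n≤m k 1) k≤n)))
        down : ∀ y → suc y < w₀ → Q (suc y) → Q y
        down y lt (i , j , (w , d , y≡) , a) = i₁ , j₁ , (w₁ , d₁ , j₁≡) , left-monotone M i₁ i j₁ j i≡ w₁ d₁ w d a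
          where
          i≡₀ : toℕ i ≡ suc (y + (k ∸ 1))
          i≡₀ = trans d (cong (_+ (k ∸ 1)) y≡)
          i₁ : Fin n
          i₁ = fromℕ< (<-trans (≤-reflexive (sym i≡₀)) (Finₚ.toℕ<n i))
          i₁≡ : toℕ i₁ ≡ y + (k ∸ 1)
          i₁≡ = Finₚ.toℕ-fromℕ< _
          i≡ : toℕ i ≡ suc (toℕ i₁)
          i≡ = trans i≡₀ (cong suc (sym i₁≡))
          c = left-cell i₁ (subst (k ∸ 1 ≤_) (sym i₁≡) (m≤n+m (k ∸ 1) y))
          j₁ = proj₁ c
          w₁ = proj₁ (proj₂ c)
          d₁ = proj₂ (proj₂ c)
          j₁≡ : toℕ j₁ ≡ y
          j₁≡ = +-cancelʳ-≡ (k ∸ 1) (toℕ j₁) y (trans (sym d₁) i₁≡)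
        at : ∀ i j → InT n k i j → toℕ i ≡ toℕ j + (k ∸ 1) → (A i j ≡ 1 → toℕ i < k ∸ 1 + t) × (toℕ i < k ∸ 1 + t → A i j ≡ 1)
        at i j w d = to , from
          where
          j<w₀ : toℕ j < w₀
          j<w₀ = +-cancelˡ-< (k ∸ 1) (toℕ j) w₀ (subst₂ _<_ (trans d (+-comm (toℕ j) (k ∸ 1))) (sym (m+[n∸m]≡n (≤-trans (m∸n≤m k 1) k≤n))) (Finₚ.toℕ<n i))
          to : A i j ≡ 1 → toℕ i < k ∸ 1 + t
          to a = subst (_< k ∸ 1 + t) (trans (+-comm (k ∸ 1) (toℕ j)) (sym d))
            (+-monoʳ-< (k ∸ 1) (⇒<threshold Q? w₀ down (toℕ j) j<w₀ (i , j , (w , d , refl) , a)))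
          from : toℕ i < k ∸ 1 + t → A i j ≡ 1
          from lt with <threshold⇒ Q? w₀ (toℕ j) (+-cancelˡ-< (k ∸ 1) (toℕ j) t (subst (_< k ∸ 1 + t) (trans d (+-comm (toℕ j) (k ∸ 1))) lt))
          ... | i′ , j′ , (w′ , d′ , y≡) , a = subst₂ (λ x y → A x y ≡ 1)
                  (Finₚ.toℕ-injective (trans d′ (trans (cong (_+ (k ∸ 1)) y≡) (sym d)))) (Finₚ.toℕ-injective y≡) a

    module _ {ℓs : Lengths} (V : Valid ℓs) where

      steps-zero : ∀ i → toℕ i ≡ 0 → Steps m (λ _ → 0) (ℓs i)
      steps-zero i e = subst₂ (λ a ℓ → Steps a ℓ (ℓs i)) (trans (cong (m +_) e) (+-identityʳ m))
        (previous-zero (λ _ → 0) ℓs i e) (proj₁ (V i))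

      steps-suc : ∀ i i′ → toℕ i′ ≡ suc (toℕ i) → Steps (m + toℕ i′) (ℓs i) (ℓs i′)
      steps-suc i i′ e = subst (λ ℓ → Steps (m + toℕ i′) ℓ (ℓs i′)) (previous-suc (λ _ → 0) ℓs i i′ e) (proj₁ (V i′))

      -- A column is empty until it becomes active and gains at most 1 per row afterwards. This
      -- gives the bound m + j on entries, and it shows that the newest column was empty before.
      reach : ∀ i c → ℓs i c ≤ m + toℕ i ∸ toℕ c
      reach i c = Fin-ind (λ i → ℓs i c ≤ m + toℕ i ∸ toℕ c) base ind i
        where
        base : ∀ i → toℕ i ≡ 0 → ℓs i c ≤ m + toℕ i ∸ toℕ c
        base i e with steps-zero i e c
        ... | inj₁ p = subst (_≤ m + toℕ i ∸ toℕ c) (sym p) z≤n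
        ... | inj₂ (l , p) = subst (_≤ m + toℕ i ∸ toℕ c) (sym p) (m<n⇒0<n∸m (<-≤-trans l (m≤m+n m (toℕ i))))
        ind : ∀ i i′ → toℕ i′ ≡ suc (toℕ i) → ℓs i c ≤ m + toℕ i ∸ toℕ c → ℓs i′ c ≤ m + toℕ i′ ∸ toℕ c
        ind i i′ e h with steps-suc i i′ e c
        ... | inj₁ p = subst (_≤ m + toℕ i′ ∸ toℕ c) (sym p) (≤-trans h (∸-monoˡ-≤ (toℕ c) (+-monoʳ-≤ m (≤-trans (n≤1+n _) (≤-reflexive (sym e))))))
        ... | inj₂ (l , p) = subst (_≤ m + toℕ i′ ∸ toℕ c) (sym p) (begin
            suc (ℓs i c)                  ≤⟨ s≤s h ⟩
            suc (m + toℕ i ∸ toℕ c)       ≡⟨ +-∸-assoc 1 (s≤s⁻¹ (subst (toℕ c <_) m+i′ l)) ⟨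
            suc (m + toℕ i) ∸ toℕ c       ≡⟨ cong (_∸ toℕ c) m+i′ ⟨
            m + toℕ i′ ∸ toℕ c ∎)
          where
          open ≤-Reasoning
          m+i′ : m + toℕ i′ ≡ suc (m + toℕ i)
          m+i′ = trans (cong (m +_) e) (+-suc m (toℕ i))

      valid-bounded : Bounded ℓs
      valid-bounded i c = proj₁ (proj₂ (V i)) c , Fin-ind (λ i → ℓs i c ≤ suc (toℕ i)) base ind i
        where
        base : ∀ i → toℕ i ≡ 0 → ℓs i c ≤ suc (toℕ i)
        base i e with steps-zero i e c
        ... | inj₁ p       = subst (_≤ suc (toℕ i)) (sym p) z≤n
        ... | inj₂ (_ , p) = subst (_≤ suc (toℕ i)) (sym p) (s≤s z≤n)
        ind : ∀ i i′ → toℕ i′ ≡ suc (toℕ i) → ℓs i c ≤ suc (toℕ i) → ℓs i′ c ≤ suc (toℕ i′)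
        ind i i′ e h with steps-suc i i′ e c
        ... | inj₁ p       = subst₂ (λ x y → x ≤ suc y) (sym p) (sym e) (m≤n⇒m≤1+n h)
        ... | inj₂ (_ , p) = subst₂ (λ x y → x ≤ suc y) (sym p) (sym e) (s≤s h)

    Entries : Array n → Set
    Entries A = (∀ i j → ¬ InT n k i j → A i j ≡ 0) × (∀ i j → InT n k i j → (1 ≤ A i j) × (A i j ≤ suc N))

    magog⇒entries : ∀ {A} → IsMagog m n k A → Entries A
    magog⇒entries (out , rng , _) = out , λ i j w → proj₁ (rng i j w) ,
      ≤-trans (proj₂ (rng i j w)) (subst (m + suc (toℕ j) ≤_) (sym N-def) (+-monoʳ-≤ m (Finₚ.toℕ<n j)))

    -- Entries lie between 1 and N + 1, so the N columns see all their differences; for a ≥ 2 the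
    -- single column c = a - 2 suffices.
    entry-≤ : ∀ {a b} → 1 ≤ b → a ≤ suc N → (∀ (c : Fin N) → suc (toℕ c) < a → suc (toℕ c) < b) → a ≤ b
    entry-≤ {zero}        1≤b le f = z≤n
    entry-≤ {suc zero}    1≤b le f = 1≤b
    entry-≤ {suc (suc a)} {b} 1≤b (s≤s le) f = subst (λ x → suc (suc x) ≤ b) c≡ (f c (subst (λ x → suc x < suc (suc a)) (sym c≡) ≤-refl))
      where
      c : Fin N
      c = fromℕ< le
      c≡ : toℕ c ≡ a
      c≡ = Finₚ.toℕ-fromℕ< le

    module _ {A : Array n} {ℓs : Lengths} (B : Bounded ℓs) (E : Entries A) (R : Matches A ℓs) where

      row-≤ : ∀ i d c → d < ℓs i c → ∃ λ j → InT n k i j × toℕ j + d ≡ toℕ i × suc (toℕ c) < A i j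
      row-≤ i d c lt with cell i d (s≤s⁻¹ (≤-trans lt (proj₂ (B i c)))) (≤-trans lt (proj₁ (B i c)))
      ... | j , w , e = j , w , e , proj₂ (R i j c w) (subst (_< ℓs i c) (sym (depth e)) lt)

      -- The inequality m_{i,j} ≤ m_{i+1,j+1} keeps the distance from the end of the row and says
      -- that lengths do not fall; m_{i+1,j} ≤ m_{i,j} raises that distance by 1 and says that they
      -- grow by at most 1. A non-empty column is exceeded by the last entry of its row, and the
      -- bound on that entry makes the column active.
      magog⇒valid : IsMagog m n k A → MinimaAt A → Valid ℓs
      magog⇒valid (out , rng , col , dia) at i = stp i , rowOK i
        where
        up : ∀ i i′ c → toℕ i′ ≡ suc (toℕ i) → ℓs i c ≤ ℓs i′ c
        up i i′ c e = ≤-from-< _ _ λ d lt →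
          let (j , w , p , a) = row-≤ i d c lt
              (j′ , w′ , p′) = cell i′ d (subst (d ≤_) (sym e) (m≤n⇒m≤1+n (subst (d ≤_) p (m≤n+m d (toℕ j))))) (≤-trans lt (proj₁ (B i c)))
              j′≡ : toℕ j′ ≡ suc (toℕ j)
              j′≡ = +-cancelʳ-≡ d (toℕ j′) (suc (toℕ j)) (trans p′ (trans e (cong suc (sym p))))
          in subst (_< ℓs i′ c) (depth p′) (proj₁ (R i′ j′ c w′) (≤-trans a (dia i i′ j j′ e j′≡ w w′)))

        down : ∀ i i′ c → toℕ i′ ≡ suc (toℕ i) → ℓs i′ c ≤ suc (ℓs i c)
        down i i′ c e = ≤-from-< _ _ λ { zero lt → s≤s z≤n ; (suc d) lt →
          let (j , w , p , a) = row-≤ i′ (suc d) c lt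
              p₀ : toℕ j + d ≡ toℕ i
              p₀ = suc-injective (trans (sym (+-suc (toℕ j) d)) (trans p e))
              d<k : d < k
              d<k = ≤-trans (n≤1+n _) (≤-trans lt (proj₁ (B i′ c)))
              w₀ : InT n k i j
              w₀ = subst (toℕ j ≤_) p₀ (m≤m+n (toℕ j) d) , subst (_< toℕ j + k) p₀ (+-monoʳ-< (toℕ j) d<k)
          in s≤s (subst (_< ℓs i c) (depth p₀) (proj₁ (R i j c w₀) (≤-trans a (col i i′ j e w₀ w)))) }

        active : ∀ i c → 0 < ℓs i c → toℕ c < m + toℕ i
        active i c lt with row-≤ i 0 c lt
        ... | j , w , p , a with Finₚ.toℕ-injective {i = j} {i} (trans (sym (+-identityʳ _)) p)
        ... | refl = s≤s⁻¹ (≤-trans a (subst (A i i ≤_) (+-suc m (toℕ i)) (proj₂ (rng i i w))))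

        near : ∀ {x y} → x ≤ y → y ≤ suc x → ∀ {a} → (0 < y → a) → y ≡ x ⊎ (a × y ≡ suc x)
        near {x} {y} p r f with m≤n⇒m<n∨m≡n p
        ... | inj₂ e = inj₁ (sym e)
        ... | inj₁ l = inj₂ (f (≤-<-trans z≤n l) , ≤-antisym r l)

        stp : ∀ i → Steps (m + toℕ i) (previous (λ _ → 0) ℓs i) (ℓs i)
        stp = Fin-ind _
          (λ i e → subst (λ ℓ → Steps (m + toℕ i) ℓ (ℓs i)) (sym (previous-zero (λ _ → 0) ℓs i e))
            (λ c → near z≤n (subst (λ x → ℓs i c ≤ suc x) e (proj₂ (B i c))) (active i c)))
          (λ i i′ e _ → subst (λ ℓ → Steps (m + toℕ i′) ℓ (ℓs i′)) (sym (previous-suc (λ _ → 0) ℓs i i′ e))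
            (λ c → near (up i i′ c e) (down i i′ c e) (active i′ c)))

        rowOK : ∀ i → RowOK m k s (toℕ i) (ℓs i)
        rowOK i = (λ c → proj₁ (B i c)) ,
          (λ c c′ lt → ≤-from-< _ _ λ d l → let (j , w , p , a) = row-≤ i d c′ l in
            subst (_< ℓs i c) (depth p) (proj₁ (R i j c w) (<-trans (s≤s lt) a))) ,
          early , late
          where
          k-1<k : k ∸ 1 < k
          k-1<k = subst (k ∸ 1 <_) (sym k≡) (n<1+n _)
          early : toℕ i < s → head₀ (ℓs i) < k
          early lt with head₀-or (ℓs i)
          ... | inj₂ (_ , h) = subst (_< k) (sym h) 1≤k
          ... | inj₁ (c , c≡ , h) = subst (_< k) (sym h) (≰⇒> λ le →
                let (j , w , p , a) = row-≤ i (k ∸ 1) c (<-≤-trans k-1<k le)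
                in <⇒≢ (≤-<-trans (s≤s z≤n) a) (sym (proj₂ (at i j w (sym p)) lt)))
          late : s ≤ toℕ i → head₀ (ℓs i) ≡ k
          late le = full (left-cell {A} i (≤-trans (m≤m+n (k ∸ 1) q) le))
            where
            full : (∃ λ j → InT n k i j × (toℕ i ≡ toℕ j + (k ∸ 1))) → head₀ (ℓs i) ≡ k
            full (j , w , d) = trans (head₀-≡ (ℓs i) c c≡) (≤-antisym (proj₁ (B i c)) (subst (_≤ ℓs i c) (sym k≡)
                (subst (_< ℓs i c) (depth (sym d)) (proj₁ (R i j c w) (subst (λ x → suc x < A i j) (sym c≡) 1<A)))))
              where
              1<A : 1 < A i j
              1<A = ≤∧≢⇒< (proj₁ (rng i j w)) (λ e → <⇒≱ (proj₁ (at i j w d) (sym e)) le)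
              0<N : 0 < N
              0<N = s≤s⁻¹ (≤-trans 1<A (proj₂ (proj₂ E i j w)))
              c : Fin N
              c = fromℕ< 0<N
              c≡ : toℕ c ≡ 0
              c≡ = Finₚ.toℕ-fromℕ< 0<N

      module _ (V : Valid ℓs) where

        entry-bound : ∀ i j → InT n k i j → A i j ≤ m + suc (toℕ j)
        entry-bound i j w = entry-≤ (≤-trans (s≤s z≤n) (m≤n+m (suc (toℕ j)) m)) (proj₂ (proj₂ E i j w)) λ c a →
          let c<  : toℕ i ∸ toℕ j < m + toℕ i ∸ toℕ c
              c<  = <-≤-trans (proj₁ (R i j c w) a) (reach V i c)
              c<′ : toℕ c < m + toℕ j
              c<′ = ≰⇒> λ le → <⇒≱ c< (≤-trans (∸-monoʳ-≤ (m + toℕ i) le) (≤-reflexive ([m+n]∸[m+o]≡n∸o m (toℕ i) (toℕ j))))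
          in subst (suc (toℕ c) <_) (sym (+-suc m (toℕ j))) (s≤s c<′)

        valid⇒magog : IsMagog m n k A
        valid⇒magog = proj₁ E , (λ i j w → proj₁ (proj₂ E i j w) , entry-bound i j w) , col , dia
          where
          col : ∀ i i′ j → toℕ i′ ≡ suc (toℕ i) → InT n k i j → InT n k i′ j → A i′ j ≤ A i j
          col i i′ j e w w′ = entry-≤ (proj₁ (proj₂ E i j w)) (proj₂ (proj₂ E i′ j w′)) λ c a →
            proj₂ (R i j c w) (s≤s⁻¹ (<-≤-trans
              (subst (_< ℓs i′ c) (trans (cong (_∸ toℕ j) e) (+-∸-assoc 1 (proj₁ w))) (proj₁ (R i′ j c w′) a))
              (grows c)))
            where
            grows : ∀ c → ℓs i′ c ≤ suc (ℓs i c)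
            grows c with steps-suc V i i′ e c
            ... | inj₁ p       = ≤-trans (≤-reflexive p) (n≤1+n _)
            ... | inj₂ (_ , p) = ≤-reflexive p
          dia : ∀ i i′ j j′ → toℕ i′ ≡ suc (toℕ i) → toℕ j′ ≡ suc (toℕ j) → InT n k i j → InT n k i′ j′ → A i j ≤ A i′ j′
          dia i i′ j j′ e e′ w w′ = entry-≤ (proj₁ (proj₂ E i′ j′ w′)) (proj₂ (proj₂ E i j w)) λ c a →
            proj₂ (R i′ j′ c w′) (<-≤-trans (subst (_< ℓs i c) (sym (cong₂ _∸_ e e′)) (proj₁ (R i j c w) a)) (grows c))
            where
            grows : ∀ c → ℓs i c ≤ ℓs i′ c
            grows c with steps-suc V i i′ e c
            ... | inj₁ p       = ≤-reflexive (sym p)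
            ... | inj₂ (_ , p) = ≤-trans (n≤1+n _) (≤-reflexive (sym p))

        valid⇒minimaAt : MinimaAt A
        valid⇒minimaAt i j w d with head₀-or (ℓs i)
        -- Without columns every entry is 1, and the length 0 is never k, so every row precedes `s`.
        ... | inj₂ (N≡ , h) = (λ _ → ≰⇒> λ le → <⇒≢ 1≤k (trans (sym h) (proj₂ (proj₂ (proj₂ (proj₂ (V i)))) le))) ,
              (λ _ → ≤-antisym (subst (λ x → A i j ≤ suc x) N≡ (proj₂ (proj₂ E i j w))) (proj₁ (proj₂ E i j w)))
        ... | inj₁ (c , c≡ , h) = (λ a → ≰⇒> λ le → <⇒≢ (proj₂ (R i j c w) (subst₂ _<_ (sym (depth (sym d)))
                  (trans (sym (proj₂ (proj₂ (proj₂ (proj₂ (V i)))) le)) h) k-1<k)) (trans (cong suc c≡) (sym a))) ,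
              (λ lt → ≤-antisym (≮⇒≥ λ 1<A → <⇒≱ (subst (_< k) h (proj₁ (proj₂ (proj₂ (proj₂ (V i)))) lt)) (subst (_≤ ℓs i c) (sym k≡)
                  (subst (_< ℓs i c) (depth (sym d)) (proj₁ (R i j c w) (subst (λ x → suc x < A i j) (sym c≡) 1<A)))))
                (proj₁ (proj₂ E i j w)))
          where
          k-1<k : k ∸ 1 < k
          k-1<k = subst (k ∸ 1 <_) (sym k≡) (n<1+n _)

        diagonal : ∀ i → InT n k i i
        diagonal i = ≤-refl , subst (_< toℕ i + k) (+-identityʳ _) (+-monoʳ-< (toℕ i) 1≤k)

        -- An entry at its upper bound exceeds the threshold of the newest column. That column was
        -- empty in the previous row by `reach`, so it has just grown.
        maximum⇒grew : ∀ i → 0 < m + toℕ i → A i i ≡ m + suc (toℕ i) → Grew (m + toℕ i) (previous (λ _ → 0) ℓs i) (ℓs i)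
        maximum⇒grew i lt a = c , suc-c , grown (proj₁ (V i) c)
          where
          x = m + toℕ i ∸ 1
          x≡ : suc x ≡ m + toℕ i
          x≡ = trans (+-comm 1 x) (m∸n+n≡m lt)
          x<N : x < N
          x<N = s≤s⁻¹ (subst₂ _<_ (sym x≡) (sym N-def) (+-monoʳ-< m (Finₚ.toℕ<n i)))
          c : Fin N
          c = fromℕ< x<N
          suc-c : suc (toℕ c) ≡ m + toℕ i
          suc-c = trans (cong suc (Finₚ.toℕ-fromℕ< x<N)) x≡
          0<ℓ : 0 < ℓs i c
          0<ℓ = subst (_< ℓs i c) (n∸n≡0 (toℕ i)) (proj₁ (R i i c (diagonal i)) (subst₂ _<_ (sym suc-c) (trans (sym (+-suc m (toℕ i))) (sym a)) (n<1+n _)))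
          before : previous (λ _ → 0) ℓs i c ≡ 0
          before = Fin-ind (λ i → suc (toℕ c) ≡ m + toℕ i → previous (λ _ → 0) ℓs i c ≡ 0)
            (λ i e _ → cong (λ ℓ → ℓ c) (previous-zero (λ _ → 0) ℓs i e))
            (λ i i′ e _ e′ → trans (cong (λ ℓ → ℓ c) (previous-suc (λ _ → 0) ℓs i i′ e))
              (n≤0⇒n≡0 (subst (ℓs i c ≤_) (m≤n⇒m∸n≡0 (≤-reflexive (suc-injective (sym (trans e′ (trans (cong (m +_) e) (+-suc m (toℕ i))))))))
                (reach V i c)))) i suc-c
          grown : ℓs i c ≡ previous (λ _ → 0) ℓs i c ⊎ _ → ℓs i c ≡ suc (previous (λ _ → 0) ℓs i c)
          grown (inj₁ p) = ⊥-elim (<⇒≢ 0<ℓ (sym (trans p before)))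
          grown (inj₂ (_ , p)) = p

        grew⇒maximum : ∀ i → Grew (m + toℕ i) (previous (λ _ → 0) ℓs i) (ℓs i) → A i i ≡ m + suc (toℕ i)
        grew⇒maximum i (c , c≡ , g) = ≤-antisym (entry-bound i i (diagonal i))
          (subst (_≤ A i i) (trans (cong suc c≡) (sym (+-suc m (toℕ i))))
            (proj₂ (R i i c (diagonal i)) (subst₂ _<_ (sym (n∸n≡0 (toℕ i))) (sym g) (s≤s z≤n))))

    module _ (A : Array n) (E : Entries A) (M : IsMagog m n k A) where

      private
        Deep : Fin n → Fin N → ℕ → Set
        Deep i c d = ∃ λ j → (InT n k i j × toℕ j + d ≡ toℕ i) × suc (toℕ c) < A i j

        deep? : ∀ i c d → Dec (Deep i c d)
        deep? i c d = Finₚ.any? (λ j → (inT? n k i j ×-dec (toℕ j + d ≟ toℕ i)) ×-dec (suc (toℕ c) <? A i j))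

        width : Fin n → ℕ
        width i = k ⊓ suc (toℕ i)

      lengths : Lengths
      lengths i c = threshold (deep? i c) (width i)

      lengths-bounded : Bounded lengths
      lengths-bounded i c = ≤-trans (threshold-≤ (deep? i c) (width i)) (m⊓n≤m k _) , ≤-trans (threshold-≤ (deep? i c) (width i)) (m⊓n≤n k _)

      lengths-matches : Matches A lengths
      lengths-matches i j c w = to , from
        where
        j+d : toℕ j + (toℕ i ∸ toℕ j) ≡ toℕ i
        j+d = m+[n∸m]≡n (proj₁ w)
        -- Rows increase weakly because m_{i,j} ≤ m_{i-1,j} ≤ m_{i,j+1}; the cell `i₀` , `j₁` is the
        -- middle one.
        down : ∀ d → suc d < width i → Deep i c (suc d) → Deep i c d
        down d lt (j₁ , (w₁ , p₁) , a₁) = shallower (cell i d (≤-trans (n≤1+n d) (s≤s⁻¹ (≤-trans lt (m⊓n≤n k _)))) (<-trans (n<1+n d) (≤-trans lt (m⊓n≤m k _))))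
          where
          shallower : (∃ λ j → InT n k i j × toℕ j + d ≡ toℕ i) → Deep i c d
          shallower (j₂ , w₂ , p₂) = j₂ , (w₂ , p₂) , ≤-trans a₁ (≤-trans
              (proj₁ (proj₂ (proj₂ M)) i₀ i j₁ i≡ w₀ w₁) (proj₂ (proj₂ (proj₂ M)) i₀ i j₁ j₂ i≡ j₂≡ w₀ w₂))
            where
            j₂≡ : toℕ j₂ ≡ suc (toℕ j₁)
            j₂≡ = +-cancelʳ-≡ d (toℕ j₂) (suc (toℕ j₁)) (trans p₂ (trans (sym p₁) (+-suc (toℕ j₁) d)))
            i≡₀ : toℕ i ≡ suc (toℕ j₁ + d)
            i≡₀ = trans (sym p₁) (+-suc (toℕ j₁) d)
            i₀ : Fin n
            i₀ = fromℕ< (<-trans (≤-reflexive (sym i≡₀)) (Finₚ.toℕ<n i))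
            i₀≡ : toℕ i₀ ≡ toℕ j₁ + d
            i₀≡ = Finₚ.toℕ-fromℕ< _
            i≡ : toℕ i ≡ suc (toℕ i₀)
            i≡ = trans i≡₀ (cong suc (sym i₀≡))
            w₀ : InT n k i₀ j₁
            w₀ = subst (toℕ j₁ ≤_) (sym i₀≡) (m≤m+n (toℕ j₁) d) , <-trans (subst (toℕ i₀ <_) (sym i≡) (n<1+n _)) (proj₂ w₁)
        to : suc (toℕ c) < A i j → toℕ i ∸ toℕ j < lengths i c
        to a = ⇒<threshold (deep? i c) (width i) down (toℕ i ∸ toℕ j) (⊓-glb (depth-< w) (s≤s (m∸n≤m (toℕ i) (toℕ j)))) (j , (w , j+d) , a)
        from : toℕ i ∸ toℕ j < lengths i c → suc (toℕ c) < A i j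
        from lt with <threshold⇒ (deep? i c) (width i) (toℕ i ∸ toℕ j) lt
        ... | j′ , (_ , p) , a = subst (λ x → suc (toℕ c) < A i x) (cell-unique i j′ j (toℕ i ∸ toℕ j) p j+d) a

    matches-unique : ∀ {A ℓs ℓs′} → Bounded ℓs → Bounded ℓs′ → Matches A ℓs → Matches A ℓs′ → ∀ i c → ℓs i c ≤ ℓs′ i c
    matches-unique {A} {ℓs} {ℓs′} B B′ R R′ i c = ≤-from-< _ _ λ d lt →
      let (j , w , p) = cell i d (s≤s⁻¹ (≤-trans lt (proj₂ (B i c)))) (≤-trans lt (proj₁ (B i c)))
      in subst (_< ℓs′ i c) (depth p) (proj₁ (R′ i j c w) (proj₂ (R i j c w) (subst (_< ℓs i c) (sym (depth p)) lt)))

    entries-unique : ∀ {A A′ ℓs} → Entries A → Entries A′ → Matches A ℓs → Matches A′ ℓs → ∀ i j → A i j ≡ A′ i j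
    entries-unique {A} {A′} E E′ R R′ i j with inT? n k i j
    ... | no ¬w = trans (proj₁ E i j ¬w) (sym (proj₁ E′ i j ¬w))
    ... | yes w = ≤-antisym
      (entry-≤ (proj₁ (proj₂ E′ i j w)) (proj₂ (proj₂ E i j w)) (λ c a → proj₂ (R′ i j c w) (proj₁ (R i j c w) a)))
      (entry-≤ (proj₁ (proj₂ E i j w)) (proj₂ (proj₂ E′ i j w)) (λ c a → proj₂ (R i j c w) (proj₁ (R′ i j c w) a)))

    module _ (ℓs : Lengths) (V : Valid ℓs) where

      private
        Long : Fin n → Fin n → ℕ → Set
        Long i j x = ∃ λ c → toℕ c ≡ x × toℕ i ∸ toℕ j < ℓs i c

        long? : ∀ i j x → Dec (Long i j x)
        long? i j x = Finₚ.any? (λ c → (toℕ c ≟ x) ×-dec (toℕ i ∸ toℕ j <? ℓs i c))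

        entry : ∀ i j → Dec (InT n k i j) → ℕ
        entry i j (yes _) = suc (threshold (long? i j) N)
        entry i j (no _)  = 0

      array : Array n
      array i j = entry i j (inT? n k i j)

      array-entries : Entries array
      array-entries = (λ i j ¬w → out i j (inT? n k i j) ¬w) , (λ i j w → inn i j (inT? n k i j) w)
        where
        out : ∀ i j (p : Dec (InT n k i j)) → ¬ InT n k i j → entry i j p ≡ 0
        out i j (yes w) ¬w = ⊥-elim (¬w w)
        out i j (no _)  ¬w = refl
        inn : ∀ i j (p : Dec (InT n k i j)) → InT n k i j → (1 ≤ entry i j p) × (entry i j p ≤ suc N)
        inn i j (yes _) w = s≤s z≤n , s≤s (threshold-≤ (long? i j) N)
        inn i j (no ¬w) w = ⊥-elim (¬w w)

      array-bound : ∀ i j → array i j < suc (m + n)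
      array-bound i j = bnd (inT? n k i j)
        where
        bnd : (p : Dec (InT n k i j)) → entry i j p < suc (m + n)
        bnd (yes _) = s≤s (subst (suc (threshold (long? i j) N) ≤_) N-def (s≤s (threshold-≤ (long? i j) N)))
        bnd (no _)  = s≤s z≤n

      array-matches : Matches array ℓs
      array-matches i j c w = mat (inT? n k i j)
        where
        down : ∀ x → suc x < N → Long i j (suc x) → Long i j x
        down x lt (c , c≡ , l) = c₀ , c₀≡ , <-≤-trans l (proj₁ (proj₂ (proj₂ (V i))) c₀ c (subst₂ _<_ (sym c₀≡) (sym c≡) (n<1+n x)))
          where
          c₀ : Fin N
          c₀ = fromℕ< (<-trans (n<1+n x) lt)
          c₀≡ : toℕ c₀ ≡ x
          c₀≡ = Finₚ.toℕ-fromℕ< _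
        mat : (p : Dec (InT n k i j)) → (suc (toℕ c) < entry i j p → toℕ i ∸ toℕ j < ℓs i c) × (toℕ i ∸ toℕ j < ℓs i c → suc (toℕ c) < entry i j p)
        mat (no ¬w) = ⊥-elim (¬w w)
        mat (yes _) = (λ { (s≤s lt) → from (<threshold⇒ (long? i j) N (toℕ c) lt) }) ,
                      (λ l → s≤s (⇒<threshold (long? i j) N down (toℕ c) (Finₚ.toℕ<n c) (c , refl , l)))
          where
          from : Long i j (toℕ c) → toℕ i ∸ toℕ j < ℓs i c
          from (c′ , e , l) = subst (λ x → toℕ i ∸ toℕ j < ℓs i x) (Finₚ.toℕ-injective e) l

-- The generating function as a weighted sum over rows of column lengths.

module RowSums where

  open RingSolving
  open AlternatingSums
  open PowerSeriesTower using (fins)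
  open RowEvolution
  open ColumnExit
  open ColumnLengths
  open import Defs using (allFuns; allArrays; isMagog?; IsMagog; minima; maxima)
  open import Algebra.Bundles using (CommutativeRing)
  open import Data.Bool using (true; false; if_then_else_)
  open import Data.Empty using (⊥-elim)
  open import Data.Fin using (Fin; toℕ; fromℕ<) renaming (zero to fz; suc to fs)
  import Data.Fin.Properties as Finₚ
  open import Data.List using ([]; _∷_; filter; upTo)
  open import Data.Nat as ℕ using (ℕ; zero; suc; _<_; _≤_; s≤s; z≤n; _+_; _∸_; _≟_)
  import Data.Nat.Properties as ℕₚ
  open import Data.Product using (_×_; _,_; proj₁; proj₂; ∃)
  open import Data.Sum using (_⊎_; inj₁; inj₂)
  open import Data.Vec.Functional using () renaming (_∷_ to _∷ᶠ_)
  open import Function using (_∘_; id)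
  open import Relation.Nullary using (Dec; yes; no; does; ¬_)
  open import Relation.Nullary.Decidable using (_×-dec_)
  import Relation.Binary.PropositionalEquality as ≡
  open ≡ using (_≡_; _≢_)

  count-suc : ∀ {n} {Q Q′ : Fin n → Set} (Q? : ∀ i → Dec (Q i)) (Q′? : ∀ i → Dec (Q′ i)) → 0 < n →
    (∀ i → toℕ i ≡ 0 → Q i × ¬ Q′ i) → (∀ i → 0 < toℕ i → Q i → Q′ i) → (∀ i → 0 < toℕ i → Q′ i → Q i) →
    count Q? ≡ suc (count Q′?)
  count-suc {suc n} Q? Q′? _ e f g with Q? fz | Q′? fz
  ... | no ¬q | _     = ⊥-elim (¬q (proj₁ (e fz ≡.refl)))
  ... | yes _ | yes q = ⊥-elim (proj₂ (e fz ≡.refl) q)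
  ... | yes _ | no _  = ≡.cong suc (count-cong (Q? ∘ fs) (Q′? ∘ fs) (λ i → f (fs i) (s≤s z≤n)) (λ i → g (fs i) (s≤s z≤n)))

  module FiniteSums (A : CRing) where
    open CommutativeRing A hiding (_+_; zero)
    open Sums A public
    open import Relation.Binary.Reasoning.Setoid setoid

    guard-⇔ : ∀ {P Q : Set} (p : Dec P) (q : Dec Q) {x y} → (P → Q) → (Q → P) → (P → x ≈ y) → guard p x ≈ guard q y
    guard-⇔ (yes p) (yes q) f g e = e p
    guard-⇔ (yes p) (no ¬q) f g e = ⊥-elim (¬q (f p))
    guard-⇔ (no ¬p) (yes q) f g e = ⊥-elim (¬p (g q))
    guard-⇔ (no ¬p) (no ¬q) f g e = refl

    ∑-guard : ∀ {P I : Set} (p : Dec P) (f : I → Carrier) is → ∑ (λ i → guard p (f i)) is ≈ guard p (∑ f is)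
    ∑-guard (yes _) f is = refl
    ∑-guard (no _)  f is = ∑-0 (λ _ → refl) is

    ∑-filter : ∀ {I : Set} {Q : I → Set} (Q? : ∀ i → Dec (Q i)) (f : I → Carrier) is →
      ∑ f (filter Q? is) ≈ ∑ (λ i → guard (Q? i) (f i)) is
    ∑-filter Q? f []       = refl
    ∑-filter Q? f (i ∷ is) with does (Q? i)
    ... | true  = +-congˡ (∑-filter Q? f is)
    ... | false = trans (∑-filter Q? f is) (sym (+-identityˡ _))

    -- Functions are compared only pointwise, so unique existence in a list is expressed by a sum of
    -- indicators that equals 1.
    ∑-unique : ∀ {I : Set} d xs {E : Fin d → I → Set} (E? : ∀ i x → Dec (E i x)) →
      (∀ i → ∑ (λ x → guard (E? i x) 1#) xs ≈ 1#) →
      ∀ {Q : (Fin d → I) → Set} (Q? : ∀ g → Dec (Q g)) → (∀ g → Q g → ∀ i → E i (g i)) → (∀ g → (∀ i → E i (g i)) → Q g) →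
      ∑ (λ g → guard (Q? g) 1#) (allFuns d xs) ≈ 1#
    ∑-unique zero xs E? one Q? to from = trans (+-identityʳ _) (reflexive (guard-yes (Q? _) (from _ (λ ()))))
    ∑-unique (suc d) xs {E} E? one {Q} Q? to from = begin
      ∑ (λ g → guard (Q? g) 1#) (allFuns (suc d) xs)
        ≈⟨ ∑-allFuns d xs _ ⟩
      ∑ (λ a → ∑ (λ g → guard (Q? (a ∷ᶠ g)) 1#) (allFuns d xs)) xs
        ≈⟨ ∑-cong (λ a → inner a (E? fz a)) xs ⟩
      ∑ (λ a → guard (E? fz a) 1#) xs
        ≈⟨ one fz ⟩
      1# ∎
      where
      inner : ∀ a (e : Dec (E fz a)) → ∑ (λ g → guard (Q? (a ∷ᶠ g)) 1#) (allFuns d xs) ≈ guard e 1#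
      inner a (yes e) = ∑-unique d xs (λ i → E? (fs i)) (λ i → one (fs i)) (λ g → Q? (a ∷ᶠ g))
        (λ g q i → to (a ∷ᶠ g) q (fs i)) (λ g es → from (a ∷ᶠ g) (λ { fz → e ; (fs i) → es i }))
      inner a (no ¬e) = ∑-0 (λ g → reflexive (guard-no (Q? (a ∷ᶠ g)) (λ q → ¬e (to (a ∷ᶠ g) q fz)))) (allFuns d xs)

    ∑-point : ∀ c B → c < B → ∑ (λ x → guard (x ≟ c) 1#) (upTo B) ≈ 1#
    ∑-point c B lt = trans (∑-single _ c (λ a ne → reflexive (guard-no (a ≟ c) ne)) B lt) (reflexive (guard-yes (c ≟ c) ≡.refl))

    ∑-grid : ∀ d e B (g₀ : Fin d → Fin e → ℕ) → (∀ i j → g₀ i j < B) →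
      ∀ {Q : (Fin d → Fin e → ℕ) → Set} (Q? : ∀ g → Dec (Q g)) → (∀ g → Q g → ∀ i j → g i j ≡ g₀ i j) →
      (∀ g → (∀ i j → g i j ≡ g₀ i j) → Q g) →
      ∑ (λ g → guard (Q? g) 1#) (allFuns d (allFuns e (upTo B))) ≈ 1#
    ∑-grid d e B g₀ lt Q? to from = ∑-unique d _ (λ i r → Finₚ.all? (λ j → r j ≟ g₀ i j))
      (λ i → ∑-unique e (upTo B) (λ j x → x ≟ g₀ i j) (λ j → ∑-point (g₀ i j) B (lt i j)) (λ r → Finₚ.all? (λ j → r j ≟ g₀ i j))
        (λ _ q → q) (λ _ q → q))
      Q? to from

    ∑-correspond : ∀ {I J : Set} {p : I → Set} {R : I → J → Set} xs ys (p? : ∀ a → Dec (p a)) (R? : ∀ a b → Dec (R a b))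
      (f : I → Carrier) (g : J → Carrier) →
      (∀ a → p a → ∑ (λ b → guard (R? a b) 1#) ys ≈ 1#) →
      (∀ b → ∑ (λ a → guard (p? a ×-dec R? a b) 1#) xs ≈ 1# ⊎ g b ≈ 0#) →
      (∀ a b → p a → R a b → f a ≈ g b) →
      ∑ (λ a → guard (p? a) (f a)) xs ≈ ∑ g ys
    ∑-correspond {p = p} {R} xs ys p? R? f g uniqueʳ uniqueˡ fg = begin
      ∑ (λ a → guard (p? a) (f a)) xs
        ≈⟨ ∑-cong (λ a → spread a (p? a)) xs ⟩
      ∑ (λ a → ∑ (λ b → guard (p? a ×-dec R? a b) 1# * g b) ys) xs
        ≈⟨ ∑-swap _ xs ys ⟩
      ∑ (λ b → ∑ (λ a → guard (p? a ×-dec R? a b) 1# * g b) xs) ys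
        ≈⟨ ∑-cong (λ b → collect b (uniqueˡ b)) ys ⟩
      ∑ g ys ∎
      where
      spread : ∀ a (pa : Dec (p a)) → guard pa (f a) ≈ ∑ (λ b → guard (pa ×-dec R? a b) 1# * g b) ys
      spread a (yes pa) = begin
        f a                                          ≈⟨ *-identityʳ _ ⟨
        f a * 1#                                     ≈⟨ *-congˡ (uniqueʳ a pa) ⟨
        f a * ∑ (λ b → guard (R? a b) 1#) ys         ≈⟨ ∑-* (f a) _ ys ⟨
        ∑ (λ b → f a * guard (R? a b) 1#) ys         ≈⟨ ∑-cong (λ b → replace b (R? a b)) ys ⟩
        ∑ (λ b → guard (yes pa ×-dec R? a b) 1# * g b) ys ∎
        where
        replace : ∀ b (r : Dec (R a b)) → f a * guard r 1# ≈ guard (yes pa ×-dec r) 1# * g b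
        replace b (yes r) = trans (*-comm _ _) (*-congˡ (fg a b pa r))
        replace b (no _)  = trans (zeroʳ _) (sym (zeroˡ _))
      spread a (no ¬p) = sym (∑-0 (λ b → zeroˡ (g b)) ys)
      collect : ∀ b → ∑ (λ a → guard (p? a ×-dec R? a b) 1#) xs ≈ 1# ⊎ g b ≈ 0# →
        ∑ (λ a → guard (p? a ×-dec R? a b) 1# * g b) xs ≈ g b
      collect b (inj₁ e) = begin
        ∑ (λ a → guard (p? a ×-dec R? a b) 1# * g b) xs ≈⟨ ∑-cong (λ a → *-comm _ _) xs ⟩
        ∑ (λ a → g b * guard (p? a ×-dec R? a b) 1#) xs ≈⟨ ∑-* (g b) _ xs ⟩
        g b * ∑ (λ a → guard (p? a ×-dec R? a b) 1#) xs ≈⟨ *-congˡ e ⟩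
        g b * 1# ≈⟨ *-identityʳ _ ⟩
        g b ∎
      collect b (inj₂ e) = trans (∑-0 (λ a → trans (*-congˡ e) (zeroʳ _)) xs) (sym e)

  module Enumeration (A : CRing) (P : CommutativeRing.Carrier A) (m n b q N : ℕ)
    (k≤n : suc b ≤ n) (q≤ : q ≤ n ∸ suc b + 1) (N-def : suc N ≡ m + n) where

    open FiniteSums A
    open Bounded A P using (growth; total; TorsionFree; ones; coeff; evolve; littlewood; coeff-evolve-littlewood; module Expansion)
    open CommutativeRing A hiding (_+_; zero)
    open import Algebra.Properties.Semiring.Exp semiring using (_^_)
    open Correspondence m n (suc b) q N (s≤s z≤n) k≤n q≤ N-def
    open import Relation.Binary.Reasoning.Setoid setoid

    private
      k : ℕ
      k = suc b

    -- Only lengths below `B` are listed. It exceeds k + 1, so a full column and one step beyond it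
    -- are still listed and `∑-grow` always finds both of its terms.
    B : ℕ
    B = 4 + b

    private
      grow-stay : ∀ v ℓ ℓ′ → ℓ′ ≡ ℓ → grow v ℓ ℓ′ ≈ 1#
      grow-stay v ℓ ℓ′ e = trans (+-cong (reflexive (guard-yes (ℓ′ ≟ ℓ) e))
        (reflexive (guard-no (ℓ′ ≟ suc ℓ) (λ e′ → ℕₚ.m≢1+n+m ℓ {0} (≡.trans (≡.sym e) e′))))) (+-identityʳ 1#)

      grow-up : ∀ v ℓ ℓ′ → ℓ′ ≡ suc ℓ → grow v ℓ ℓ′ ≈ v
      grow-up v ℓ ℓ′ e = trans (+-cong (reflexive (guard-no (ℓ′ ≟ ℓ) (λ e′ → ℕₚ.m≢1+n+m ℓ {0} (≡.trans (≡.sym e′) e))))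
        (reflexive (guard-yes (ℓ′ ≟ suc ℓ) e))) (+-identityˡ v)

      grow-bad : ∀ v ℓ ℓ′ → ℓ′ ≢ ℓ → ℓ′ ≢ suc ℓ → grow v ℓ ℓ′ ≈ 0#
      grow-bad v ℓ ℓ′ ne ne′ = trans (+-cong (reflexive (guard-no (ℓ′ ≟ ℓ) ne)) (reflexive (guard-no (ℓ′ ≟ suc ℓ) ne′))) (+-identityʳ 0#)

      growAll-still : ∀ {K} (v : Fin K → Carrier) ℓ ℓ′ → (∀ c → ℓ′ c ≡ ℓ c) → growAll v ℓ ℓ′ ≈ 1#
      growAll-still {zero}  v ℓ ℓ′ e = refl
      growAll-still {suc K} v ℓ ℓ′ e = trans (*-cong (grow-stay _ _ _ (e fz)) (growAll-still _ _ _ (e ∘ fs))) (*-identityˡ 1#)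

      growAll-steps : ∀ {K} a (ℓ ℓ′ : Fin K → ℕ) → Steps a ℓ ℓ′ →
        (Grew a ℓ ℓ′ → growAll (growth a ∘ toℕ) ℓ ℓ′ ≈ P) × (¬ Grew a ℓ ℓ′ → growAll (growth a ∘ toℕ) ℓ ℓ′ ≈ 1#)
      growAll-steps zero ℓ ℓ′ st = (λ ()) , (λ _ → growAll-still _ ℓ ℓ′ still)
        where
        still : ∀ c → ℓ′ c ≡ ℓ c
        still c with st c
        ... | inj₁ e = e
      growAll-steps {zero} (suc a) ℓ ℓ′ st = (λ ()) , (λ _ → refl)
      growAll-steps {suc K} (suc zero) ℓ ℓ′ st =
        (λ { (fz , _ , e) → trans (*-cong (grow-up P _ _ e) rest) (*-identityʳ P) }) ,
        (λ ¬g → trans (*-cong (first ¬g) rest) (*-identityʳ 1#))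
        where
        rest : growAll (growth 1 ∘ toℕ ∘ fs) (ℓ ∘ fs) (ℓ′ ∘ fs) ≈ 1#
        rest = growAll-still _ _ _ still
          where
          still : ∀ c → ℓ′ (fs c) ≡ ℓ (fs c)
          still c with st (fs c)
          ... | inj₁ e = e
          ... | inj₂ (s≤s () , _)
        first : ¬ Grew 1 ℓ ℓ′ → grow P (ℓ fz) (ℓ′ fz) ≈ 1#
        first ¬g with st fz
        ... | inj₁ e = grow-stay P _ _ e
        ... | inj₂ (_ , e) = ⊥-elim (¬g (fz , ≡.refl , e))
      growAll-steps {suc K} (suc (suc a)) ℓ ℓ′ st =
        (λ { (fs c , e , g) → trans (*-cong first (proj₁ rest (c , ℕₚ.suc-injective e , g))) (*-identityˡ P) }) ,
        (λ ¬g → trans (*-cong first (proj₂ rest (λ { (c , e , g) → ¬g (fs c , ≡.cong suc e , g) }))) (*-identityˡ 1#))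
        where
        first : grow 1# (ℓ fz) (ℓ′ fz) ≈ 1#
        first with st fz
        ... | inj₁ e = grow-stay 1# _ _ e
        ... | inj₂ (_ , e) = grow-up 1# _ _ e
        st′ : Steps (suc a) (ℓ ∘ fs) (ℓ′ ∘ fs)
        st′ c with st (fs c)
        ... | inj₁ e = inj₁ e
        ... | inj₂ (l , e) = inj₂ (ℕ.s≤s⁻¹ l , e)
        rest = growAll-steps (suc a) (ℓ ∘ fs) (ℓ′ ∘ fs) st′

      growAll-bad : ∀ {K} a (ℓ ℓ′ : Fin K → ℕ) → ¬ Steps a ℓ ℓ′ → growAll (growth a ∘ toℕ) ℓ ℓ′ ≈ 0#
      growAll-bad {zero}  a ℓ ℓ′ ¬st = ⊥-elim (¬st (λ ()))
      growAll-bad {suc K} zero ℓ ℓ′ ¬st with ℓ′ fz ≟ ℓ fz | ℓ′ fz ≟ suc (ℓ fz)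
      ... | yes e | _ = trans (*-congˡ (growAll-bad zero (ℓ ∘ fs) (ℓ′ ∘ fs) (λ st → ¬st (λ { fz → inj₁ e ; (fs c) → lift (st c) })))) (zeroʳ _)
        where
        lift : ∀ {c : Fin K} → ℓ′ (fs c) ≡ ℓ (fs c) ⊎ (toℕ c < 0 × _) → _
        lift (inj₁ e) = inj₁ e
      ... | no _ | yes e = trans (*-congʳ (grow-up 0# _ _ e)) (zeroˡ _)
      ... | no ne | no ne′ = trans (*-congʳ (grow-bad 0# _ _ ne ne′)) (zeroˡ _)
      growAll-bad {suc K} (suc a) ℓ ℓ′ ¬st with ℓ′ fz ≟ ℓ fz | ℓ′ fz ≟ suc (ℓ fz)
      ... | no ne | no ne′ = trans (*-congʳ (grow-bad _ _ _ ne ne′)) (zeroˡ _)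
      ... | yes e | _ = trans (*-congˡ (growAll-bad a (ℓ ∘ fs) (ℓ′ ∘ fs) (λ st → ¬st (λ { fz → inj₁ e ; (fs c) → lift (st c) })))) (zeroʳ _)
        where
        lift : ∀ {c : Fin K} → ℓ′ (fs c) ≡ ℓ (fs c) ⊎ (toℕ c < a × ℓ′ (fs c) ≡ suc (ℓ (fs c))) → ℓ′ (fs c) ≡ ℓ (fs c) ⊎ (suc (toℕ c) < suc a × ℓ′ (fs c) ≡ suc (ℓ (fs c)))
        lift (inj₁ e) = inj₁ e
        lift (inj₂ (l , e)) = inj₂ (s≤s l , e)
      ... | no _ | yes e = trans (*-congˡ (growAll-bad a (ℓ ∘ fs) (ℓ′ ∘ fs) (λ st → ¬st (λ { fz → inj₂ (s≤s z≤n , e) ; (fs c) → lift (st c) })))) (zeroʳ _)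
        where
        lift : ∀ {c : Fin K} → ℓ′ (fs c) ≡ ℓ (fs c) ⊎ (toℕ c < a × ℓ′ (fs c) ≡ suc (ℓ (fs c))) → ℓ′ (fs c) ≡ ℓ (fs c) ⊎ (suc (toℕ c) < suc a × ℓ′ (fs c) ≡ suc (ℓ (fs c)))
        lift (inj₁ e) = inj₁ e
        lift (inj₂ (l , e)) = inj₂ (s≤s l , e)

    row? : ∀ i (ℓ : Fin N → ℕ) → Dec (RowOK m k s i ℓ)
    row? = rowOK? m k s

    Row : Set
    Row = Fin N → ℕ

    growRow : ℕ → Row → Row → Carrier
    growRow i = growAll (growth (m + i) ∘ toℕ)

    weight : ∀ d → ℕ → Row → (Fin d → Row) → Carrier
    weight zero    i ℓ ℓs = 1#
    weight (suc d) i ℓ ℓs = growRow i ℓ (ℓs fz) * guard (row? i (ℓs fz)) (weight d (suc i) (ℓs fz) (ℓs ∘ fs))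

    rows : ℕ → ℕ → Row → Carrier
    rows zero    i ℓ = 1#
    rows (suc d) i ℓ = ∑ (λ ℓ′ → growRow i ℓ ℓ′ * guard (row? i ℓ′) (rows d (suc i) ℓ′)) (allFuns N (upTo B))

    ∑-weight : ∀ d i ℓ → ∑ (weight d i ℓ) (allFuns d (allFuns N (upTo B))) ≈ rows d i ℓ
    ∑-weight zero    i ℓ = +-identityʳ 1#
    ∑-weight (suc d) i ℓ = begin
      ∑ (weight (suc d) i ℓ) (allFuns (suc d) (allFuns N (upTo B)))
        ≈⟨ ∑-allFuns d (allFuns N (upTo B)) _ ⟩
      ∑ (λ a → ∑ (λ g → growRow i ℓ a * guard (row? i a) (weight d (suc i) a g)) G) (allFuns N (upTo B))
        ≈⟨ ∑-cong (λ a → trans (∑-* _ _ G) (*-congˡ (trans (∑-guard (row? i a) _ G)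
             (guard-⇔ (row? i a) (row? i a) id id (λ _ → ∑-weight d (suc i) a))))) (allFuns N (upTo B)) ⟩
      rows (suc d) i ℓ ∎
      where G = allFuns d (allFuns N (upTo B))

    private
      previous-shift : ∀ {d} ℓ (ℓs : Fin (suc d) → Row) t → previous (ℓs fz) (ℓs ∘ fs) t ≡ previous ℓ ℓs (fs t)
      previous-shift ℓ ℓs fz     = ≡.refl
      previous-shift ℓ ℓs (fs t) = ≡.refl

      VF : ∀ {d} → ℕ → Row → (Fin d → Row) → Set
      VF = ValidFrom m k s

      valid-head : ∀ {d i ℓ} {ℓs : Fin (suc d) → Row} → VF i ℓ ℓs → Steps (m + i) ℓ (ℓs fz) × RowOK m k s i (ℓs fz)
      valid-head {i = i} {ℓ} {ℓs} V = ≡.subst (λ x → Steps (m + x) ℓ (ℓs fz) × RowOK m k s x (ℓs fz)) (ℕₚ.+-identityʳ i) (V fz)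

      valid-tail : ∀ {d i ℓ} {ℓs : Fin (suc d) → Row} → VF i ℓ ℓs → VF (suc i) (ℓs fz) (ℓs ∘ fs)
      valid-tail {i = i} {ℓ} {ℓs} V t = ≡.subst₂ (λ x p → Steps (m + x) p (ℓs (fs t)) × RowOK m k s x (ℓs (fs t)))
        (ℕₚ.+-suc i (toℕ t)) (≡.sym (previous-shift ℓ ℓs t)) (V (fs t))

      valid-cons : ∀ {d i ℓ} {ℓs : Fin (suc d) → Row} → Steps (m + i) ℓ (ℓs fz) → RowOK m k s i (ℓs fz) →
        VF (suc i) (ℓs fz) (ℓs ∘ fs) → VF i ℓ ℓs
      valid-cons {i = i} {ℓ} {ℓs} st r V fz = ≡.subst (λ x → Steps (m + x) ℓ (ℓs fz) × RowOK m k s x (ℓs fz)) (≡.sym (ℕₚ.+-identityʳ i)) (st , r)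
      valid-cons {i = i} {ℓ} {ℓs} st r V (fs t) = ≡.subst₂ (λ x p → Steps (m + x) p (ℓs (fs t)) × RowOK m k s x (ℓs (fs t)))
        (≡.sym (ℕₚ.+-suc i (toℕ t))) (previous-shift ℓ ℓs t) (V t)

      Grows : ∀ {d} → ℕ → Row → (Fin d → Row) → Fin d → Set
      Grows i ℓ ℓs t = Grew (m + (i + toℕ t)) (previous ℓ ℓs t) (ℓs t)

      grows? : ∀ {d} i ℓ (ℓs : Fin d → Row) t → Dec (Grows i ℓ ℓs t)
      grows? i ℓ ℓs t = grew? (m + (i + toℕ t)) (previous ℓ ℓs t) (ℓs t)

    weight-valid : ∀ d i ℓ ℓs → VF i ℓ ℓs → weight d i ℓ ℓs ≈ P ^ count (grows? i ℓ ℓs)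
    weight-valid zero    i ℓ ℓs V = refl
    weight-valid (suc d) i ℓ ℓs V = trans
      (*-congˡ (trans (reflexive (guard-yes (row? i (ℓs fz)) (proj₂ (valid-head V)))) (weight-valid d (suc i) (ℓs fz) (ℓs ∘ fs) (valid-tail V))))
      headed
      where
      growth-fz : Grows i ℓ ℓs fz → Grew (m + i) ℓ (ℓs fz)
      growth-fz = ≡.subst (λ x → Grew (m + x) ℓ (ℓs fz)) (ℕₚ.+-identityʳ i)
      fz-growth : Grew (m + i) ℓ (ℓs fz) → Grows i ℓ ℓs fz
      fz-growth = ≡.subst (λ x → Grew (m + x) ℓ (ℓs fz)) (≡.sym (ℕₚ.+-identityʳ i))
      spec = growAll-steps (m + i) ℓ (ℓs fz) (proj₁ (valid-head V))
      same : count (grows? (suc i) (ℓs fz) (ℓs ∘ fs)) ≡ count (grows? i ℓ ℓs ∘ fs)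
      same = count-cong (grows? (suc i) (ℓs fz) (ℓs ∘ fs)) (grows? i ℓ ℓs ∘ fs)
        (λ t → ≡.subst₂ (λ x p → Grew (m + x) p (ℓs (fs t))) (≡.sym (ℕₚ.+-suc i (toℕ t))) (previous-shift ℓ ℓs t))
        (λ t → ≡.subst₂ (λ x p → Grew (m + x) p (ℓs (fs t))) (ℕₚ.+-suc i (toℕ t)) (≡.sym (previous-shift ℓ ℓs t)))
      headed : growRow i ℓ (ℓs fz) * P ^ count (grows? (suc i) (ℓs fz) (ℓs ∘ fs)) ≈ P ^ count (grows? i ℓ ℓs)
      headed with grows? i ℓ ℓs fz
      ... | yes g = *-cong (proj₁ spec (growth-fz g)) (reflexive (≡.cong (P ^_) same))
      ... | no ¬g = trans (*-cong (proj₂ spec (¬g ∘ fz-growth)) (reflexive (≡.cong (P ^_) same))) (*-identityˡ _)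

    weight-invalid : ∀ d i ℓ ℓs → ¬ VF i ℓ ℓs → weight d i ℓ ℓs ≈ 0#
    weight-invalid zero    i ℓ ℓs ¬V = ⊥-elim (¬V (λ ()))
    weight-invalid (suc d) i ℓ ℓs ¬V with steps? (m + i) ℓ (ℓs fz)
    ... | no ¬st = trans (*-congʳ (growAll-bad (m + i) ℓ (ℓs fz) ¬st)) (zeroˡ _)
    ... | yes st = trans (*-congˡ (by (row? i (ℓs fz)))) (zeroʳ _)
      where
      by : (r : Dec (RowOK m k s i (ℓs fz))) → guard r (weight d (suc i) (ℓs fz) (ℓs ∘ fs)) ≈ 0#
      by (yes r) = weight-invalid d (suc i) (ℓs fz) (ℓs ∘ fs) (λ V → ¬V (valid-cons st r V))
      by (no _)  = refl

    -- The maximum in the first row that is always present if m = 0.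
    freeMaximum : Carrier
    freeMaximum = if does (m ≟ 0) then P else 1#

    private
      0<n : 0 < n
      0<n = ℕₚ.<-≤-trans (s≤s z≤n) k≤n

    power-maxima : ∀ {M ℓs} → IsMagog m n k M → Valid ℓs → Matches M ℓs → P ^ maxima m n M ≈ freeMaximum * weight n 0 (λ _ → 0) ℓs
    power-maxima {M} {ℓs} mag V R = trans (reflexive (≡.cong (P ^_) (length-filter-tabulate (λ j → M j j ≟ m + suc (toℕ j)) id)))
      (trans (by (m ≟ 0)) (*-congˡ (sym (weight-valid n 0 (λ _ → 0) ℓs V))))
      where
      Bd = valid-bounded V
      En = magog⇒entries mag
      grew : ∀ i → 0 < m + toℕ i → M i i ≡ m + suc (toℕ i) → Grows 0 (λ _ → 0) ℓs i
      grew = maximum⇒grew Bd En R V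
      max : ∀ i → Grows 0 (λ _ → 0) ℓs i → M i i ≡ m + suc (toℕ i)
      max = grew⇒maximum Bd En R V
      by : (z : Dec (m ≡ 0)) → P ^ count (λ j → M j j ≟ m + suc (toℕ j)) ≈ (if does z then P else 1#) * P ^ count (grows? 0 (λ _ → 0) ℓs)
      by (no m≢0) = trans (reflexive (≡.cong (P ^_) (count-cong _ (grows? 0 (λ _ → 0) ℓs)
        (λ i → grew i (ℕₚ.<-≤-trans (ℕₚ.n≢0⇒n>0 m≢0) (ℕₚ.m≤m+n m (toℕ i)))) max))) (sym (*-identityˡ _))
      by (yes m≡0) = reflexive (≡.cong (P ^_) (count-suc _ (grows? 0 (λ _ → 0) ℓs) 0<n
        (λ i e → ℕₚ.≤-antisym (proj₂ (proj₁ (proj₂ mag) i i (diagonal Bd En R V i)))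
                   (≡.subst (_≤ M i i) (≡.sym (≡.cong₂ (λ x y → x + suc y) m≡0 e)) (proj₁ (proj₁ (proj₂ mag) i i (diagonal Bd En R V i)))) ,
          (λ { (c , c≡ , _) → ℕₚ.1+n≢0 (≡.trans c≡ (≡.cong₂ _+_ m≡0 e)) }))
        (λ i lt → grew i (ℕₚ.<-≤-trans lt (ℕₚ.m≤n+m (toℕ i) m))) (λ i _ → max i)))

    ∑-trapezoids : ∑ (λ M → P ^ maxima m n M) (filter (λ M → isMagog? m n k M ×-dec (minima n k M ≟ q)) (allArrays m n))
      ≈ freeMaximum * rows n 0 (λ _ → 0)
    ∑-trapezoids = begin
      ∑ (λ M → P ^ maxima m n M) (filter p? (allArrays m n))
        ≈⟨ ∑-filter p? _ (allArrays m n) ⟩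
      ∑ (λ M → guard (p? M) (P ^ maxima m n M)) (allArrays m n)
        ≈⟨ ∑-correspond (allArrays m n) ys p? R? _ (λ ℓs → freeMaximum * weight n 0 (λ _ → 0) ℓs) uniqueʳ uniqueˡ
             (λ M ℓs pM (V , R) → power-maxima (proj₁ pM) V R) ⟩
      ∑ (λ ℓs → freeMaximum * weight n 0 (λ _ → 0) ℓs) ys
        ≈⟨ ∑-* freeMaximum _ ys ⟩
      freeMaximum * ∑ (weight n 0 (λ _ → 0)) ys
        ≈⟨ *-congˡ (∑-weight n 0 (λ _ → 0)) ⟩
      freeMaximum * rows n 0 (λ _ → 0) ∎
      where
      ys = allFuns n (allFuns N (upTo B))
      p? : ∀ M → Dec (IsMagog m n k M × minima n k M ≡ q)
      p? M = isMagog? m n k M ×-dec (minima n k M ≟ q)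
      R? : ∀ M ℓs → Dec (Valid ℓs × Matches M ℓs)
      R? M ℓs = validFrom? m k s 0 (λ _ → 0) ℓs ×-dec matches? M ℓs
      uniqueʳ : ∀ M → IsMagog m n k M × minima n k M ≡ q → ∑ (λ ℓs → guard (R? M ℓs) 1#) ys ≈ 1#
      uniqueʳ M (mag , min) = ∑-grid n N B ℓ₀ (λ i c → ℕₚ.≤-<-trans (proj₁ (B₀ i c)) (s≤s (ℕₚ.≤-trans (ℕₚ.n≤1+n k) (ℕₚ.n≤1+n _))))
        (R? M)
        (λ { ℓs (V , R) i c → ℕₚ.≤-antisym (matches-unique (valid-bounded V) B₀ R R₀ i c) (matches-unique B₀ (valid-bounded V) R₀ R i c) })
        (λ ℓs e → let Bd = λ i c → ≡.subst (λ x → x ≤ k × x ≤ suc (toℕ i)) (≡.sym (e i c)) (B₀ i c)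
                      R  = λ i j c w → ≡.subst (λ x → (suc (toℕ c) < M i j → toℕ i ∸ toℕ j < x) × (toℕ i ∸ toℕ j < x → suc (toℕ c) < M i j))
                                         (≡.sym (e i c)) (R₀ i j c w)
                  in magog⇒valid Bd En R mag (minima⇒minimaAt mag min) , R)
        where
        En = magog⇒entries mag
        ℓ₀ = lengths M En mag
        B₀ = lengths-bounded M En mag
        R₀ = lengths-matches M En mag
      uniqueˡ : ∀ ℓs → ∑ (λ M → guard (p? M ×-dec R? M ℓs) 1#) (allArrays m n) ≈ 1# ⊎ freeMaximum * weight n 0 (λ _ → 0) ℓs ≈ 0#
      uniqueˡ ℓs with validFrom? m k s 0 (λ _ → 0) ℓs
      ... | no ¬V = inj₂ (trans (*-congˡ (weight-invalid n 0 (λ _ → 0) ℓs ¬V)) (zeroʳ _))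
      ... | yes V = inj₁ (∑-grid n n (suc (m + n)) (array ℓs V) (array-bound ℓs V) (λ M → p? M ×-dec R? M ℓs)
        (λ { M ((mag , _) , (_ , R)) → entries-unique (magog⇒entries mag) (array-entries ℓs V) R (array-matches ℓs V) })
        (λ M e → let En = (λ i j ¬w → ≡.trans (e i j) (proj₁ (array-entries ℓs V) i j ¬w)) ,
                          (λ i j w → ≡.subst (λ x → (1 ≤ x) × (x ≤ suc N)) (≡.sym (e i j)) (proj₂ (array-entries ℓs V) i j w))
                     R  = λ i j c w → ≡.subst (λ x → (suc (toℕ c) < x → toℕ i ∸ toℕ j < ℓs i c) × (toℕ i ∸ toℕ j < ℓs i c → suc (toℕ c) < x))
                                        (≡.sym (e i j)) (array-matches ℓs V i j c w)
                     Bd = valid-bounded V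
                 in (valid⇒magog Bd En R V , minimaAt⇒minima (valid⇒minimaAt Bd En R V)) , (V , R)))

    private
      ≤-head : ∀ {K} (ℓ : Fin K → ℕ) → (∀ c c′ → toℕ c < toℕ c′ → ℓ c′ ≤ ℓ c) → ∀ c → ℓ c ≤ head₀ ℓ
      ≤-head ℓ decr fz     = ℕₚ.≤-refl
      ≤-head ℓ decr (fs c) = decr fz (fs c) (s≤s z≤n)

      head-≤ : ∀ {K} (ℓ : Fin K → ℕ) → (∀ c → ℓ c ≤ b) → head₀ ℓ < k
      head-≤ {zero}  ℓ le = s≤s z≤n
      head-≤ {suc K} ℓ le = s≤s (le fz)

      early-good : ∀ i (ℓ : Row) → i < s → RowOK m k s i ℓ → Good b ℓ
      early-good i ℓ lt (_ , decr , early , _) = (λ c → ℕₚ.≤-trans (≤-head ℓ decr c) (ℕ.s≤s⁻¹ (early lt))) , decr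

      good-early : ∀ i (ℓ : Row) → i < s → Good b ℓ → RowOK m k s i ℓ
      good-early i ℓ lt (le , decr) = (λ c → ℕₚ.m≤n⇒m≤1+n (le c)) , decr , (λ _ → head-≤ ℓ le) , (λ le′ → ⊥-elim (ℕₚ.<⇒≱ lt le′))

    -- Before row `s` the first length is below k, and it dominates all others, so the condition on
    -- a row is just `Good b`.
    rows-early : ∀ d e i (F : Row → Carrier) → i + d ≡ s → (∀ ℓ → Good b ℓ → rows e s ℓ ≈ F ℓ) → ∀ ℓ → Good b ℓ →
      rows (d + e) i ℓ ≈ total B N b d (m + i) F ℓ
    rows-early zero    e i F i≡s base ℓ g = trans (reflexive (≡.cong (λ x → rows e x ℓ) (≡.trans (≡.sym (ℕₚ.+-identityʳ i)) i≡s))) (base ℓ g)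
    rows-early (suc d) e i F i≡s base ℓ g = ∑-cong (λ ℓ′ → *-congˡ (guard-⇔ (row? i ℓ′) (good? b ℓ′)
      (early-good i ℓ′ i<s) (good-early i ℓ′ i<s) (λ r → trans
        (rows-early d e (suc i) F (≡.trans (≡.sym (ℕₚ.+-suc i d)) i≡s) base ℓ′ (early-good i ℓ′ i<s r))
        (reflexive (≡.cong (λ a → total B N b d a F ℓ′) (ℕₚ.+-suc m i)))))) (allFuns N (upTo B))
      where
      i<s : i < s
      i<s = ≡.subst (i <_) i≡s (ℕₚ.m<m+n i (s≤s z≤n))

    -- The first column has length at most m + i in row i.
    rows-empty : m ≡ 0 → q ≡ 0 → rows n 0 (λ _ → 0) ≈ 0#
    rows-empty m≡0 q≡0 = trans (sym (∑-weight n 0 (λ _ → 0))) (∑-0 (λ ℓs → weight-invalid n 0 (λ _ → 0) ℓs invalid) (allFuns n (allFuns N (upTo B))))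
      where
      b<n : b < n
      b<n = k≤n
      i : Fin n
      i = fromℕ< b<n
      i≡ : toℕ i ≡ b
      i≡ = Finₚ.toℕ-fromℕ< b<n
      s≡ : s ≡ b
      s≡ = ≡.trans (≡.cong (λ x → b + x) q≡0) (ℕₚ.+-identityʳ b)
      invalid : ∀ {ℓs} → ¬ Valid ℓs
      invalid {ℓs} V = absurd (head₀-or (ℓs i))
        where
        full : head₀ (ℓs i) ≡ k
        full = proj₂ (proj₂ (proj₂ (proj₂ (V i)))) (ℕₚ.≤-reflexive (≡.trans s≡ (≡.sym i≡)))
        absurd : (∃ λ c → toℕ c ≡ 0 × head₀ (ℓs i) ≡ ℓs i c) ⊎ (N ≡ 0 × head₀ (ℓs i) ≡ 0) → _
        absurd (inj₂ (_ , h)) = ℕₚ.0≢1+n (≡.trans (≡.sym h) full)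
        absurd (inj₁ (c , _ , h)) = ℕₚ.<⇒≱ (ℕₚ.n<1+n b) begin′
          where
          begin′ : k ≤ b
          begin′ = ≡.subst₂ _≤_ (≡.trans (≡.sym h) full) (≡.trans (≡.cong (λ x → x + toℕ i) m≡0) i≡)
            (ℕₚ.≤-trans (reach V i c) (ℕₚ.m∸n≤m (m + toℕ i) (toℕ c)))

    module _ (torsionFree : TorsionFree) where

      private
        zero-good : Good {K = N} b (λ _ → 0)
        zero-good = (λ _ → z≤n) , (λ _ _ _ → z≤n)

        start-strict : ∀ {K} {i j : Fin K} → toℕ i < toℕ j → b + toℕ i < b + toℕ j
        start-strict = ℕₚ.+-monoʳ-< b

      rows-all-early : s ≡ n → rows n 0 (λ _ → 0) ≈ coeff N (evolve N n m (littlewood N (fins N))) (λ i → b + toℕ i)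
      rows-all-early s≡n = begin
        rows n 0 (λ _ → 0)
          ≡⟨ ≡.cong (λ x → rows x 0 (λ _ → 0)) (ℕₚ.+-identityʳ n) ⟨
        rows (n + 0) 0 (λ _ → 0)
          ≈⟨ rows-early n 0 0 ones (≡.sym s≡n) (λ _ _ → refl) (λ _ → 0) zero-good ⟩
        total B N b n (m + 0) ones (λ _ → 0)
          ≡⟨ ≡.cong (λ a → total B N b n a ones (λ _ → 0)) (ℕₚ.+-identityʳ m) ⟩
        total B N b n m ones (λ _ → 0)
          ≈⟨ coeff-evolve-littlewood torsionFree B N b (λ i → b + toℕ i) (λ _ → ≡.refl) (s≤s (s≤s (ℕₚ.m≤n+m b 2))) n m
               (λ i → b + toℕ i) (λ _ → 0) start-strict (λ _ → z≤n) (λ i → ℕₚ.+-identityʳ _) ⟩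
        coeff N (evolve N n m (littlewood N (fins N))) (λ i → b + toℕ i) ∎

  module Exit (A : CRing) (P : CommutativeRing.Carrier A) (m n b q K : ℕ)
    (k≤n : suc b ≤ n) (q≤ : q ≤ n ∸ suc b + 1) (N-def : suc (suc K) ≡ m + n)
    (torsionFree : Bounded.TorsionFree A P) (M : ℕ) (0<M : 0 < M) (M-def : b + q + m ≡ suc M) where

    open FiniteSums A
    open Bounded A P using (growth; total; ones; coeff; evolve; expansion; module Expansion)
    open CommutativeRing A hiding (_+_; zero)
    open Enumeration A P m n b q (suc K) k≤n q≤ N-def
    open import Relation.Binary.Reasoning.Setoid setoid

    private
      k s : ℕ
      k = suc b
      s = b + q

      late-good : ∀ i (g : Fin K → ℕ) → s ≤ i → RowOK m k s i (k ∷ᶠ g) → Good k g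
      late-good i g le (bnd , decr , _) = (λ c → bnd (fs c)) , (λ c c′ lt → decr (fs c) (fs c′) (s≤s lt))

      good-late : ∀ i (g : Fin K → ℕ) → s ≤ i → Good k g → RowOK m k s i (k ∷ᶠ g)
      good-late i g le (bnd , decr) =
        (λ { fz → ℕₚ.≤-refl ; (fs c) → bnd c }) ,
        (λ { fz (fs c′) _ → bnd c′ ; (fs c) (fs c′) (s≤s lt) → decr c c′ lt }) ,
        (λ lt → ⊥-elim (ℕₚ.<⇒≱ lt le)) , (λ _ → ≡.refl)

      tails : (d i : ℕ) → (Fin (suc K) → ℕ) → ℕ → Carrier
      tails d i ℓ a = ∑ (λ g → growAll (growth (m + i) ∘ toℕ ∘ fs) (ℓ ∘ fs) g * guard (row? i (a ∷ᶠ g)) (rows d (suc i) (a ∷ᶠ g))) (allFuns K (upTo B))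

      tails-0 : ∀ d i ℓ a → s ≤ i → a ≢ k → tails d i ℓ a ≈ 0#
      tails-0 d i ℓ a le ne = ∑-0 (λ g → trans (*-congˡ (reflexive (guard-no (row? i (a ∷ᶠ g))
        (λ r → ne (proj₂ (proj₂ (proj₂ r)) le))))) (zeroʳ _)) (allFuns K (upTo B))

    mutual
      -- A full first column can only stay, with weight 1. Deleting it renumbers the others, and
      -- `growth (suc a) (suc c)` is `growth a c` by definition.
      rows-late : ∀ d i a ℓ → s ≤ i → m + i ≡ suc a → ℓ fz ≡ k → rows d i ℓ ≈ total B K k d a ones (ℓ ∘ fs)
      rows-late zero    i a ℓ le e ℓ≡k = refl
      rows-late (suc d) i a ℓ le e ℓ≡k = begin
        rows (suc d) i ℓ
          ≈⟨ ∑-growAll K (growth (m + i) ∘ toℕ) ℓ B (≡.subst (λ x → suc x < B) (≡.sym ℓ≡k) (s≤s (s≤s (s≤s (ℕₚ.n≤1+n b))))) _ ⟩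
        tails d i ℓ (ℓ fz) +ᴬ growth (m + i) 0 * tails d i ℓ (suc (ℓ fz))
          ≈⟨ +-cong (trans (reflexive (≡.cong (tails d i ℓ) ℓ≡k)) (tails-late d i a ℓ le e))
               (trans (*-congˡ (tails-0 d i ℓ (suc (ℓ fz)) le (λ p → ℕₚ.1+n≢n (≡.trans p (≡.sym ℓ≡k))))) (zeroʳ _)) ⟩
        total B K k (suc d) a ones (ℓ ∘ fs) +ᴬ 0#
          ≈⟨ +-identityʳ _ ⟩
        total B K k (suc d) a ones (ℓ ∘ fs) ∎
        where open CommutativeRing A using () renaming (_+_ to _+ᴬ_)

      tails-late : ∀ d i a ℓ → s ≤ i → m + i ≡ suc a → tails d i ℓ k ≈ total B K k (suc d) a ones (ℓ ∘ fs)
      tails-late d i a ℓ le e = ∑-cong (λ g → *-cong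
        (reflexive (≡.cong (λ x → growAll (growth x ∘ toℕ ∘ fs) (ℓ ∘ fs) g) e))
        (guard-⇔ (row? i (k ∷ᶠ g)) (good? k g) (late-good i g le) (good-late i g le)
          (λ _ → rows-late d (suc i) (suc a) (k ∷ᶠ g) (ℕₚ.m≤n⇒m≤1+n le) (≡.trans (ℕₚ.+-suc m i) (≡.cong suc e)) ≡.refl)))
        (allFuns K (upTo B))

    -- In row `s` the first length must become k, and before it is at most k-1, so the column has to
    -- grow, and from exactly k-1. By `0<M` it is not the newest column, so this growth has weight 1
    -- and not P.
    rows-exit : ∀ d ℓ → Good b ℓ → rows (suc d) s ℓ ≈ Expansion.afterExit torsionFree B b K (suc d) M 0<M ℓ
    rows-exit d ℓ (bnd , decr) = begin
      rows (suc d) s ℓ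
        ≈⟨ ∑-growAll K (growth (m + s) ∘ toℕ) ℓ B (s≤s (s≤s (ℕₚ.≤-trans (bnd fz) (ℕₚ.m≤n+m b 2)))) _ ⟩
      tails d s ℓ (ℓ fz) +ᴬ growth (m + s) 0 * tails d s ℓ (suc (ℓ fz))
        ≈⟨ +-congʳ (tails-0 d s ℓ (ℓ fz) ℕₚ.≤-refl (λ p → ℕₚ.<⇒≢ (s≤s (bnd fz)) p)) ⟩
      0# +ᴬ growth (m + s) 0 * tails d s ℓ (suc (ℓ fz))
        ≈⟨ trans (+-identityˡ _) (trans (*-congʳ (reflexive one)) (*-identityˡ _)) ⟩
      tails d s ℓ (suc (ℓ fz))
        ≈⟨ by (ℓ fz ℕ.≟ b) ⟩
      Expansion.afterExit torsionFree B b K (suc d) M 0<M ℓ ∎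
      where
      open CommutativeRing A using () renaming (_+_ to _+ᴬ_)
      m+s : m + s ≡ suc M
      m+s = ≡.trans (ℕₚ.+-comm m s) M-def
      one : growth (m + s) 0 ≡ 1#
      one = ≡.trans (≡.cong (λ x → growth x 0) m+s) (positive 0<M)
        where
        positive : ∀ {x} → 0 < x → growth (suc x) 0 ≡ 1#
        positive (s≤s _) = ≡.refl
      by : (e : Dec (ℓ fz ≡ b)) → tails d s ℓ (suc (ℓ fz)) ≈ guard e (total B K k (suc d) M ones (ℓ ∘ fs))
      by (yes e) = trans (reflexive (≡.cong (λ x → tails d s ℓ (suc x)) e)) (tails-late d s M ℓ ℕₚ.≤-refl m+s)
      by (no ne) = tails-0 d s ℓ (suc (ℓ fz)) ℕₚ.≤-refl (λ p → ne (ℕₚ.suc-injective p))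

    rows-expansion : ∀ d → s + suc d ≡ n →
      rows n 0 (λ _ → 0) ≈ coeff (suc K) (evolve (suc K) s m (expansion (suc K) (suc d) M)) (λ i → b + toℕ i)
    rows-expansion d s+d≡n = begin
      rows n 0 (λ _ → 0)
        ≡⟨ ≡.cong (λ x → rows x 0 (λ _ → 0)) s+d≡n ⟨
      rows (s + suc d) 0 (λ _ → 0)
        ≈⟨ rows-early s (suc d) 0 (Expansion.afterExit torsionFree B b K (suc d) M 0<M) ≡.refl (rows-exit d) (λ _ → 0) ((λ _ → z≤n) , (λ _ _ _ → z≤n)) ⟩
      total B (suc K) b s (m + 0) (Expansion.afterExit torsionFree B b K (suc d) M 0<M) (λ _ → 0)
        ≡⟨ ≡.cong (λ a → total B (suc K) b s a (Expansion.afterExit torsionFree B b K (suc d) M 0<M) (λ _ → 0)) (ℕₚ.+-identityʳ m) ⟩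
      total B (suc K) b s m (Expansion.afterExit torsionFree B b K (suc d) M 0<M) (λ _ → 0)
        ≈⟨ Expansion.total-expansion torsionFree B b K (suc d) M 0<M (s≤s (s≤s (s≤s (ℕₚ.n≤1+n b)))) s m M-def
             (λ i → b + toℕ i) (λ _ → 0) (ℕₚ.+-monoʳ-< b) (λ _ → z≤n) (λ i → ℕₚ.+-identityʳ _) ⟩
      coeff (suc K) (evolve (suc K) s m (expansion (suc K) (suc d) M)) (λ i → b + toℕ i) ∎

-- Translation of the series of the statement into the tower of power series.

module SeriesRepresentation where

  open RingSolving
  open AlternatingSums
  open PowerSeriesTower
  open LittlewoodSeries
  open RowEvolution
  open import Defs as D using (Series; sumℤ; below; vecEq?; total; unit; genBinom; const; var; _+ₛ_; _-ₛ_; _*ₛ_)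
  open import Algebra.Bundles using (CommutativeRing)
  open import Data.Bool using (if_then_else_)
  open import Data.Empty using (⊥-elim)
  open import Data.Fin using (Fin) renaming (zero to fz; suc to fs)
  import Data.Fin.Properties as Finₚ
  open import Data.Integer as ℤ using (ℤ; +_; -[1+_]; 0ℤ; 1ℤ; -1ℤ)
  import Data.Integer.Properties as ℤₚ
  open import Data.List using (List; []; _∷_; map; applyUpTo; upTo; allFin; tabulate; foldr)
  import Data.List.Properties as Listₚ
  open import Data.Nat as ℕ using (ℕ; zero; suc; _<_; _≤_; s≤s; z≤n; _∸_)
  import Data.Nat.Properties as ℕₚ
  open import Data.Nat.Combinatorics using (_C_; nCk+nC[k+1]≡[n+1]C[k+1]; nCn≡1)
  open import Data.Vec.Functional using () renaming (_∷_ to _∷ᶠ_)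
  open import Function using (_∘_; id)
  open import Relation.Nullary using (Dec; yes; no; does; ¬_)
  import Relation.Binary.PropositionalEquality as ≡
  open ≡ using (_≡_; _≢_)

  ℤᴿ : CRing
  ℤᴿ = ℤₚ.+-*-commutativeRing

  ℤ⟦P⟧ : CRing
  ℤ⟦P⟧ = Univariate.powerSeries ℤᴿ

  module Z = Sums ℤᴿ

  sumℤ-map : ∀ {I : Set} (f : I → ℤ) is → sumℤ (map f is) ≡ Z.∑ f is
  sumℤ-map f []       = ≡.refl
  sumℤ-map f (i ∷ is) = ≡.cong (λ t → f i ℤ.+ t) (sumℤ-map f is)

  module ConvSum (R : CRing) where
    open CommutativeRing R
    open Sums R

    ∑-applyUpTo : ∀ (h : ℕ → Carrier) f n → ∑ h (applyUpTo f n) ≈ ∑ (h ∘ f) (upTo n)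
    ∑-applyUpTo h f n = trans (reflexive (≡.cong (∑ h) (≡.sym (Listₚ.map-upTo f n)))) (∑-map h f (upTo n))

    conv-∑ : ∀ f g n → Univariate.conv R f g n ≈ ∑ (λ c → f c * g (n ∸ c)) (upTo (suc n))
    conv-∑ f g zero    = sym (+-identityʳ _)
    conv-∑ f g (suc n) = +-congˡ (trans (conv-∑ (f ∘ suc) g n) (sym (∑-applyUpTo _ suc (suc n))))

  module CoeffProduct (A : CRing) where
    open Tower A
    open Sums A
    open import Relation.Binary.Reasoning.Setoid A.setoid

    coeff-∑ : ∀ K {I : Set} (f : I → ∣ K ∣) is z → coeff K (ListAlgebra.∑ (PS K) f is) z A.≈ ∑ (λ i → coeff K (f i) z) is
    coeff-∑ K f []       z = A.reflexive (coeff-0 K z)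
    coeff-∑ K f (i ∷ is) z = A.trans (A.reflexive (coeff-+ K _ _ z)) (A.+-congˡ (coeff-∑ K f is z))

    coeff-* : ∀ K (F G : ∣ K ∣) z → coeff K (F *[ K ] G) z A.≈ ∑ (λ b → coeff K F b A.* coeff K G (λ i → z i ∸ b i)) (below K z)
    coeff-* zero    F G z = A.sym (A.+-identityʳ _)
    coeff-* (suc K) F G z = begin
      coeff K (Univariate.conv (PS K) F G (z fz)) (z ∘ fs)
        ≈⟨ coeff-cong K (ConvSum.conv-∑ (PS K) F G (z fz)) (z ∘ fs) ⟩
      coeff K (ListAlgebra.∑ (PS K) (λ c → F c *[ K ] G (z fz ∸ c)) (upTo (suc (z fz)))) (z ∘ fs)
        ≈⟨ coeff-∑ K _ (upTo (suc (z fz))) (z ∘ fs) ⟩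
      ∑ (λ c → coeff K (F c *[ K ] G (z fz ∸ c)) (z ∘ fs)) (upTo (suc (z fz)))
        ≈⟨ ∑-cong (λ c → A.trans (coeff-* K (F c) (G (z fz ∸ c)) (z ∘ fs)) (A.sym (∑-map _ (c ∷ᶠ_) (below K (z ∘ fs))))) (upTo (suc (z fz))) ⟩
      ∑ (λ c → ∑ (λ b → coeff (suc K) F b A.* coeff (suc K) G (λ i → z i ∸ b i)) (map (c ∷ᶠ_) (below K (z ∘ fs)))) (upTo (suc (z fz)))
        ≈⟨ ∑-concatMap (λ b → coeff (suc K) F b A.* coeff (suc K) G (λ i → z i ∸ b i)) (λ c → map (c ∷ᶠ_) (below K (z ∘ fs))) (upTo (suc (z fz))) ⟨
      ∑ (λ b → coeff (suc K) F b A.* coeff (suc K) G (λ i → z i ∸ b i)) (below (suc K) z) ∎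

  open D using (one; _^ₛ_; prodL; sumL; onePlusPow; geom; geomPair)

  module T = Series ℤ⟦P⟧
  open T using (∣_∣; PS; coeff; scalar; X; module Op)
  module Aᴿ = CommutativeRing ℤ⟦P⟧

  private
    _⟨_⟩ : ∀ {N} → ∣ N ∣ → (Fin (suc N) → ℕ) → ℤ
    _⟨_⟩ {N} F e = coeff N F (e ∘ fs) (e fz)

  -- f is the power series F, with its variables numbered P, x₁, x₂, ….
  Rep : ∀ N → Series (suc N) → ∣ N ∣ → Set
  Rep N f F = ∀ e → f e ≡ coeff N F (e ∘ fs) (e fz)

  module _ (N : ℕ) where
    open Op N using (_+_; _*_; -_; _-_; 1#; 0#; _≈_)

    rep-≈ : ∀ {f F G} → F ≈ G → Rep N f F → Rep N f G
    rep-≈ e r x = ≡.trans (r x) (T.coeff-cong N e (x ∘ fs) (x fz))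

    rep-+ : ∀ {f g F G} → Rep N f F → Rep N g G → Rep N (f +ₛ g) (F + G)
    rep-+ {F = F} {G} r r′ e = ≡.trans (≡.cong₂ ℤ._+_ (r e) (r′ e)) (≡.cong (λ h → h (e fz)) (≡.sym (T.coeff-+ N F G (e ∘ fs))))

    rep-sub : ∀ {f g F G} → Rep N f F → Rep N g G → Rep N (f -ₛ g) (F - G)
    rep-sub {F = F} {G} r r′ e = ≡.trans (≡.cong₂ ℤ._-_ (r e) (r′ e))
      (≡.cong (λ h → h (e fz)) (≡.sym (≡.trans (T.coeff-+ N F (- G) (e ∘ fs)) (≡.cong (λ t → coeff N F (e ∘ fs) Aᴿ.+ t) (T.coeff-neg N G (e ∘ fs))))))

    -- In the statement P is the first of all variables, in the tower it belongs to the coefficient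
    -- ring; the two orders of summation are reconciled by `∑-swap`.
    rep-* : ∀ {f g F G} → Rep N f F → Rep N g G → Rep N (f *ₛ g) (F * G)
    rep-* {f} {g} {F} {G} r r′ e = begin
      sumℤ (map (λ a → f a ℤ.* g (λ i → e i ∸ a i)) (below (suc N) e))
        ≡⟨ sumℤ-map _ (below (suc N) e) ⟩
      Z.∑ (λ a → f a ℤ.* g (λ i → e i ∸ a i)) (below (suc N) e)
        ≡⟨ Z.∑-cong (λ a → ≡.cong₂ ℤ._*_ (r a) (r′ (λ i → e i ∸ a i))) (below (suc N) e) ⟩
      Z.∑ term (below (suc N) e)
        ≡⟨ Z.∑-concatMap term (λ c → map (c ∷ᶠ_) (below N z)) (upTo (suc h)) ⟩
      Z.∑ (λ c → Z.∑ term (map (c ∷ᶠ_) (below N z))) (upTo (suc h))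
        ≡⟨ Z.∑-cong (λ c → Z.∑-map term (c ∷ᶠ_) (below N z)) (upTo (suc h)) ⟩
      Z.∑ (λ c → Z.∑ (λ b → coeff N F b c ℤ.* coeff N G (λ i → z i ∸ b i) (h ∸ c)) (below N z)) (upTo (suc h))
        ≡⟨ Z.∑-swap _ (upTo (suc h)) (below N z) ⟩
      Z.∑ (λ b → Z.∑ (λ c → coeff N F b c ℤ.* coeff N G (λ i → z i ∸ b i) (h ∸ c)) (upTo (suc h))) (below N z)
        ≡⟨ Z.∑-cong (λ b → ConvSum.conv-∑ ℤᴿ (coeff N F b) (coeff N G (λ i → z i ∸ b i)) h) (below N z) ⟨
      Z.∑ (λ b → (coeff N F b Aᴿ.* coeff N G (λ i → z i ∸ b i)) h) (below N z)
        ≡⟨ ∑-at _ (below N z) ⟨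
      Sums.∑ ℤ⟦P⟧ (λ b → coeff N F b Aᴿ.* coeff N G (λ i → z i ∸ b i)) (below N z) h
        ≡⟨ CoeffProduct.coeff-* ℤ⟦P⟧ N F G z h ⟨
      coeff N (F * G) z h ∎
      where
      open ≡.≡-Reasoning
      z = e ∘ fs
      h = e fz
      term : (Fin (suc N) → ℕ) → ℤ
      term a = coeff N F (a ∘ fs) (a fz) ℤ.* coeff N G (λ i → z i ∸ a (fs i)) (h ∸ a fz)
      ∑-at : ∀ {I : Set} (f : I → Aᴿ.Carrier) is → Sums.∑ ℤ⟦P⟧ f is h ≡ Z.∑ (λ i → f i h) is
      ∑-at f []       = ≡.refl
      ∑-at f (i ∷ is) = ≡.cong (λ t → f i h ℤ.+ t) (∑-at f is)

    coeff-scalar-0 : ∀ K a z → (∀ i → z i ≡ 0) → coeff K (scalar K a) z ≡ a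
    coeff-scalar-0 zero    a z e = ≡.refl
    coeff-scalar-0 (suc K) a z e rewrite e fz = coeff-scalar-0 K a (z ∘ fs) (e ∘ fs)

    coeff-scalar-≢ : ∀ K a z → ¬ (∀ i → z i ≡ 0) → coeff K (scalar K a) z ≡ Aᴿ.0#
    coeff-scalar-≢ zero    a z ne = ⊥-elim (ne (λ ()))
    coeff-scalar-≢ (suc K) a z ne with z fz in eq
    ... | zero  = coeff-scalar-≢ K a (z ∘ fs) (λ e → ne (λ { fz → eq ; (fs i) → e i }))
    ... | suc _ = T.coeff-0 K (z ∘ fs)

    scalarℤ : ℤ → ∣ N ∣
    scalarℤ c = scalar N (Univariate.constant ℤᴿ c)

    rep-const : ∀ c → Rep N (const c) (scalarℤ c)
    rep-const c e = by (vecEq? e (λ _ → 0)) (Finₚ.all? (λ i → e (fs i) ℕ.≟ 0))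
      where
      by : (d : Dec (∀ i → e i ≡ 0)) (d′ : Dec (∀ i → e (fs i) ≡ 0)) →
        (if does d then c else 0ℤ) ≡ coeff N (scalarℤ c) (e ∘ fs) (e fz)
      by (yes p) _ rewrite coeff-scalar-0 N (Univariate.constant ℤᴿ c) (e ∘ fs) (p ∘ fs) | p fz = ≡.refl
      by (no ¬p) (no ¬q) rewrite coeff-scalar-≢ N (Univariate.constant ℤᴿ c) (e ∘ fs) ¬q = ≡.refl
      by (no ¬p) (yes q) rewrite coeff-scalar-0 N (Univariate.constant ℤᴿ c) (e ∘ fs) q with e fz in eq
      ... | zero  = ⊥-elim (¬p (λ { fz → eq ; (fs i) → q i }))
      ... | suc _ = ≡.refl

    scalar-1 : scalarℤ 1ℤ ≈ 1#
    scalar-1 = Hom.1-homo (T.scalarHom N)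

    rep-one : Rep N one 1#
    rep-one = rep-≈ scalar-1 (rep-const 1ℤ)

    rep-zero : Rep N (const 0ℤ) 0#
    rep-zero = rep-≈ (Op.trans N (Hom.⟦⟧-cong (T.scalarHom N) (λ { zero → ≡.refl ; (suc _) → ≡.refl })) (Hom.0-homo (T.scalarHom N))) (rep-const 0ℤ)

    rep-prodL : ∀ {I : Set} {f : I → Series (suc N)} {F : I → ∣ N ∣} is → (∀ i → Rep N (f i) (F i)) → Rep N (prodL is f) (ListAlgebra.∏ (PS N) F is)
    rep-prodL []       r = rep-one
    rep-prodL (i ∷ is) r = rep-* (r i) (rep-prodL is r)

    rep-sumL : ∀ {I : Set} {f : I → Series (suc N)} {F : I → ∣ N ∣} is → (∀ i → Rep N (f i) (F i)) → Rep N (sumL is f) (ListAlgebra.∑ (PS N) F is)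
    rep-sumL []       r = rep-zero
    rep-sumL (i ∷ is) r = rep-+ (r i) (rep-sumL is r)

    Pᴬ : Aᴿ.Carrier
    Pᴬ = Univariate.indet ℤᴿ

    unit-≡ : ∀ {V} (t : Fin V) → unit t t ≡ 1
    unit-≡ t with t Finₚ.≟ t
    ... | yes _ = ≡.refl
    ... | no ne = ⊥-elim (ne ≡.refl)

    unit-≢ : ∀ {V} (t i : Fin V) → i ≢ t → unit t i ≡ 0
    unit-≢ t i ne with i Finₚ.≟ t
    ... | yes e = ⊥-elim (ne e)
    ... | no _  = ≡.refl

    unit-fs : ∀ {V} (t i : Fin V) → unit (fs t) (fs i) ≡ unit t i
    unit-fs t i with i Finₚ.≟ t
    ... | yes _ = ≡.refl
    ... | no  _ = ≡.refl

    rep-P : Rep N (var fz) (scalar N Pᴬ)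
    rep-P e = by (vecEq? e (unit fz)) (Finₚ.all? (λ i → e (fs i) ℕ.≟ 0))
      where
      by : (d : Dec (∀ i → e i ≡ unit fz i)) (d′ : Dec (∀ i → e (fs i) ≡ 0)) →
        (if does d then 1ℤ else 0ℤ) ≡ coeff N (scalar N Pᴬ) (e ∘ fs) (e fz)
      by (yes p) _ rewrite coeff-scalar-0 N Pᴬ (e ∘ fs) (p ∘ fs) | p fz = ≡.refl
      by (no ¬p) (no ¬q) rewrite coeff-scalar-≢ N Pᴬ (e ∘ fs) ¬q = ≡.refl
      by (no ¬p) (yes q) rewrite coeff-scalar-0 N Pᴬ (e ∘ fs) q with e fz in eq
      ... | zero        = ≡.refl
      ... | suc zero    = ⊥-elim (¬p (λ { fz → eq ; (fs i) → q i }))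
      ... | suc (suc _) = ≡.refl

    coeff-X* : ∀ t (F : ∣ N ∣) z {n} → z t ≡ suc n → coeff N (X t * F) z Aᴿ.≈ coeff N F (λ i → z i ∸ unit t i)
    coeff-X* t F z {n} e = T.coeff-X-suc t F z (λ i → z i ∸ unit t i)
      (≡.trans e (≡.cong suc (≡.sym (≡.trans (≡.cong₂ _∸_ e (unit-≡ t)) ≡.refl))))
      (λ j ne → ≡.sym (≡.cong (z j ∸_) (unit-≢ t j ne)))

    rep-X : ∀ t → Rep N (var (fs t)) (X t)
    rep-X t e = ≡.trans (by (vecEq? e (unit (fs t)))) (T.coeff-cong N (Op.*-identityʳ N (X t)) (e ∘ fs) (e fz))
      where
      z = e ∘ fs
      1ᴿ : ∣ N ∣
      1ᴿ = 1#
      one≡ : ∀ z′ p → coeff N 1ᴿ z′ p ≡ coeff N (scalarℤ 1ℤ) z′ p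
      one≡ z′ p = ≡.sym (T.coeff-cong N scalar-1 z′ p)
      by : (d : Dec (∀ i → e i ≡ unit (fs t) i)) → (if does d then 1ℤ else 0ℤ) ≡ coeff N (X t * 1#) z (e fz)
      by (yes p) = ≡.sym (≡.trans (coeff-X* t 1# z (≡.trans (p (fs t)) (unit-≡ (fs t))) (e fz))
        (≡.trans (one≡ _ (e fz)) (≡.trans (≡.cong (λ h → h (e fz)) (coeff-scalar-0 N _ _
          (λ i → ≡.trans (≡.cong (_∸ unit t i) (≡.trans (p (fs i)) (unit-fs t i))) (ℕₚ.n∸n≡0 (unit t i)))))
          (≡.cong (Univariate.constant ℤᴿ 1ℤ) (p fz)))))
      by (no ¬p) with z t in eq
      ... | zero  = ≡.sym (T.coeff-X-zero t 1# z eq (e fz))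
      ... | suc n = ≡.sym (≡.trans (coeff-X* t 1# z eq (e fz)) (≡.trans (one≡ _ (e fz)) (rest (Finₚ.all? (λ i → (z i ∸ unit t i) ℕ.≟ 0)))))
        where
        rest : Dec (∀ i → z i ∸ unit t i ≡ 0) → coeff N (scalarℤ 1ℤ) (λ i → z i ∸ unit t i) (e fz) ≡ 0ℤ
        rest (no ¬q) = ≡.cong (λ h → h (e fz)) (coeff-scalar-≢ N _ _ ¬q)
        rest (yes q) = ≡.trans (≡.cong (λ h → h (e fz)) (coeff-scalar-0 N _ _ q)) (nonzero (e fz) ≡.refl)
          where
          nonzero : ∀ p → e fz ≡ p → Univariate.constant ℤᴿ 1ℤ p ≡ 0ℤ
          nonzero (suc p) _ = ≡.refl
          nonzero zero e₀ = ⊥-elim (¬p λ { fz → e₀ ; (fs i) → ≡.trans (≡.sym (ℕₚ.m∸n+n≡m (at i))) (≡.trans (≡.cong (ℕ._+ unit t i) (q i)) (≡.sym (unit-fs t i))) })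
            where
            at : ∀ i → unit t i ≤ z i
            at i with i Finₚ.≟ t
            ... | no _ = z≤n
            ... | yes ≡.refl = ≡.subst (1 ≤_) (≡.sym eq) (s≤s z≤n)

  module _ {V : ℕ} where

    private
      E : Set
      E = Fin V → ℕ

    ≤-total : ∀ (e : E) i → e i ≤ total e
    ≤-total e i = go id i
      where
      go : ∀ {n} (f : Fin n → Fin V) i → e (f i) ≤ foldr ℕ._+_ 0 (map e (tabulate f))
      go f fz     = ℕₚ.m≤m+n _ _
      go f (fs i) = ℕₚ.≤-trans (go (f ∘ fs) i) (ℕₚ.m≤n+m _ _)

    -- The sum in `subst` with a free bound, because its own bound, the total degree, changes when
    -- the monomial is divided out.
    multiples : ℕ → (ℕ → ℤ) → (μ e : E) → ℤ
    multiples b c μ e = Z.∑ (λ d → Z.guard (vecEq? e (λ i → d ℕ.* μ i)) (c d)) (upTo b)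

    subst≡multiples : ∀ c μ e → D.subst c μ e ≡ multiples (suc (total e)) c μ e
    subst≡multiples c μ e = sumℤ-map (λ d → Z.guard (vecEq? e (λ i → d ℕ.* μ i)) (c d)) (upTo (suc (total e)))

    guard-swap : ∀ {P Q : Set} (p : Dec P) (q : Dec Q) {x : ℤ} → (P → Q) → (Q → P) → Z.guard p x ≡ Z.guard q x
    guard-swap (yes _) (yes _) f g = ≡.refl
    guard-swap (yes p) (no ¬q) f g = ⊥-elim (¬q (f p))
    guard-swap (no ¬p) (yes q) f g = ⊥-elim (¬p (g q))
    guard-swap (no _)  (no _)  f g = ≡.refl

    multiples-suc : ∀ b c μ e → multiples (suc b) c μ e ≡
      Z.guard (vecEq? e (λ _ → 0)) (c 0) ℤ.+ Z.guard (Finₚ.all? (λ i → μ i ℕ.≤? e i)) (multiples b (c ∘ suc) μ (λ i → e i ∸ μ i))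
    multiples-suc b c μ e = ≡.cong₂ ℤ._+_ (guard-swap (vecEq? e (λ i → 0 ℕ.* μ i)) (vecEq? e (λ _ → 0)) id id)
      (≡.trans (ConvSum.∑-applyUpTo ℤᴿ _ suc b) (by (Finₚ.all? (λ i → μ i ℕ.≤? e i))))
      where
      by : (d : Dec (∀ i → μ i ≤ e i)) → Z.∑ (λ d → Z.guard (vecEq? e (λ i → suc d ℕ.* μ i)) (c (suc d))) (upTo b)
        ≡ Z.guard d (multiples b (c ∘ suc) μ (λ i → e i ∸ μ i))
      by (yes le) = Z.∑-cong (λ d → guard-swap (vecEq? e (λ i → suc d ℕ.* μ i)) (vecEq? (λ i → e i ∸ μ i) (λ i → d ℕ.* μ i))
        (λ p i → ≡.trans (≡.cong (_∸ μ i) (p i)) (ℕₚ.m+n∸m≡n (μ i) (d ℕ.* μ i)))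
        (λ p i → ≡.trans (≡.sym (ℕₚ.m+[n∸m]≡n (le i))) (≡.cong (μ i ℕ.+_) (p i)))) (upTo b)
      by (no ¬le) = Z.∑-0 (λ d → Z.guard-no (vecEq? e (λ i → suc d ℕ.* μ i))
        (λ p → ¬le (λ i → ≡.subst (μ i ≤_) (≡.sym (p i)) (ℕₚ.m≤m+n (μ i) (d ℕ.* μ i))))) (upTo b)

    module _ (μ : E) (i₀ : Fin V) (0<μ : 0 < μ i₀) where

      shrinks : ∀ {e : E} → (∀ i → μ i ≤ e i) → e i₀ ∸ μ i₀ < e i₀
      shrinks le = ℕₚ.∸-monoʳ-< 0<μ (le i₀)

      -- A multiple d of the monomial needs exponent at least d at `i₀`, so every term past `e i₀`
      -- is 0.
      multiples-stable : ∀ b b′ c e → e i₀ < b → e i₀ < b′ → multiples b c μ e ≡ multiples b′ c μ e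
      multiples-stable (suc b) (suc b′) c e lt lt′ = ≡.trans (multiples-suc b c μ e) (≡.trans
        (≡.cong (λ t → Z.guard (vecEq? e (λ _ → 0)) (c 0) ℤ.+ t) (by (Finₚ.all? (λ i → μ i ℕ.≤? e i)))) (≡.sym (multiples-suc b′ c μ e)))
        where
        by : (d : Dec (∀ i → μ i ≤ e i)) → Z.guard d (multiples b (c ∘ suc) μ (λ i → e i ∸ μ i)) ≡ Z.guard d (multiples b′ (c ∘ suc) μ (λ i → e i ∸ μ i))
        by (yes le) = multiples-stable b b′ (c ∘ suc) _ (ℕₚ.<-≤-trans (shrinks le) (ℕ.s≤s⁻¹ lt)) (ℕₚ.<-≤-trans (shrinks le) (ℕ.s≤s⁻¹ lt′))
        by (no _) = ≡.refl

      -- The recursion c(y) = c(0) + y c'(y), where c' has the shifted coefficients and y is the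
      -- monomial. Inverses and binomial series are recognised in the tower through it.
      subst-suc : ∀ c e → D.subst c μ e ≡
        Z.guard (vecEq? e (λ _ → 0)) (c 0) ℤ.+ Z.guard (Finₚ.all? (λ i → μ i ℕ.≤? e i)) (D.subst (c ∘ suc) μ (λ i → e i ∸ μ i))
      subst-suc c e = ≡.trans (subst≡multiples c μ e) (≡.trans (multiples-suc (total e) c μ e)
        (≡.cong (λ t → Z.guard (vecEq? e (λ _ → 0)) (c 0) ℤ.+ t) (by (Finₚ.all? (λ i → μ i ℕ.≤? e i)))))
        where
        by : (d : Dec (∀ i → μ i ≤ e i)) → Z.guard d (multiples (total e) (c ∘ suc) μ (λ i → e i ∸ μ i)) ≡ Z.guard d (D.subst (c ∘ suc) μ (λ i → e i ∸ μ i))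
        by (yes le) = ≡.trans (multiples-stable (total e) (suc (total (λ i → e i ∸ μ i))) (c ∘ suc) _
          (ℕₚ.<-≤-trans (shrinks le) (≤-total e i₀)) (s≤s (≤-total (λ i → e i ∸ μ i) i₀)))
          (≡.sym (subst≡multiples (c ∘ suc) μ _))
        by (no _) = ≡.refl

    multiples-≗ : ∀ b c μ {e e′ : E} → (∀ i → e i ≡ e′ i) → multiples b c μ e ≡ multiples b c μ e′
    multiples-≗ b c μ {e} {e′} p = Z.∑-cong (λ d → guard-swap (vecEq? e (λ i → d ℕ.* μ i)) (vecEq? e′ (λ i → d ℕ.* μ i))
      (λ q i → ≡.trans (≡.sym (p i)) (q i)) (λ q i → ≡.trans (p i) (q i))) (upTo b)

    subst-≗ : ∀ c μ (e e′ : E) → (∀ i → e i ≡ e′ i) → D.subst c μ e ≡ D.subst c μ e′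
    subst-≗ c μ e e′ p = ≡.trans (subst≡multiples c μ e) (≡.trans
      (≡.trans (≡.cong (λ t → multiples (suc t) c μ e) (≡.cong (foldr ℕ._+_ 0) (Listₚ.map-cong p (allFin V))))
        (multiples-≗ (suc (total e′)) c μ p))
      (≡.sym (subst≡multiples c μ e′)))

    multiples-+ : ∀ b c c′ μ (e : E) → multiples b (λ d → c d ℤ.+ c′ d) μ e ≡ multiples b c μ e ℤ.+ multiples b c′ μ e
    multiples-+ b c c′ μ e = ≡.trans (Z.∑-cong (λ d → guard-+ (vecEq? e (λ i → d ℕ.* μ i)) (c d) (c′ d)) (upTo b)) (Z.∑-+ _ _ (upTo b))
      where
      guard-+ : ∀ {P : Set} (p : Dec P) x y → Z.guard p (x ℤ.+ y) ≡ Z.guard p x ℤ.+ Z.guard p y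
      guard-+ (yes _) x y = ≡.refl
      guard-+ (no _)  x y = ≡.refl

    subst-+ : ∀ c c′ μ (e : E) → D.subst (λ d → c d ℤ.+ c′ d) μ e ≡ D.subst c μ e ℤ.+ D.subst c′ μ e
    subst-+ c c′ μ e = ≡.trans (subst≡multiples _ μ e) (≡.trans (multiples-+ (suc (total e)) c c′ μ e)
      (≡.sym (≡.cong₂ ℤ._+_ (subst≡multiples c μ e) (subst≡multiples c′ μ e))))

    multiples-cong : ∀ b {c c′} μ (e : E) → (∀ d → c d ≡ c′ d) → multiples b c μ e ≡ multiples b c′ μ e
    multiples-cong b μ e p = Z.∑-cong (λ d → ≡.cong (Z.guard (vecEq? e (λ i → d ℕ.* μ i))) (p d)) (upTo b)

    subst-cong : ∀ {c c′} μ (e : E) → (∀ d → c d ≡ c′ d) → D.subst c μ e ≡ D.subst c′ μ e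
    subst-cong {c} {c′} μ e p = ≡.trans (subst≡multiples c μ e) (≡.trans
      (multiples-cong (suc (total e)) μ e p) (≡.sym (subst≡multiples c′ μ e)))

  tabulateSeries : ∀ N → ((Fin N → ℕ) → Aᴿ.Carrier) → ∣ N ∣
  tabulateSeries zero    h = h (λ ())
  tabulateSeries (suc N) h = λ c → tabulateSeries N (λ b → h (c ∷ᶠ b))

  coeff-tabulateSeries : ∀ N h z p → (∀ {z z′} → (∀ i → z i ≡ z′ i) → h z p ≡ h z′ p) → coeff N (tabulateSeries N h) z p ≡ h z p
  coeff-tabulateSeries zero    h z p e = e (λ ())
  coeff-tabulateSeries (suc N) h z p e = ≡.trans
    (coeff-tabulateSeries N (λ b → h (z fz ∷ᶠ b)) (z ∘ fs) p (λ q → e (λ { fz → ≡.refl ; (fs i) → q i })))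
    (e (λ { fz → ≡.refl ; (fs i) → ≡.refl }))

  module Substitution (N : ℕ) where
    open Op N using (_+_; _*_; -_; _-_; 1#; 0#; _≈_)

    -- A monomial is described by how multiplication with it moves coefficients, which treats x_t
    -- and x_s x_t alike.
    record Monomial (μ : Fin (suc N) → ℕ) (Xμ : ∣ N ∣) : Set where
      field
        free-of-P : μ fz ≡ 0
        coeff-≥   : ∀ F z → (∀ i → μ (fs i) ≤ z i) → coeff N (Xμ * F) z Aᴿ.≈ coeff N F (λ i → z i ∸ μ (fs i))
        coeff-≱   : ∀ F z → ¬ (∀ i → μ (fs i) ≤ z i) → coeff N (Xμ * F) z Aᴿ.≈ Aᴿ.0#

    open Monomial

    monomial-X : ∀ t → Monomial (unit (fs t)) (X t)
    monomial-X t .free-of-P = ≡.refl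
    monomial-X t .coeff-≥ F z le p = ≡.trans (coeff-X* N t F z (≡.sym (ℕₚ.suc-pred (z t) {{ℕ.>-nonZero 0<z}})) p)
      (≡.cong (λ h → h p) (T.coeff-≗ N F (λ i → ≡.cong (z i ∸_) (≡.sym (unit-fs N t i)))))
      where
      0<z : 0 < z t
      0<z = ≡.subst (_≤ z t) (≡.trans (unit-fs N t t) (unit-≡ N t)) (le t)
    monomial-X t .coeff-≱ F z ¬le with z t in eq
    ... | zero  = T.coeff-X-zero t F z eq
    ... | suc n = ⊥-elim (¬le at)
      where
      at : ∀ i → unit (fs t) (fs i) ≤ z i
      at i with i Finₚ.≟ t
      ... | no _ = z≤n
      ... | yes ≡.refl = ≡.subst (1 ≤_) (≡.sym eq) (s≤s z≤n)

    monomial-* : ∀ {μ ν Xμ Xν} → Monomial μ Xμ → Monomial ν Xν → Monomial (λ i → μ i ℕ.+ ν i) (Xμ * Xν)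
    monomial-* M M′ .free-of-P = ≡.cong₂ ℕ._+_ (free-of-P M) (free-of-P M′)
    monomial-* {μ} {ν} {Xμ} {Xν} M M′ .coeff-≥ F z le p = ≡.trans
      (T.coeff-cong N (Op.*-assoc N Xμ Xν F) z p) (≡.trans
      (coeff-≥ M (Xν * F) z (λ i → ℕₚ.≤-trans (ℕₚ.m≤m+n (μ (fs i)) (ν (fs i))) (le i)) p) (≡.trans
      (coeff-≥ M′ F (λ i → z i ∸ μ (fs i)) (λ i → ℕₚ.≤-trans (ℕₚ.≤-reflexive (≡.sym (ℕₚ.m+n∸m≡n (μ (fs i)) (ν (fs i))))) (ℕₚ.∸-monoˡ-≤ (μ (fs i)) (le i))) p)
      (≡.cong (λ h → h p) (T.coeff-≗ N F (λ i → ℕₚ.∸-+-assoc (z i) (μ (fs i)) (ν (fs i)))))))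
    monomial-* {μ} {ν} {Xμ} {Xν} M M′ .coeff-≱ F z ¬le p = ≡.trans (T.coeff-cong N (Op.*-assoc N Xμ Xν F) z p) (by (Finₚ.all? (λ i → μ (fs i) ℕ.≤? z i)))
      where
      by : Dec (∀ i → μ (fs i) ≤ z i) → coeff N (Xμ * (Xν * F)) z p ≡ 0ℤ
      by (no ¬q) = coeff-≱ M (Xν * F) z ¬q p
      by (yes q) = ≡.trans (coeff-≥ M (Xν * F) z q p) (coeff-≱ M′ F _ (λ q′ → ¬le (λ i →
        ℕₚ.≤-trans (ℕₚ.+-monoʳ-≤ (μ (fs i)) (q′ i)) (ℕₚ.≤-reflexive (ℕₚ.m+[n∸m]≡n (q i))))) p)

    series : (ℕ → ℤ) → (Fin (suc N) → ℕ) → ∣ N ∣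
    series c μ = tabulateSeries N (λ z p → D.subst c μ (p ∷ᶠ z))

    coeff-series : ∀ c μ z p → coeff N (series c μ) z p ≡ D.subst c μ (p ∷ᶠ z)
    coeff-series c μ z p = coeff-tabulateSeries N _ z p (λ {z} {z′} q → subst-≗ c μ (p ∷ᶠ z) (p ∷ᶠ z′) (λ { fz → ≡.refl ; (fs i) → q i }))

    rep-subst : ∀ c μ → Rep N (D.subst c μ) (series c μ)
    rep-subst c μ e = ≡.trans (subst-≗ c μ e (e fz ∷ᶠ (e ∘ fs)) (λ { fz → ≡.refl ; (fs i) → ≡.refl })) (≡.sym (coeff-series c μ (e ∘ fs) (e fz)))

    series-suc : ∀ {μ Xμ} → Monomial μ Xμ → ∀ i₀ → 0 < μ i₀ → ∀ c → series c μ ≈ scalarℤ N (c 0) + Xμ * series (c ∘ suc) μ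
    series-suc {μ} {Xμ} M i₀ 0<μ c = T.coeff-ext N λ z p → begin
      coeff N (series c μ) z p
        ≡⟨ coeff-series c μ z p ⟩
      D.subst c μ (p ∷ᶠ z)
        ≡⟨ subst-suc μ i₀ 0<μ c (p ∷ᶠ z) ⟩
      const (c 0) (p ∷ᶠ z) ℤ.+ Z.guard (Finₚ.all? (λ i → μ i ℕ.≤? (p ∷ᶠ z) i)) (D.subst (c ∘ suc) μ (λ i → (p ∷ᶠ z) i ∸ μ i))
        ≡⟨ ≡.cong₂ ℤ._+_ (rep-const N (c 0) (p ∷ᶠ z)) (by z p (Finₚ.all? (λ i → μ i ℕ.≤? (p ∷ᶠ z) i))) ⟩
      coeff N (scalarℤ N (c 0)) z p ℤ.+ coeff N (Xμ * series (c ∘ suc) μ) z p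
        ≡⟨ ≡.cong (λ h → h p) (T.coeff-+ N (scalarℤ N (c 0)) (Xμ * series (c ∘ suc) μ) z) ⟨
      coeff N (scalarℤ N (c 0) + Xμ * series (c ∘ suc) μ) z p ∎
      where
      open ≡.≡-Reasoning
      by : ∀ z p (d : Dec (∀ i → μ i ≤ (p ∷ᶠ z) i)) → Z.guard d (D.subst (c ∘ suc) μ (λ i → (p ∷ᶠ z) i ∸ μ i)) ≡ coeff N (Xμ * series (c ∘ suc) μ) z p
      by z p (yes le) = ≡.sym (≡.trans (coeff-≥ M (series (c ∘ suc) μ) z (λ i → le (fs i)) p) (≡.trans (coeff-series (c ∘ suc) μ _ p)
        (subst-≗ (c ∘ suc) μ (p ∷ᶠ (λ i → z i ∸ μ (fs i))) (λ i → (p ∷ᶠ z) i ∸ μ i) (λ { fz → ≡.cong (p ∸_) (≡.sym (free-of-P M)) ; (fs i) → ≡.refl }))))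
      by z p (no ¬le) = ≡.sym (coeff-≱ M (series (c ∘ suc) μ) z
        (λ q → ¬le (λ { fz → ≡.subst (_≤ p) (≡.sym (free-of-P M)) z≤n ; (fs i) → q i })) p)

    series-cong : ∀ {c c′} μ → (∀ d → c d ≡ c′ d) → series c μ ≈ series c′ μ
    series-cong {c} {c′} μ e = T.coeff-ext N λ z p → ≡.trans (coeff-series c μ z p) (≡.trans (subst-cong μ (p ∷ᶠ z) e) (≡.sym (coeff-series c′ μ z p)))

    series-+ : ∀ c c′ μ → series (λ d → c d ℤ.+ c′ d) μ ≈ series c μ + series c′ μ
    series-+ c c′ μ = T.coeff-ext N λ z p → ≡.trans (coeff-series (λ d → c d ℤ.+ c′ d) μ z p) (≡.trans (subst-+ c c′ μ (p ∷ᶠ z)) (≡.trans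
      (≡.sym (≡.cong₂ ℤ._+_ (coeff-series c μ z p) (coeff-series c′ μ z p)))
      (≡.cong (λ h → h p) (≡.sym (T.coeff-+ N (series c μ) (series c′ μ) z)))))

    private
      module S = IntegerSolver (PS N)
      open import Relation.Binary.Reasoning.Setoid (Op.setoid N)

    series-inverse : ∀ {μ Xμ} → Monomial μ Xμ → ∀ i₀ → 0 < μ i₀ → (1# - Xμ) * series (λ _ → 1ℤ) μ ≈ 1#
    series-inverse {μ} {Xμ} M i₀ lt = begin
      (1# - Xμ) * G
        ≈⟨ S.solve 2 (λ x g → (S.con (+ 1) S.:- x) S.:* g S.:= g S.:- x S.:* g) (Op.refl N) Xμ G ⟩
      G - Xμ * G
        ≈⟨ Op.+-congʳ N (Op.trans N (series-suc M i₀ lt (λ _ → 1ℤ)) (Op.+-congʳ N (scalar-1 N))) ⟩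
      (1# + Xμ * G) - Xμ * G
        ≈⟨ S.solve 1 (λ y → (S.con (+ 1) S.:+ y) S.:- y S.:= S.con (+ 1)) (Op.refl N) (Xμ * G) ⟩
      1# ∎
      where G = series (λ _ → 1ℤ) μ

    0<unit : ∀ (t : Fin N) → 0 < unit (fs t) (fs t)
    0<unit t = ℕₚ.≤-reflexive (≡.sym (≡.trans (unit-fs N t t) (unit-≡ N t)))

    rep-geom : ∀ t → Rep N (geom (fs t)) (T.geo t)
    rep-geom t = rep-≈ N (T.Lw.inv-unique N {1# - X t} (series-inverse (monomial-X t) (fs t) (0<unit t)) (T.geo-inv t))
      (rep-subst (λ _ → 1ℤ) (unit (fs t)))

    rep-geomPair : ∀ s t → Rep N (geomPair (fs s) (fs t)) (T.gp s t)
    rep-geomPair s t = rep-≈ N (T.Lw.inv-unique N {1# - X s * X t}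
        (series-inverse (monomial-* (monomial-X s) (monomial-X t)) (fs s) (ℕₚ.<-≤-trans (0<unit s) (ℕₚ.m≤m+n _ _))) (T.gp-inv s t))
      (rep-subst (λ _ → 1ℤ) (λ i → unit (fs s) i ℕ.+ unit (fs t) i))

    binomial : Fin N → ℤ → ∣ N ∣
    binomial t z = series (genBinom z) (unit (fs t))

    rep-onePlusPow : ∀ t z → Rep N (onePlusPow (fs t) z) (binomial t z)
    rep-onePlusPow t z = rep-subst (genBinom z) (unit (fs t))

    genBinom-0 : ∀ z → genBinom z 0 ≡ 1ℤ
    genBinom-0 (+ n)    = ≡.refl
    genBinom-0 -[1+ r ] = ≡.refl

    -- Pascal's rule for integer exponents. The case -1 stands alone because there the two clauses
    -- of `genBinom` meet.
    genBinom-suc : ∀ z d → genBinom (ℤ.suc z) (suc d) ≡ genBinom z (suc d) ℤ.+ genBinom z d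
    genBinom-suc (+ n) d = ≡.cong +_ (≡.trans (≡.sym (nCk+nC[k+1]≡[n+1]C[k+1] n d)) (ℕₚ.+-comm (n C d) (n C suc d)))
    -- The exponent passes from -1 to 0, and the right side is (-1)^(d+1) + (-1)^d.
    genBinom-suc -[1+ zero ] d = ≡.sym (≡.trans (≡.cong₂ ℤ._+_ (≡.cong (λ t → (-1ℤ ℤ.^ suc d) ℤ.* + t) (nCn≡1 (suc d))) (≡.cong (λ t → (-1ℤ ℤ.^ d) ℤ.* + t) (nCn≡1 d)))
      (alternate (-1ℤ ℤ.^ d)))
      where
      alternate : ∀ x → (-1ℤ ℤ.* x) ℤ.* + 1 ℤ.+ x ℤ.* + 1 ≡ 0ℤ
      alternate x = ≡.trans (≡.cong₂ ℤ._+_ (≡.trans (ℤₚ.*-identityʳ (-1ℤ ℤ.* x)) (ℤₚ.-1*i≡-i x)) (ℤₚ.*-identityʳ x)) (ℤₚ.+-inverseˡ x)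
    genBinom-suc -[1+ suc r ] d = ≡.trans (≡.cong (λ t → (-1ℤ ℤ.^ suc d) ℤ.* + t) (shape pascal)) (expand (-1ℤ ℤ.^ d))
      where
      a b c : ℕ
      a = (r ℕ.+ suc d) C suc d
      b = (suc r ℕ.+ suc d) C suc d
      c = (suc r ℕ.+ d) C d
      pascal : b ≡ c ℕ.+ a
      pascal = ≡.trans (≡.sym (nCk+nC[k+1]≡[n+1]C[k+1] (r ℕ.+ suc d) d)) (≡.cong (λ t → t C d ℕ.+ a) (ℕₚ.+-suc r d))
      shape : b ≡ c ℕ.+ a → a ≡ b ∸ c
      shape e = ≡.sym (≡.trans (≡.cong (_∸ c) e) (ℕₚ.m+n∸m≡n c a))
      expand : ∀ x → (-1ℤ ℤ.* x) ℤ.* + (b ∸ c) ≡ (-1ℤ ℤ.* x) ℤ.* + b ℤ.+ x ℤ.* + c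
      expand x = ≡.trans (≡.cong (λ t → (-1ℤ ℤ.* x) ℤ.* + t) (≡.sym (shape pascal))) (≡.trans
        (Zs.solve 3 (λ x a c → (Zs.con -1ℤ Zs.:* x) Zs.:* a Zs.:= (Zs.con -1ℤ Zs.:* x) Zs.:* (c Zs.:+ a) Zs.:+ x Zs.:* c) ≡.refl x (+ a) (+ c))
        (≡.cong (λ t → (-1ℤ ℤ.* x) ℤ.* t ℤ.+ x ℤ.* + c) (≡.trans (≡.sym (ℤₚ.pos-+ c a)) (≡.cong +_ (≡.sym pascal)))))
        where open import Data.Integer.Solver using (module +-*-Solver)
              module Zs = +-*-Solver

    binomial-suc : ∀ t z → binomial t (ℤ.suc z) ≈ (1# + X t) * binomial t z
    binomial-suc t z = begin
      binomial t (ℤ.suc z)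
        ≈⟨ series-suc (monomial-X t) (fs t) (0<unit t) (genBinom (ℤ.suc z)) ⟩
      scalarℤ N (genBinom (ℤ.suc z) 0) + X t * series (genBinom (ℤ.suc z) ∘ suc) μ
        ≈⟨ Op.+-cong N (reflexive (≡.cong (scalarℤ N) (≡.trans (genBinom-0 (ℤ.suc z)) (≡.sym (genBinom-0 z)))))
             (Op.*-congˡ N {X t} (Op.trans N (series-cong μ (genBinom-suc z)) (series-+ (genBinom z ∘ suc) (genBinom z) μ))) ⟩
      scalarℤ N (genBinom z 0) + X t * (series (genBinom z ∘ suc) μ + binomial t z)
        ≈⟨ S.solve 4 (λ s x y b → s S.:+ x S.:* (y S.:+ b) S.:= (s S.:+ x S.:* y) S.:+ x S.:* b) (Op.refl N)
             (scalarℤ N (genBinom z 0)) (X t) (series (genBinom z ∘ suc) μ) (binomial t z) ⟩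
      (scalarℤ N (genBinom z 0) + X t * series (genBinom z ∘ suc) μ) + X t * binomial t z
        ≈⟨ Op.+-congʳ N (series-suc (monomial-X t) (fs t) (0<unit t) (genBinom z)) ⟨
      binomial t z + X t * binomial t z
        ≈⟨ S.solve 2 (λ x b → b S.:+ x S.:* b S.:= (S.con (+ 1) S.:+ x) S.:* b) (Op.refl N) (X t) (binomial t z) ⟩
      (1# + X t) * binomial t z ∎
      where
      μ = unit (fs t)
      reflexive = Op.reflexive N

    binomial-0 : ∀ t → binomial t (+ 0) ≈ 1#
    binomial-0 t = begin
      binomial t (+ 0)
        ≈⟨ series-suc (monomial-X t) (fs t) (0<unit t) (genBinom (+ 0)) ⟩
      scalarℤ N 1ℤ + X t * series (λ d → genBinom (+ 0) (suc d)) μ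
        ≈⟨ Op.+-cong N (scalar-1 N) (Op.*-congˡ N {X t} zero-series) ⟩
      1# + X t * 0#
        ≈⟨ S.solve 1 (λ x → S.con (+ 1) S.:+ x S.:* S.con (+ 0) S.:= S.con (+ 1)) (Op.refl N) (X t) ⟩
      1# ∎
      where
      μ = unit (fs t)
      zero-series : series (λ d → genBinom (+ 0) (suc d)) μ ≈ 0#
      zero-series = T.coeff-ext N λ z p → ≡.trans (coeff-series (λ _ → 0ℤ) μ z p) (≡.trans
        (≡.trans (subst≡multiples (λ _ → 0ℤ) μ (p ∷ᶠ z)) (Z.∑-0 (λ d → zero-guard (vecEq? (p ∷ᶠ z) (λ i → d ℕ.* μ i))) (upTo (suc (total (p ∷ᶠ z))))))
        (≡.cong (λ h → h p) (≡.sym (T.coeff-0 N z))))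
        where
        zero-guard : ∀ {Q : Set} (q : Dec Q) → Z.guard q 0ℤ ≡ 0ℤ
        zero-guard (yes _) = ≡.refl
        zero-guard (no _)  = ≡.refl

    binomial-+ : ∀ t j z → binomial t (+ j) * binomial t z ≈ binomial t (+ j ℤ.+ z)
    binomial-+ t zero z = Op.trans N (Op.*-congʳ N (binomial-0 t)) (Op.trans N (Op.*-identityˡ N _)
      (Op.reflexive N (≡.cong (binomial t) (≡.sym (ℤₚ.+-identityˡ z)))))
    binomial-+ t (suc j) z = begin
      binomial t (+ suc j) * binomial t z        ≈⟨ Op.*-congʳ N (binomial-suc t (+ j)) ⟩
      (1# + X t) * binomial t (+ j) * binomial t z ≈⟨ Op.*-assoc N (1# + X t) _ _ ⟩
      (1# + X t) * (binomial t (+ j) * binomial t z) ≈⟨ Op.*-congˡ N {1# + X t} (binomial-+ t j z) ⟩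
      (1# + X t) * binomial t (+ j ℤ.+ z)        ≈⟨ binomial-suc t (+ j ℤ.+ z) ⟨
      binomial t (ℤ.suc (+ j ℤ.+ z))             ≡⟨ ≡.cong (binomial t) (≡.sym (ℤₚ.+-assoc (+ 1) (+ j) z)) ⟩
      binomial t (+ suc j ℤ.+ z) ∎

-- Products over pairs of variables and signed sums over positions.

module PairProducts where

  open RingSolving
  open AlternatingSums
  open PowerSeriesTower
  open LittlewoodSeries
  open RowEvolution
  open import Algebra.Bundles using (CommutativeRing)
  open import Data.Bool using (true; false; if_then_else_)
  open import Data.Empty using (⊥-elim)
  open import Data.Fin using (Fin; toℕ) renaming (zero to fz; suc to fs)
  import Data.Fin.Properties as Finₚ
  open import Data.Integer using (+_)
  open import Data.List using (List; []; _∷_; map; filter; allFin; cartesianProduct; _++_)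
  import Data.List.Properties as Listₚ
  open import Data.List.Relation.Unary.All as All using (All; []; _∷_)
  import Data.List.Relation.Unary.All.Properties as Allₚ
  open import Data.List.Relation.Unary.AllPairs as AllPairs using (AllPairs; []; _∷_)
  import Data.List.Relation.Unary.AllPairs.Properties as AllPairsₚ
  open import Data.Nat as ℕ using (ℕ; zero; suc; _<_; s≤s; z≤n)
  import Data.Nat.Properties as ℕₚ
  open import Data.Product using (_×_; _,_; proj₁; proj₂)
  open import Function using (_∘_; id)
  open import Relation.Nullary using (Dec; yes; no; does; ¬_; ¬?)
  open import Relation.Nullary.Decidable using (_×-dec_)
  import Relation.Binary.PropositionalEquality as ≡
  open ≡ using (_≡_; _≢_)

  fins≡allFin : ∀ K → fins K ≡ allFin K
  fins≡allFin zero    = ≡.refl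
  fins≡allFin (suc K) = ≡.cong (fz ∷_) (≡.trans (≡.cong (map fs) (fins≡allFin K)) (Listₚ.map-tabulate id fs))

  fins-sorted : ∀ K → AllPairs (λ i j → toℕ i < toℕ j) (fins K)
  fins-sorted zero    = []
  fins-sorted (suc K) = Allₚ.map⁺ (All.universal (λ _ → s≤s z≤n) (fins K)) ∷ AllPairsₚ.map⁺ (AllPairs.map s≤s (fins-sorted K))

  without : ∀ {K} → Fin K → List (Fin K)
  without {suc K} fz     = map fs (fins K)
  without {suc K} (fs r) = fz ∷ map fs (without r)

  module ListProducts (R : CRing) where
    open CommutativeRing R hiding (zero)
    open ListAlgebra R
    open import Relation.Binary.Reasoning.Setoid setoid
    open IntegerSolver R
    open import Algebra.Properties.Ring ring using (-0#≈0#; -‿distribˡ-*)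

    keep : ∀ {P : Set} → Dec P → Carrier → Carrier
    keep p x = if does p then x else 1#

    keep-yes : ∀ {P : Set} (p : Dec P) {x} → P → keep p x ≡ x
    keep-yes (yes _) _ = ≡.refl
    keep-yes (no ¬p) p = ⊥-elim (¬p p)

    keep-no : ∀ {P : Set} (p : Dec P) {x} → ¬ P → keep p x ≡ 1#
    keep-no (yes p) ¬p = ⊥-elim (¬p p)
    keep-no (no _)  _  = ≡.refl

    ∏-filter : ∀ {I : Set} {Q : I → Set} (Q? : ∀ i → Dec (Q i)) (f : I → Carrier) is →
      ∏ f (filter Q? is) ≈ ∏ (λ i → keep (Q? i) (f i)) is
    ∏-filter Q? f []       = refl
    ∏-filter Q? f (i ∷ is) with does (Q? i)
    ... | true  = *-congˡ (∏-filter Q? f is)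
    ... | false = trans (∏-filter Q? f is) (sym (*-identityˡ _))

    ∏-++ : ∀ {I : Set} (f : I → Carrier) is js → ∏ f (is ++ js) ≈ ∏ f is * ∏ f js
    ∏-++ f []       js = sym (*-identityˡ _)
    ∏-++ f (i ∷ is) js = trans (*-congˡ (∏-++ f is js)) (sym (*-assoc _ _ _))

    ∏-cong-All : ∀ {I : Set} {f g : I → Carrier} {is} → All (λ i → f i ≈ g i) is → ∏ f is ≈ ∏ g is
    ∏-cong-All []       = refl
    ∏-cong-All (e ∷ es) = *-cong e (∏-cong-All es)

    ∏-pairs : ∀ {I J : Set} (f : I × J → Carrier) is js → ∏ f (cartesianProduct is js) ≈ ∏ (λ i → ∏ (λ j → f (i , j)) js) is
    ∏-pairs f []       js = refl
    ∏-pairs f (i ∷ is) js = trans (∏-++ f (map (i ,_) js) _) (*-cong (∏-map f (i ,_) js) (∏-pairs f is js))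

    pairwise : ∀ {I : Set} → (I → I → Carrier) → List I → Carrier
    pairwise g []       = 1#
    pairwise g (i ∷ is) = ∏ (g i) is * pairwise g is

    pairwise-cong : ∀ {I : Set} {g h : I → I → Carrier} → (∀ i j → g i j ≈ h i j) → ∀ is → pairwise g is ≈ pairwise h is
    pairwise-cong e []       = refl
    pairwise-cong e (i ∷ is) = *-cong (∏-cong (e i) is) (pairwise-cong e is)

    pairwise-map : ∀ {I J : Set} (g : J → J → Carrier) (f : I → J) is → pairwise g (map f is) ≈ pairwise (λ i j → g (f i) (f j)) is
    pairwise-map g f []       = refl
    pairwise-map g f (i ∷ is) = *-cong (∏-map (g (f i)) f is) (pairwise-map g f is)

    ∏-sortedPairs : ∀ {K} (f : Fin K × Fin K → Carrier) is → AllPairs (λ i j → toℕ i < toℕ j) is →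
      ∏ f (filter (λ p → toℕ (proj₁ p) ℕ.<? toℕ (proj₂ p)) (cartesianProduct is is)) ≈ pairwise (λ i j → f (i , j)) is
    ∏-sortedPairs f is srt = trans (∏-filter _ f (cartesianProduct is is)) (trans (∏-pairs _ is is) (go is srt))
      where
      g : _ → _ → Carrier
      g i j = keep (toℕ i ℕ.<? toℕ j) (f (i , j))
      go : ∀ is → AllPairs (λ i j → toℕ i < toℕ j) is → ∏ (λ i → ∏ (g i) is) is ≈ pairwise (λ i j → f (i , j)) is
      go []       []          = refl
      go (i ∷ is) (lt ∷ srt) = *-cong
        (trans (*-cong (reflexive (keep-no (toℕ i ℕ.<? toℕ i) (ℕₚ.<-irrefl ≡.refl)))
                       (∏-cong-All (All.map (λ {j} l → reflexive (keep-yes (toℕ i ℕ.<? toℕ j) l)) lt))) (*-identityˡ _))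
        (trans (∏-cong-All (All.map (λ {j} l → trans (*-congʳ (reflexive (keep-no (toℕ j ℕ.<? toℕ i) (ℕₚ.<⇒≯ l)))) (*-identityˡ _)) lt)) (go is srt))

    ∏-without : ∀ {K} (r : Fin K) (f : Fin K → Carrier) → ∏ (λ t → keep (¬? (t Finₚ.≟ r)) (f t)) (fins K) ≈ ∏ f (without r)
    ∏-without {suc K} fz f = trans (*-cong refl
      (trans (∏-map _ fs (fins K)) (sym (∏-map f fs (fins K)))))
      (*-identityˡ _)
    ∏-without {suc K} (fs r) f = *-cong (reflexive (keep-yes (¬? (fz Finₚ.≟ fs r)) (λ ())))
      (trans (∏-map _ fs (fins K)) (trans (trans (∏-cong (λ i → reflexive (shift i (i Finₚ.≟ r))) (fins K)) (∏-without r (f ∘ fs))) (sym (∏-map f fs (without r)))))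
      where
      shift : ∀ i (d : Dec (i ≡ r)) → keep (¬? (fs i Finₚ.≟ fs r)) (f (fs i)) ≡ keep (¬? d) (f (fs i))
      shift i (yes e) = keep-no (¬? (fs i Finₚ.≟ fs r)) (λ ne → ne (≡.cong fs e))
      shift i (no ne) = keep-yes (¬? (fs i Finₚ.≟ fs r)) (ne ∘ Finₚ.suc-injective)

    pairwise-without : ∀ {K} (r : Fin K) (g : Fin K → Fin K → Carrier) →
      pairwise (λ i j → keep (¬? (i Finₚ.≟ r) ×-dec ¬? (j Finₚ.≟ r)) (g i j)) (fins K) ≈ pairwise g (without r)
    pairwise-without {suc K} fz g = trans (*-cong
        (∏-1 (map fs (fins K)))
        (trans (pairwise-map _ fs (fins K)) (sym (pairwise-map g fs (fins K)))))
      (*-identityˡ _)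
    pairwise-without {suc K} (fs r) g = *-cong
      (trans (∏-map _ fs (fins K)) (trans (trans (∏-cong (λ j → reflexive (first j (j Finₚ.≟ r))) (fins K)) (∏-without r (λ j → g fz (fs j)))) (sym (∏-map (g fz) fs (without r)))))
      (trans (pairwise-map _ fs (fins K)) (trans (trans (pairwise-cong (λ i j → reflexive (shift i j (i Finₚ.≟ r) (j Finₚ.≟ r))) (fins K))
        (pairwise-without r (λ i j → g (fs i) (fs j)))) (sym (pairwise-map g fs (without r)))))
      where
      first : ∀ j (d : Dec (j ≡ r)) → keep (¬? (fz Finₚ.≟ fs r) ×-dec ¬? (fs j Finₚ.≟ fs r)) (g fz (fs j)) ≡ keep (¬? d) (g fz (fs j))
      first j (yes e) = keep-no (¬? (fz Finₚ.≟ fs r) ×-dec ¬? (fs j Finₚ.≟ fs r)) (λ p → proj₂ p (≡.cong fs e))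
      first j (no ne) = keep-yes (¬? (fz Finₚ.≟ fs r) ×-dec ¬? (fs j Finₚ.≟ fs r)) ((λ ()) , ne ∘ Finₚ.suc-injective)
      shift : ∀ i j (d : Dec (i ≡ r)) (d′ : Dec (j ≡ r)) →
        keep (¬? (fs i Finₚ.≟ fs r) ×-dec ¬? (fs j Finₚ.≟ fs r)) (g (fs i) (fs j)) ≡ keep (¬? d ×-dec ¬? d′) (g (fs i) (fs j))
      shift i j (yes e) d′ = keep-no (¬? (fs i Finₚ.≟ fs r) ×-dec ¬? (fs j Finₚ.≟ fs r)) (λ p → proj₁ p (≡.cong fs e))
      shift i j (no ne) (yes e) = keep-no (¬? (fs i Finₚ.≟ fs r) ×-dec ¬? (fs j Finₚ.≟ fs r)) (λ p → proj₂ p (≡.cong fs e))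
      shift i j (no ne) (no ne′) = keep-yes (¬? (fs i Finₚ.≟ fs r) ×-dec ¬? (fs j Finₚ.≟ fs r)) (ne ∘ Finₚ.suc-injective , ne′ ∘ Finₚ.suc-injective)

    module _ (sign : ℕ → Carrier) (sign-0 : sign 0 ≈ 1#) (sign-suc : ∀ t → sign (suc t) ≈ - sign t) where

      -- The statement carries explicit powers of -1 at each position, whereas the signs of `altSum`
      -- arise from its recursion.
      altSum-signed : ∀ {K} (h : Fin K → List (Fin K) → Carrier) → ∑ (λ r → sign (toℕ r) * h r (without r)) (fins K) ≈ altSum h (fins K)
      altSum-signed {zero}  h = refl
      altSum-signed {suc K} h = begin
        sign 0 * h fz rest + ∑ (λ r → sign (toℕ r) * h r (without r)) (map fs (fins K))
          ≈⟨ +-cong (trans (*-congʳ sign-0) (*-identityˡ _)) (Sums.∑-map R _ fs (fins K)) ⟩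
        h fz rest + ∑ (λ r → sign (suc (toℕ r)) * h (fs r) (fz ∷ map fs (without r))) (fins K)
          ≈⟨ +-congˡ (Sums.∑-cong R (λ r → trans (*-congʳ (sign-suc (toℕ r))) (sym (-‿distribˡ-* _ _))) (fins K)) ⟩
        h fz rest + ∑ (λ r → - (sign (toℕ r) * h (fs r) (fz ∷ map fs (without r)))) (fins K)
          ≈⟨ +-congˡ (∑-neg _ (fins K)) ⟩
        h fz rest - ∑ (λ r → sign (toℕ r) * h (fs r) (fz ∷ map fs (without r))) (fins K)
          ≈⟨ +-congˡ (-‿cong (altSum-signed (λ r js → h (fs r) (fz ∷ map fs js)))) ⟩
        h fz rest - altSum (λ r js → h (fs r) (fz ∷ map fs js)) (fins K)
          ≈⟨ +-congˡ (-‿cong (altSum-map (λ j js → h j (fz ∷ js)) fs (fins K))) ⟨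
        altSum h (fz ∷ rest) ∎
        where
        rest = map fs (fins K)
        ∑-neg : ∀ {I : Set} (f : I → Carrier) is → ∑ (λ i → - f i) is ≈ - ∑ f is
        ∑-neg f []       = sym -0#≈0#
        ∑-neg f (i ∷ is) = trans (+-congˡ (∑-neg f is)) (solve 2 (λ a b → :- a :+ :- b := :- (a :+ b)) refl _ _)

-- The closed form of the column factors and the two cases for q.

module Assembly where

  open RingSolving
  open AlternatingSums
  open PowerSeriesTower
  open LittlewoodSeries
  open RowEvolution
  open ColumnExit
  open SeriesRepresentation
  open RowSums
  open PairProducts
  open import Defs as D using (Series; module RHS; magogGF; _^ₛ_; one; maxima; minima; isMagog?; allArrays)
  open import Data.Bool using (if_then_else_)
  open import Data.Empty using (⊥-elim)
  open import Data.Fin using (Fin; toℕ) renaming (zero to fz; suc to fs)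
  import Data.Fin.Properties as Finₚ
  open import Data.Integer as ℤ using (ℤ; +_; -[1+_]; 0ℤ; 1ℤ; -1ℤ)
  import Data.Integer.Properties as ℤₚ
  open import Data.Integer.Solver using (module +-*-Solver)
  open import Data.List using (List; []; _∷_; filter; allFin; cartesianProduct)
  open import Data.List.Relation.Binary.Permutation.Propositional using (_↭_)
  open import Data.Nat as ℕ using (ℕ; zero; suc; _<_; _≤_; s≤s; z≤n; _∸_; _⊔_)
  import Data.Nat.Properties as ℕₚ
  open import Data.Product using (_×_; _,_; proj₁; proj₂)
  open import Data.Sum using (_⊎_; inj₁; inj₂)
  open import Data.Vec.Functional using () renaming (_∷_ to _∷ᶠ_)
  open import Relation.Nullary using (Dec; yes; no; does; ¬_; ¬?)
  open import Relation.Nullary.Decidable using (_×-dec_)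
  import Relation.Binary.PropositionalEquality as ≡
  open ≡ using (_≡_; _≢_)

  indeterminate : Aᴿ.Carrier
  indeterminate = Univariate.indet ℤᴿ

  open T using (∣_∣; PS; coeff; scalar; X; module Op)
  module B = Bounded ℤ⟦P⟧ indeterminate
  open import Algebra.Properties.Semiring.Exp Aᴿ.semiring using (_^_)

  ℤ⟦P⟧-torsionFree : B.TorsionFree
  ℤ⟦P⟧-torsionFree a e n = by (a n) (e n)
    where
    by : ∀ i → i ≡ ℤ.- i → i ≡ 0ℤ
    by (+ zero)  _ = ≡.refl
    by (+ suc _) ()
    by -[1+ _ ]  ()

  rep-^ : ∀ {f F} j → Rep 0 f F → Rep 0 (f ^ₛ j) (F ^ j)
  rep-^ zero    r = rep-one 0
  rep-^ (suc j) r = rep-* 0 r (rep-^ j r)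

  module Factors (N : ℕ) where
    open Op N using (_+_; _*_; -_; _-_; 1#; 0#; _≈_)
    open Substitution N
    open B using (growth; factor; factors)
    open T using (scalarHom)
    private
      module N = Op N
      module S = IntegerSolver (PS N)
      open import Relation.Binary.Reasoning.Setoid N.setoid

    growth-< : ∀ a c → suc c < a → growth a c ≡ Aᴿ.1#
    growth-< (suc (suc a)) zero    lt = ≡.refl
    growth-< (suc zero)    zero    (s≤s ())
    growth-< (suc a)       (suc c) (s≤s lt) = growth-< a c lt

    growth-≡ : ∀ a c → suc c ≡ a → growth a c ≡ indeterminate
    growth-≡ (suc zero)    zero    e = ≡.refl
    growth-≡ (suc a)       (suc c) e = growth-≡ a c (ℕₚ.suc-injective e)

    growth-> : ∀ a c → a ≤ c → growth a c ≡ Aᴿ.0#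
    growth-> zero    c       le = ≡.refl
    growth-> (suc a) (suc c) (s≤s le) = growth-> a c le

    factor-< : ∀ a c → suc (toℕ c) < a → factor N a c ≈ 1# + X c
    factor-< a c lt = N.+-congˡ (N.trans (N.*-congʳ (N.trans (N.reflexive (≡.cong (scalar N) (growth-< a (toℕ c) lt)))
      (Hom.1-homo (scalarHom N)))) (N.*-identityˡ _))

    factor-> : ∀ a c → a ≤ toℕ c → factor N a c ≈ 1#
    factor-> a c le = N.trans (N.+-congˡ (N.trans (N.*-congʳ (N.trans (N.reflexive (≡.cong (scalar N) (growth-> a (toℕ c) le)))
      (Hom.0-homo (scalarHom N)))) (N.zeroˡ _))) (N.+-identityʳ _)

    maximum : Fin N → ∣ N ∣
    maximum c = scalar N indeterminate * X c + 1#

    factor-≡ : ∀ a c → suc (toℕ c) ≡ a → factor N a c ≈ maximum c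
    factor-≡ a c e = N.trans (N.+-comm _ _) (N.+-congʳ (N.*-congʳ (N.reflexive (≡.cong (scalar N) (growth-≡ a (toℕ c) e)))))

    factors-< : ∀ d a c → suc (toℕ c) < a → factors N d a c ≈ binomial c (+ d)
    factors-< zero    a c lt = N.sym (binomial-0 c)
    factors-< (suc d) a c lt = N.trans (N.*-cong (factor-< a c lt) (factors-< d (suc a) c (ℕₚ.m<n⇒m<1+n lt))) (N.sym (binomial-suc c (+ d)))

    -- The column is inactive for g rows, newest in one row, and an ordinary active column in the d
    -- rows that follow.
    factors-≥ : ∀ g d a c → suc (toℕ c) ≡ a ℕ.+ g → factors N (suc g ℕ.+ d) a c ≈ binomial c (+ d) * maximum c
    factors-≥ zero    d a c e = N.trans (N.*-cong (factor-≡ a c e′) (factors-< d (suc a) c (s≤s (ℕₚ.≤-reflexive e′)))) (N.*-comm _ _)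
      where e′ = ≡.trans e (ℕₚ.+-identityʳ a)
    factors-≥ (suc g) d a c e = N.trans (N.*-congʳ (factor-> a c (≡.subst (a ≤_) (≡.sym (ℕₚ.suc-injective (≡.trans e (ℕₚ.+-suc a g)))) (ℕₚ.m≤m+n a g))))
      (N.trans (N.*-identityˡ _) (factors-≥ g d (suc a) c (≡.trans e (ℕₚ.+-suc a g))))

    factors-+ : ∀ d e a c → factors N (d ℕ.+ e) a c ≈ factors N d a c * factors N e (a ℕ.+ d) c
    factors-+ zero    e a c = N.sym (N.trans (N.*-identityˡ _) (N.reflexive (≡.cong (λ x → factors N e x c) (ℕₚ.+-identityʳ a))))
    factors-+ (suc d) e a c = N.trans (N.*-congˡ {factor N a c} (factors-+ d e (suc a) c)) (N.trans (N.sym (N.*-assoc _ _ _))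
      (N.*-congˡ (N.reflexive (≡.cong (λ x → factors N e x c) (≡.sym (ℕₚ.+-suc a d))))))

    module _ (m n : ℕ) (N-def : suc N ≡ m ℕ.+ n) where
      open ListProducts (PS N) using (keep; keep-yes; keep-no)

      ι : Fin N → ℕ
      ι c = suc (toℕ c)

      -- A column with number ι ≥ m is newest in row ι - m, counted from 0, and n + m - ι - 1 rows
      -- follow: this is the exponent that results on the left. A column with ι < m is older than
      -- the newest one from the first row on, so it only contributes (1 + x)^n.
      factors-closed : ∀ c → binomial c (+ n) * keep ((m ⊔ 1) ℕ.≤? ι c) (binomial c (+ m ℤ.- + ι c ℤ.- 1ℤ) * maximum c) ≈ factors N n m c
      factors-closed c = by ((m ⊔ 1) ℕ.≤? ι c)
        where
        by : (d : Dec (m ⊔ 1 ≤ ι c)) → binomial c (+ n) * keep d (binomial c (+ m ℤ.- + ι c ℤ.- 1ℤ) * maximum c) ≈ factors N n m c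
        by (no ¬le) = N.trans (N.*-identityʳ _) (N.sym (factors-< n m c (ℕₚ.≰⇒> (λ le → ¬le (ℕₚ.⊔-lub le (s≤s z≤n))))))
        by (yes le) = begin
          binomial c (+ n) * (binomial c (+ m ℤ.- + ι c ℤ.- 1ℤ) * maximum c)
            ≈⟨ N.*-assoc _ _ _ ⟨
          binomial c (+ n) * binomial c (+ m ℤ.- + ι c ℤ.- 1ℤ) * maximum c
            ≈⟨ N.*-congʳ (binomial-+ c n (+ m ℤ.- + ι c ℤ.- 1ℤ)) ⟩
          binomial c (+ n ℤ.+ (+ m ℤ.- + ι c ℤ.- 1ℤ)) * maximum c
            ≡⟨ ≡.cong (λ z → binomial c z * maximum c) exponent ⟩
          binomial c (+ d) * maximum c
            ≈⟨ factors-≥ g d m c ι≡ ⟨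
          factors N (suc g ℕ.+ d) m c
            ≡⟨ ≡.cong (λ x → factors N x m c) n≡ ⟩
          factors N n m c ∎
          where
          g d : ℕ
          g = ι c ∸ m
          d = n ∸ suc g
          ι≡ : ι c ≡ m ℕ.+ g
          ι≡ = ≡.sym (ℕₚ.m+[n∸m]≡n (ℕₚ.≤-trans (ℕₚ.m≤m⊔n m 1) le))
          g<n : g < n
          g<n = ℕₚ.+-cancelˡ-< m g n (≡.subst₂ _<_ ι≡ N-def (s≤s (Finₚ.toℕ<n c)))
          n≡ : suc g ℕ.+ d ≡ n
          n≡ = ℕₚ.m+[n∸m]≡n g<n
          exponent : + n ℤ.+ (+ m ℤ.- + ι c ℤ.- 1ℤ) ≡ + d
          exponent = ≡.trans (≡.cong₂ (λ x y → x ℤ.+ (+ m ℤ.- y ℤ.- 1ℤ))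
              (≡.trans (≡.cong +_ (≡.sym n≡)) (ℤₚ.pos-+ (suc g) d)) (≡.trans (≡.cong +_ ι≡) (ℤₚ.pos-+ m g)))
            (solve 3 (λ x y z → (con (+ 1) :+ x) :+ y :+ (z :- (z :+ x) :- con (+ 1)) := y) ≡.refl (+ g) (+ d) (+ m))
            where open +-*-Solver

  module ConstantTerm (m n b q : ℕ) (k≤n : suc b ≤ n) (q≤ : q ≤ n ∸ suc b ℕ.+ 1) where

    private
      k : ℕ
      k = suc b

    N : ℕ
    N = m ℕ.+ n ∸ 1

    N-def : suc N ≡ m ℕ.+ n
    N-def = ≡.trans (ℕₚ.+-comm 1 N) (ℕₚ.m∸n+n≡m (ℕₚ.≤-trans (ℕₚ.≤-trans (s≤s z≤n) k≤n) (ℕₚ.m≤n+m n m)))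

    open Op N using (_+_; _*_; -_; _-_; 1#; 0#; _≈_)
    open Substitution N
    open Factors N
    open B using (factors; evolve; expansion; expansionPick; expansionTerm; evolve-∏)
    open ListAlgebra (PS N) using (∏; ∑; altSum; ∏-cong; ∏-*; ∏-↭; ∏-1; altSum-cong; altSum-scale)
    open ListProducts (PS N)
    open T using (scalarHom; geo; gp; littlewood; module Lw; module V)
    private
      module N = Op N
      module S = IntegerSolver (PS N)
      open module GN = FiniteSums (PS N) using (guard; guard-⇔; ∑-filter; ∑-0; ∑-cong)
      module R = RHS m n (suc b) q
      open import Relation.Binary.Reasoning.Setoid N.setoid

      xs : List (Fin N)
      xs = allFin N

      fins≡ : allFin N ≡ fins N
      fins≡ = ≡.sym (fins≡allFin N)

      pairsOf : List (Fin N) → List (Fin N × Fin N)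
      pairsOf l = filter (λ p → toℕ (proj₁ p) ℕ.<? toℕ (proj₂ p)) (cartesianProduct l l)

      ∏-pairsOf : ∀ f → ∏ f (pairsOf xs) ≈ pairwise (λ i j → f (i , j)) (fins N)
      ∏-pairsOf f = N.trans (N.reflexive (≡.cong (λ l → ∏ f (pairsOf l)) fins≡)) (∏-sortedPairs f (fins N) (fins-sorted N))

      ∏-xs : ∀ f → ∏ f xs ≈ ∏ f (fins N)
      ∏-xs f = N.reflexive (≡.cong (∏ f) fins≡)

      vandermonde≈ : ∀ is → pairwise (λ i j → X j - X i) is ≈ V.vandermonde N is
      vandermonde≈ []       = N.refl
      vandermonde≈ (i ∷ is) = N.*-congˡ (vandermonde≈ is)

      cauchy≈ : ∀ is → ∏ geo is * pairwise gp is ≈ Lw.cauchy N is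
      cauchy≈ []       = N.*-identityˡ _
      cauchy≈ (i ∷ is) = N.trans
        (S.solve 4 (λ a b c d → a S.:* b S.:* (c S.:* d) S.:= a S.:* c S.:* (b S.:* d)) N.refl (geo i) (∏ geo is) (∏ (gp i) is) (pairwise gp is))
        (N.*-congˡ (cauchy≈ is))

      freeMax : Aᴿ.Carrier
      freeMax = if does (m ℕ.≟ 0) then indeterminate else Aᴿ.1#

      rep-Pm0 : Rep N R.Pm0 (scalar N freeMax)
      rep-Pm0 = by (m ℕ.≟ 0)
        where
        by : (d : Dec (m ≡ 0)) → Rep N (if does d then R.P else one) (scalar N (if does d then indeterminate else Aᴿ.1#))
        by (yes _) = rep-P N
        by (no _)  = rep-≈ N (N.sym (Hom.1-homo (scalarHom N))) (rep-one N)

      lower? : ∀ (t : Fin N) → Dec (m ⊔ 1 ≤ suc (toℕ t))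
      lower? t = (m ⊔ 1) ℕ.≤? suc (toℕ t)

      upperPart lowerPart : Fin N → ∣ N ∣
      upperPart t = binomial t (+ n) * geo t
      lowerPart t = binomial t (+ m ℤ.- + suc (toℕ t) ℤ.- 1ℤ) * maximum t

      prefix : ∣ N ∣
      prefix = scalar N freeMax * ∏ upperPart xs * ∏ lowerPart (filter lower? xs) * ∏ (λ p → gp (proj₁ p) (proj₂ p)) (pairsOf xs)

      rep-prefix : Rep N (R.common D.*ₛ R.cauchy) prefix
      rep-prefix = rep-* N (rep-* N (rep-* N rep-Pm0
          (rep-prodL N xs (λ t → rep-* N (rep-onePlusPow t (+ n)) (rep-geom t))))
          (rep-prodL N (filter lower? xs) (λ t → rep-* N (rep-onePlusPow t (+ m ℤ.- + suc (toℕ t) ℤ.- 1ℤ)) (rep-+ N (rep-* N (rep-P N) (rep-X N t)) (rep-one N)))))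
        (rep-prodL N (pairsOf xs) (λ p → rep-geomPair (proj₁ p) (proj₂ p)))

      allFactors : ∣ N ∣
      allFactors = ∏ (factors N n m) (fins N)

      prefix≈ : prefix ≈ scalar N freeMax * (allFactors * Lw.cauchy N (fins N))
      prefix≈ = begin
        prefix
          ≈⟨ N.*-cong (N.*-cong (N.*-congˡ {scalar N freeMax} (N.trans (∏-xs upperPart) (∏-* (λ t → binomial t (+ n)) geo (fins N))))
               (N.trans (∏-filter lower? lowerPart xs) (∏-xs _))) (∏-pairsOf _) ⟩
        scalar N freeMax * (∏ (λ t → binomial t (+ n)) (fins N) * ∏ geo (fins N)) * ∏ (λ t → keep (lower? t) (lowerPart t)) (fins N) * pairwise gp (fins N)
          ≈⟨ S.solve 5 (λ s b g l p → s S.:* (b S.:* g) S.:* l S.:* p S.:= s S.:* ((b S.:* l) S.:* (g S.:* p))) N.refl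
               (scalar N freeMax) (∏ (λ t → binomial t (+ n)) (fins N)) (∏ geo (fins N)) (∏ (λ t → keep (lower? t) (lowerPart t)) (fins N)) (pairwise gp (fins N)) ⟩
        scalar N freeMax * ((∏ (λ t → binomial t (+ n)) (fins N) * ∏ (λ t → keep (lower? t) (lowerPart t)) (fins N)) * (∏ geo (fins N) * pairwise gp (fins N)))
          ≈⟨ N.*-congˡ {scalar N freeMax} (N.*-cong (N.trans (N.sym (∏-* _ _ (fins N))) (∏-cong (factors-closed m n N-def) (fins N))) (cauchy≈ (fins N))) ⟩
        scalar N freeMax * (allFactors * Lw.cauchy N (fins N)) ∎

      vandermonde-rep : Rep N R.vand (∏ (λ p → X (proj₂ p) - X (proj₁ p)) (pairsOf xs))
      vandermonde-rep = rep-prodL N (pairsOf xs) (λ p → rep-sub N (rep-X N (proj₂ p)) (rep-X N (proj₁ p)))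

      distinct? : ∀ r (p : Fin N × Fin N) → Dec (¬ proj₁ p ≡ r × ¬ proj₂ p ≡ r)
      distinct? r p = ¬? (proj₁ p Finₚ.≟ r) ×-dec ¬? (proj₂ p Finₚ.≟ r)

      -- Minus the number n - (k-1+q) of rows from the exit row to the end.
      exponent : ℤ
      exponent = + k ℤ.+ + q ℤ.- + n ℤ.- 1ℤ

      sign : ℕ → ∣ N ∣
      sign t = scalarℤ N (-1ℤ ℤ.^ t)

      exitTerm : Fin N → ∣ N ∣
      exitTerm r = sign (toℕ r) * binomial r exponent * (1# - X r)
        * ∏ (λ t → 1# - X r * X t) (filter (λ t → ¬? (t Finₚ.≟ r)) xs)
        * ∏ (λ p → X (proj₂ p) - X (proj₁ p)) (filter (distinct? r) (pairsOf xs))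

      exits? : ∀ (t : Fin N) → Dec (suc (toℕ t) ℕ.+ 2 ≤ k ℕ.+ m ℕ.+ q)
      exits? t = suc (toℕ t) ℕ.+ 2 ℕ.≤? k ℕ.+ m ℕ.+ q

      exitSum : ∣ N ∣
      exitSum = ∑ exitTerm (filter exits? xs)

      Rterm : Fin N → Series (suc N)
      Rterm r = D.const (-1ℤ ℤ.^ toℕ r)
        D.*ₛ D.onePlusPow (fs r) (+ k ℤ.+ + q ℤ.- + n ℤ.- 1ℤ)
        D.*ₛ (one D.-ₛ R.x r)
        D.*ₛ D.prodL (filter (λ t → ¬? (t Finₚ.≟ r)) R.xs) (λ t → one D.-ₛ R.x r D.*ₛ R.x t)
        D.*ₛ R.vandWithout r

      exitSum-rep : Rep N (D.sumL (filter exits? R.xs) Rterm) exitSum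
      exitSum-rep = rep-sumL N (filter exits? xs) (λ r →
        rep-* N (rep-* N (rep-* N (rep-* N (rep-const N (-1ℤ ℤ.^ toℕ r)) (rep-onePlusPow r exponent))
          (rep-sub N (rep-one N) (rep-X N r)))
          (rep-prodL N (filter (λ t → ¬? (t Finₚ.≟ r)) xs) (λ t → rep-sub N (rep-one N) (rep-* N (rep-X N r) (rep-X N t)))))
          (rep-prodL N (filter (distinct? r) (pairsOf xs)) (λ p → rep-sub N (rep-X N (proj₂ p)) (rep-X N (proj₁ p)))))

      exitBody : Fin N → List (Fin N) → ∣ N ∣
      exitBody r js = (1# - X r) * ∏ (λ t → 1# - X r * X t) js

      exitTerm≈ : ∀ r → exitTerm r ≈ sign (toℕ r) * (binomial r exponent * exitBody r (without r) * V.vandermonde N (without r))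
      exitTerm≈ r = begin
        exitTerm r
          ≈⟨ N.*-cong (N.*-congˡ {sign (toℕ r) * binomial r exponent * (1# - X r)}
               (N.trans (∏-filter _ _ xs) (N.trans (∏-xs _) (∏-without r _))))
               (N.trans (∏-filter (distinct? r) _ (pairsOf xs)) (N.trans (∏-pairsOf _) (N.trans (pairwise-without r _) (vandermonde≈ (without r))))) ⟩
        sign (toℕ r) * binomial r exponent * (1# - X r) * ∏ (λ t → 1# - X r * X t) (without r) * V.vandermonde N (without r)
          ≈⟨ S.solve 5 (λ s b x p v → s S.:* b S.:* x S.:* p S.:* v S.:= s S.:* (b S.:* (x S.:* p) S.:* v)) N.refl
               (sign (toℕ r)) (binomial r exponent) (1# - X r) (∏ (λ t → 1# - X r * X t) (without r)) (V.vandermonde N (without r)) ⟩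
        sign (toℕ r) * (binomial r exponent * exitBody r (without r) * V.vandermonde N (without r)) ∎

      sign-suc : ∀ t → sign (suc t) ≈ - sign t
      sign-suc t = N.trans (Hom.⟦⟧-cong (scalarHom N) (λ { zero → ℤₚ.-1*i≡-i (-1ℤ ℤ.^ t) ; (suc _) → ≡.refl }))
        (Hom.neg-homo (scalarHom N) (Univariate.constant ℤᴿ (-1ℤ ℤ.^ t)))

      module _ (M d : ℕ) (M-def : b ℕ.+ q ℕ.+ m ≡ suc M) (d-def : b ℕ.+ q ℕ.+ d ≡ n) where

        s : ℕ
        s = b ℕ.+ q

        -- So the upper limit k + m + q - 2 of the sum R is `M`, one less than the number of active
        -- columns in the exit row.
        k+m+q : k ℕ.+ m ℕ.+ q ≡ suc (suc M)
        k+m+q = ≡.cong suc (≡.trans (ℕₚ.+-assoc b m q) (≡.trans (≡.cong (λ x → b ℕ.+ x) (ℕₚ.+-comm m q)) (≡.trans (≡.sym (ℕₚ.+-assoc b q m)) M-def)))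

        exits⇒< : ∀ (t : Fin N) → suc (toℕ t) ℕ.+ 2 ≤ k ℕ.+ m ℕ.+ q → toℕ t < M
        exits⇒< t le = ℕ.s≤s⁻¹ (ℕ.s≤s⁻¹ (≡.subst₂ _≤_ (ℕₚ.+-comm (suc (toℕ t)) 2) k+m+q le))

        <⇒exits : ∀ (t : Fin N) → toℕ t < M → suc (toℕ t) ℕ.+ 2 ≤ k ℕ.+ m ℕ.+ q
        <⇒exits t lt = ≡.subst₂ _≤_ (≡.sym (ℕₚ.+-comm (suc (toℕ t)) 2)) (≡.sym k+m+q) (s≤s (s≤s lt))

        chosen : Fin N → List (Fin N) → ∣ N ∣
        chosen r js = guard (toℕ r ℕ.<? M) (binomial r exponent)

        exitSum≈ : exitSum ≈ altSum (λ r js → chosen r js * exitBody r js * V.vandermonde N js) (fins N)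
        exitSum≈ = begin
          exitSum
            ≈⟨ ∑-filter exits? exitTerm xs ⟩
          ∑ (λ r → guard (exits? r) (exitTerm r)) xs
            ≡⟨ ≡.cong (∑ (λ r → guard (exits? r) (exitTerm r))) fins≡ ⟩
          ∑ (λ r → guard (exits? r) (exitTerm r)) (fins N)
            ≈⟨ ∑-cong (λ r → N.trans (guard-⇔ (exits? r) (toℕ r ℕ.<? M) (exits⇒< r) (<⇒exits r) (λ _ → exitTerm≈ r)) (inside r (toℕ r ℕ.<? M))) (fins N) ⟩
          ∑ (λ r → sign (toℕ r) * (chosen r (without r) * exitBody r (without r) * V.vandermonde N (without r))) (fins N)
            ≈⟨ altSum-signed sign (scalar-1 N) sign-suc (λ r js → chosen r js * exitBody r js * V.vandermonde N js) ⟩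
          altSum (λ r js → chosen r js * exitBody r js * V.vandermonde N js) (fins N) ∎
          where
          inside : ∀ r (p : Dec (toℕ r < M)) → guard p (sign (toℕ r) * (binomial r exponent * exitBody r (without r) * V.vandermonde N (without r)))
            ≈ sign (toℕ r) * (guard p (binomial r exponent) * exitBody r (without r) * V.vandermonde N (without r))
          inside r (yes _) = N.refl
          inside r (no _)  = S.solve 3 (λ s e v → S.con (+ 0) S.:= s S.:* (S.con (+ 0) S.:* e S.:* v)) N.refl
            (sign (toℕ r)) (exitBody r (without r)) (V.vandermonde N (without r))

        late early : ∣ N ∣
        late  = ∏ (factors N d (suc M)) (fins N)
        early = ∏ (factors N s m) (fins N)

        allFactors≈ : allFactors ≈ early * late
        allFactors≈ = N.trans (∏-cong (λ c → N.trans (N.reflexive (≡.cong (λ x → factors N x m c) (≡.sym d-def)))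
            (N.trans (factors-+ s d m c) (N.*-congˡ {factors N s m c} (N.reflexive (≡.cong (λ a → factors N d a c) (≡.trans (ℕₚ.+-comm m s) M-def)))))) (fins N))
          (∏-* (factors N s m) (factors N d (suc M)) (fins N))

        -- Since r < M, the leaving column contributes exactly (1 + x_r)^d to `late`, and the power
        -- of 1 + x_r in R is its inverse; what is left are the factors of the other columns.
        late*chosen : ∀ r js → (r ∷ js) ↭ fins N → late * (chosen r js * littlewood N js) ≈ expansionPick N d M r js
        late*chosen r js p = by (toℕ r ℕ.<? M)
          where
          by : (c : Dec (toℕ r < M)) → late * (guard c (binomial r exponent) * littlewood N js) ≈ guard c (expansionTerm N d M r js)
          by (no _)   = S.solve 2 (λ a b → a S.:* (S.con (+ 0) S.:* b) S.:= S.con (+ 0)) N.refl late (littlewood N js)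
          by (yes lt) = begin
            late * (binomial r exponent * littlewood N js)
              ≈⟨ N.*-congʳ (∏-↭ (factors N d (suc M)) p) ⟨
            factors N d (suc M) r * ∏ (factors N d (suc M)) js * (binomial r exponent * littlewood N js)
              ≈⟨ S.solve 4 (λ a b c e → a S.:* b S.:* (c S.:* e) S.:= (a S.:* c) S.:* (b S.:* e)) N.refl
                   (factors N d (suc M) r) (∏ (factors N d (suc M)) js) (binomial r exponent) (littlewood N js) ⟩
            (factors N d (suc M) r * binomial r exponent) * expansionTerm N d M r js
              ≈⟨ N.*-congʳ {expansionTerm N d M r js} (N.trans (N.*-congʳ (factors-< d (suc M) r (s≤s lt))) (N.trans (binomial-+ r d exponent)
                   (N.trans (N.reflexive (≡.cong (binomial r) cancel)) (binomial-0 r)))) ⟩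
            1# * expansionTerm N d M r js
              ≈⟨ N.*-identityˡ _ ⟩
            expansionTerm N d M r js ∎
            where
            cancel : + d ℤ.+ exponent ≡ + 0
            cancel = ≡.trans (≡.cong (λ x → + d ℤ.+ (+ k ℤ.+ + q ℤ.- x ℤ.- 1ℤ))
                (≡.trans (≡.cong +_ (≡.sym d-def)) (≡.trans (ℤₚ.pos-+ s d) (≡.cong (λ y → y ℤ.+ + d) (ℤₚ.pos-+ b q)))))
              (solve 3 (λ d b q → d :+ ((con (+ 1) :+ b) :+ q :- ((b :+ q) :+ d) :- con (+ 1)) := con (+ 0)) ≡.refl (+ d) (+ b) (+ q))
              where open +-*-Solver

        expansion≈ : prefix * exitSum ≈ scalar N freeMax * evolve N s m (expansion N d M)
        expansion≈ = begin
          prefix * exitSum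
            ≈⟨ N.*-cong prefix≈ exitSum≈ ⟩
          scalar N freeMax * (allFactors * C) * A
            ≈⟨ S.solve 4 (λ f a c r → f S.:* (a S.:* c) S.:* r S.:= f S.:* (a S.:* (c S.:* r))) N.refl (scalar N freeMax) allFactors C A ⟩
          scalar N freeMax * (allFactors * (C * A))
            ≈⟨ N.*-congˡ {scalar N freeMax} (N.*-cong allFactors≈ (Lw.cauchy*altSum N chosen (fins N))) ⟩
          scalar N freeMax * (early * late * altSum (λ r js → chosen r js * littlewood N js) (fins N))
            ≈⟨ N.*-congˡ {scalar N freeMax} (N.trans (N.*-assoc early late _) (N.*-congˡ {early}
                 (N.trans (altSum-scale late _ (fins N)) (altSum-cong (fins N) late*chosen)))) ⟩
          scalar N freeMax * (early * expansion N d M)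
            ≈⟨ N.*-congˡ {scalar N freeMax} (evolve-∏ N s m (expansion N d M)) ⟨
          scalar N freeMax * evolve N s m (expansion N d M) ∎
          where
          C A : ∣ N ∣
          C = Lw.cauchy N (fins N)
          A = altSum (λ r js → chosen r js * exitBody r js * V.vandermonde N js) (fins N)

      littlewood≈ : prefix * ∏ (λ p → X (proj₂ p) - X (proj₁ p)) (pairsOf xs) ≈ scalar N freeMax * evolve N n m (littlewood N (fins N))
      littlewood≈ = begin
        prefix * ∏ (λ p → X (proj₂ p) - X (proj₁ p)) (pairsOf xs)
          ≈⟨ N.*-cong prefix≈ (N.trans (∏-pairsOf _) (vandermonde≈ (fins N))) ⟩
        scalar N freeMax * (allFactors * Lw.cauchy N (fins N)) * V.vandermonde N (fins N)
          ≈⟨ S.solve 4 (λ f a c r → f S.:* (a S.:* c) S.:* r S.:= f S.:* (a S.:* (c S.:* r))) N.refl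
               (scalar N freeMax) allFactors (Lw.cauchy N (fins N)) (V.vandermonde N (fins N)) ⟩
        scalar N freeMax * (allFactors * littlewood N (fins N))
          ≈⟨ N.*-congˡ {scalar N freeMax} (evolve-∏ N n m (littlewood N (fins N))) ⟨
        scalar N freeMax * evolve N n m (littlewood N (fins N)) ∎

      target : Fin N → ℕ
      target i = b ℕ.+ toℕ i

      constTerm-rep : ∀ f {G} → Rep N f G → ∀ e → f (e ∷ᶠ (λ t → toℕ t ℕ.+ b)) ≡ coeff N G target e
      constTerm-rep f {G} r e = ≡.trans (r _) (≡.cong (λ h → h e) (T.coeff-≗ N G (λ t → ℕₚ.+-comm (toℕ t) b)))

      module E = Enumeration ℤ⟦P⟧ indeterminate m n b q N k≤n q≤ N-def

      magogGF≡ : ∀ e → magogGF m n k q e ≡ (freeMax Aᴿ.* E.rows n 0 (λ _ → 0)) (e fz)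
      magogGF≡ e = ≡.trans
        (rep-sumL 0 {F = λ M → indeterminate ^ maxima m n M}
          (filter (λ M → isMagog? m n k M ×-dec (minima n k M ℕ.≟ q)) (allArrays m n)) (λ M → rep-^ (maxima m n M) (rep-P 0)) e)
        (E.∑-trapezoids (e fz))

      finish : ∀ g {G} → Rep N g G → (H : ∣ N ∣) → prefix * G ≈ scalar N freeMax * H → E.rows n 0 (λ _ → 0) Aᴿ.≈ coeff N H target →
        ∀ e → magogGF m n k q e ≡ (R.common D.*ₛ R.cauchy D.*ₛ g) (e fz ∷ᶠ (λ t → toℕ t ℕ.+ b))
      finish g {G} r H G≈ rows≈ e = ≡.trans (magogGF≡ e) (≡.trans (Aᴿ.*-congˡ {freeMax} rows≈ (e fz)) (≡.sym
        (≡.trans (constTerm-rep (R.common D.*ₛ R.cauchy D.*ₛ g) (rep-* N {R.common D.*ₛ R.cauchy} {g} rep-prefix r) (e fz)) (≡.trans (T.coeff-cong N G≈ target (e fz)) (T.coeff-scalar* N freeMax H target (e fz))))))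

    constantTerm : (suc b ≢ 1 ⊎ m ℕ.+ q ≢ 1) → (e : Fin 1 → ℕ) → magogGF m n (suc b) q e ≡ RHS.constTerm m n (suc b) q e
    constantTerm cond e = by (q ℕ.≟ n ∸ k ℕ.+ 1)
      where
      k+[n∸k] : k ℕ.+ (n ∸ k) ≡ n
      k+[n∸k] = ℕₚ.m+[n∸m]≡n k≤n

      vandR : Dec (q ≡ n ∸ k ℕ.+ 1) → Series (suc N)
      vandR d = if does d then R.vand else D.sumL (filter exits? R.xs) Rterm

      by : (d : Dec (q ≡ n ∸ k ℕ.+ 1)) → magogGF m n k q e ≡ (R.common D.*ₛ R.cauchy D.*ₛ vandR d) (e fz ∷ᶠ (λ t → toℕ t ℕ.+ b))
      by (yes q≡) = finish R.vand vandermonde-rep (evolve N n m (littlewood N (fins N))) littlewood≈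
        (E.rows-all-early ℤ⟦P⟧-torsionFree (≡.trans (≡.cong (λ x → b ℕ.+ x) (≡.trans q≡ (ℕₚ.+-comm (n ∸ k) 1))) (≡.trans (ℕₚ.+-suc b (n ∸ k)) k+[n∸k]))) e
      -- This is the number of active columns in the exit row. From 2 on, column 1 leaves as an
      -- older column; up to 1, the sum R is empty.
      by (no q≢) = cases (b ℕ.+ q ℕ.+ m) ≡.refl
        where
        s<n : b ℕ.+ q < n
        s<n = ≡.subst (b ℕ.+ q <_) k+[n∸k] (s≤s (ℕₚ.+-monoʳ-≤ b (ℕ.s≤s⁻¹ (≡.subst (q <_) (ℕₚ.+-comm (n ∸ k) 1) (ℕₚ.≤∧≢⇒< q≤ q≢)))))
        d : ℕ
        d = n ∸ suc (b ℕ.+ q)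
        s+d : b ℕ.+ q ℕ.+ suc d ≡ n
        s+d = ≡.trans (ℕₚ.+-suc (b ℕ.+ q) d) (ℕₚ.m+[n∸m]≡n s<n)
        Goal : Set
        Goal = magogGF m n k q e ≡ (R.common D.*ₛ R.cauchy D.*ₛ D.sumL (filter exits? R.xs) Rterm) (e fz ∷ᶠ (λ t → toℕ t ℕ.+ b))

        -- Here m = q = 0 and k ≤ 2, but then m_{1,1} = 1 forces a minimum.
        nothing : b ℕ.+ q ℕ.+ m ≤ 1 → Goal
        nothing le = finish (D.sumL (filter exits? R.xs) Rterm) exitSum-rep 0#
          (N.trans (N.*-congˡ {prefix} empty) (N.trans (N.zeroʳ prefix) (N.sym (N.zeroʳ (scalar N freeMax)))))
          (Aᴿ.trans (E.rows-empty m≡0 q≡0) (Aᴿ.reflexive (≡.sym (T.coeff-0 N target)))) e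
          where
          split : m ≡ 0 × q ≡ 0
          split = go cond
            where
            q+m≤1 : q ℕ.+ m ≤ 1
            q+m≤1 = ℕₚ.≤-trans (ℕₚ.m≤n+m (q ℕ.+ m) b) (≡.subst (_≤ 1) (ℕₚ.+-assoc b q m) le)
            zeros : m ℕ.+ q ≢ 1 → m ≡ 0 × q ≡ 0
            zeros ne = ℕₚ.m+n≡0⇒m≡0 m m+q≡0 , ℕₚ.m+n≡0⇒n≡0 m m+q≡0
              where
              m+q≡0 : m ℕ.+ q ≡ 0
              m+q≡0 = ℕₚ.n<1⇒n≡0 (ℕₚ.≤∧≢⇒< (≡.subst (_≤ 1) (ℕₚ.+-comm q m) q+m≤1) ne)
            go : suc b ≢ 1 ⊎ m ℕ.+ q ≢ 1 → m ≡ 0 × q ≡ 0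
            go (inj₂ ne) = zeros ne
            go (inj₁ b≢0) = zeros (λ e′ → b≢0 (≡.cong suc (ℕₚ.n≤0⇒n≡0 (ℕ.s≤s⁻¹ (≡.subst (_≤ 1) (≡.trans (≡.cong (λ x → b ℕ.+ x) (≡.trans (ℕₚ.+-comm q m) e′)) (ℕₚ.+-comm b 1))
              (≡.subst (_≤ 1) (ℕₚ.+-assoc b q m) le))))))
          m≡0 = proj₁ split
          q≡0 = proj₂ split
          small : k ℕ.+ m ℕ.+ q ≤ 2
          small = s≤s (≡.subst (_≤ 1) (≡.trans (ℕₚ.+-assoc b q m) (≡.trans (≡.cong (λ x → b ℕ.+ x) (ℕₚ.+-comm q m)) (≡.sym (ℕₚ.+-assoc b m q)))) le)
          empty : exitSum ≈ 0#
          empty = N.trans (∑-filter exits? exitTerm xs) (∑-0 (λ t → N.reflexive (GN.guard-no (exits? t)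
            (λ le′ → ℕₚ.<⇒≱ (ℕₚ.≤-trans (s≤s (ℕₚ.m≤n+m 2 (toℕ t))) le′) small))) xs)

        regular : ∀ M → b ℕ.+ q ℕ.+ m ≡ suc (suc M) → E.rows n 0 (λ _ → 0) Aᴿ.≈ coeff N (evolve N (b ℕ.+ q) m (expansion N (suc d) (suc M))) target
        regular M M-def = go N N-def
          where
          -- Generalised over `N` in order to expose a first column. The value 0 is impossible: b +
          -- q < n, so m + n exceeds b + q + m, which is at least 2.
          go : ∀ N (N-def : suc N ≡ m ℕ.+ n) → Enumeration.rows ℤ⟦P⟧ indeterminate m n b q N k≤n q≤ N-def n 0 (λ _ → 0)
            Aᴿ.≈ coeff N (evolve N (b ℕ.+ q) m (expansion N (suc d) (suc M))) (λ i → b ℕ.+ toℕ i)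
          go zero N-def = ⊥-elim (ℕₚ.<⇒≱ (ℕₚ.≤-<-trans (≡.subst (1 ≤_) (≡.trans (≡.cong ℕ.pred (≡.sym M-def)) ≡.refl) (s≤s z≤n)) (pred< M-def))
            (ℕₚ.≤-reflexive (≡.sym N-def)))
            where
            pred< : b ℕ.+ q ℕ.+ m ≡ suc (suc M) → ℕ.pred (b ℕ.+ q ℕ.+ m) < m ℕ.+ n
            pred< e = ℕₚ.≤-<-trans ℕₚ.pred[n]≤n (≡.subst (b ℕ.+ q ℕ.+ m <_) (ℕₚ.+-comm n m) (ℕₚ.+-monoˡ-< m s<n))
          go (suc K) N-def = Exit.rows-expansion ℤ⟦P⟧ indeterminate m n b q K k≤n q≤ N-def ℤ⟦P⟧-torsionFree (suc M) (s≤s z≤n) M-def d s+d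

        cases : ∀ x → b ℕ.+ q ℕ.+ m ≡ x → Goal
        cases zero          e = nothing (≡.subst (_≤ 1) (≡.sym e) z≤n)
        cases (suc zero)    e = nothing (ℕₚ.≤-reflexive e)
        cases (suc (suc M)) M-def = finish (D.sumL (filter exits? R.xs) Rterm) exitSum-rep (evolve N (b ℕ.+ q) m (expansion N (suc d) (suc M)))
          (expansion≈ (suc M) (suc d) M-def s+d) (regular M M-def) e

open import Defs
open import Data.Nat using (ℕ; zero; suc; _≤_; _+_; _∸_)
open import Data.Fin using (Fin)
open import Data.Sum using (_⊎_)
open import Relation.Binary.PropositionalEquality using (_≡_; _≢_)

theorem4p4 : (m n k q : ℕ) → 1 ≤ k → k ≤ n → q ≤ n ∸ k + 1 →
    (k ≢ 1 ⊎ m + q ≢ 1) →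
    (e : Fin 1 → ℕ) → magogGF m n k q e ≡ RHS.constTerm m n k q e
theorem4p4 m n zero    q () k≤n q≤ cond e
theorem4p4 m n (suc b) q _  k≤n q≤ cond e = Assembly.ConstantTerm.constantTerm m n b q k≤n q≤ cond e
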